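{- Let $V(n)$ be an $r \times d$ matrix and $c(n)$ an $r \times 1$ column vector, all of whose entries are polynomials in $n$ with integer coefficients. For $n$ sufficiently large, let $P(n) = \{x \in \mathbf{R}^d \mid V(n)x \ge c(n)\}$, and assume that for all sufficiently large $n$ this is a (bounded) rational polytope. Then the function $n \mapsto \#(P(n) \cap \mathbf{Z}^d)$ lies in $\mathbf{QP}_{\gg 0}$.
   Context: For vectors $x,y$, $x \ge y$ means $x_i \ge y_i$ for all $i$. A function $f$ defined on all sufficiently large integers with integer values is eventually a quasi-polynomial if there exist a positive integer $s$ and polynomials $f_0,\dots,f_{s-1} \in \mathbf{Q}[t]$ such that $f(n) = f_i(n)$ for all sufficiently large $n$ with $n \equiv i \pmod s$. $\mathbf{QP}_{\gg 0}$ denotes the set of such functions. -}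

module Defs where

open import Data.Nat as ℕ using (ℕ; zero; suc)
open import Data.Integer as ℤ using (ℤ; +_)
open import Data.Rational as ℚ using (ℚ; 0ℚ)
open import Data.Fin using (Fin)
open import Data.List using (List; []; _∷_; length)
open import Data.List.Membership.Propositional using (_∈_)
open import Data.List.Relation.Unary.Unique.Propositional using (Unique)
open import Data.Product using (Σ; ∃; _×_; _,_)
open import Function.Bundles using (_⇔_)

-- Polynomials as coefficient lists [a₀, a₁, …] meaning a₀ + a₁ t + a₂ t² + …
ZPoly : Set
ZPoly = List ℤ

QPoly : Set
QPoly = List ℚ

evalℤ : ZPoly → ℤ → ℤ
evalℤ []       t = + 0
evalℤ (a ∷ as) t = a ℤ.+ t ℤ.* evalℤ as t

evalℚ : QPoly → ℚ → ℚ
evalℚ []       t = 0ℚ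
evalℚ (a ∷ as) t = a ℚ.+ t ℚ.* evalℚ as t

ℤtoℚ : ℤ → ℚ
ℤtoℚ z = z ℚ./ 1

ℕtoℚ : ℕ → ℚ
ℕtoℚ m = ℤtoℚ (+ m)

sumℤ : (d : ℕ) → (Fin d → ℤ) → ℤ
sumℤ zero    f = + 0
sumℤ (suc d) f = f Fin.zero ℤ.+ sumℤ d (λ j → f (Fin.suc j))
  where import Data.Fin as Fin

sumℚ : (d : ℕ) → (Fin d → ℚ) → ℚ
sumℚ zero    f = 0ℚ
sumℚ (suc d) f = f Fin.zero ℚ.+ sumℚ d (λ j → f (Fin.suc j))
  where import Data.Fin as Fin

PolyMatrix : ℕ → ℕ → Set
PolyMatrix r d = Fin r → Fin d → ZPoly

PolyVector : ℕ → Set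
PolyVector r = Fin r → ZPoly

InPℚ : ∀ {r d} → PolyMatrix r d → PolyVector r → ℕ → (Fin d → ℚ) → Set
InPℚ {r} {d} V c n x =
  ∀ (i : Fin r) →
    ℤtoℚ (evalℤ (c i) (+ n)) ℚ.≤ sumℚ d (λ j → ℤtoℚ (evalℤ (V i j) (+ n)) ℚ.* x j)

InPℤ : ∀ {r d} → PolyMatrix r d → PolyVector r → ℕ → (Fin d → ℤ) → Set
InPℤ {r} {d} V c n x =
  ∀ (i : Fin r) → evalℤ (c i) (+ n) ℤ.≤ sumℤ d (λ j → evalℤ (V i j) (+ n) ℤ.* x j)

BoundedP : ∀ {r d} → PolyMatrix r d → PolyVector r → ℕ → Set
BoundedP {r} {d} V c n =
  ∃ λ (B : ℚ) → ∀ (x : Fin d → ℚ) → InPℚ V c n x → ∀ (j : Fin d) → ℚ.∣ x j ∣ ℚ.≤ B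

open import Data.Vec using (Vec; lookup)

HasIntPointCount : ∀ {r d} → PolyMatrix r d → PolyVector r → ℕ → ℕ → Set
HasIntPointCount {r} {d} V c n k =
  Σ (List (Vec ℤ d)) λ L →
    Unique L × (∀ (x : Vec ℤ d) → (x ∈ L ⇔ InPℤ V c n (lookup x))) × length L ≡ k
  where open import Relation.Binary.PropositionalEquality using (_≡_)

{-# OPTIONS --safe #-}
module Submission where

-- Fourier–Motzkin elimination over the germs at infinity of integer polynomials shows that the coordinates of the
-- points of P(n) are at most n^k in absolute value.  After the shift x ↦ x + n^k, expand every coordinate in base n:
-- a constraint becomes ∑ n^l L_l(y) ≥ 0 with affine forms L_l, free of n, in the digits y.  Since L_l(y) = O(n), the
-- possible carries are finitely many, so that the constraint is a finite disjunction of systems of inequalities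
-- between affine forms in (y, n) with constant coefficients.  It remains to sum a polynomial times indicators of
-- such inequalities over a box, one variable at a time: once n and the remaining variables are restricted to fixed
-- residue classes modulo the coefficients of the summation variable x, all bounds on x are integral affine forms,
-- and the sum over x is again of the same shape, by case distinction on the largest lower and the smallest upper
-- bound and by the discrete antiderivative of falling factorials.  When no variable is left, only indicators of
-- an + b ≥ 0 remain, which are eventually constant.

open import Defs
open import Data.Nat using (ℕ; _≥_; NonZero)
open import Data.Fin using (Fin)
open import Data.Nat.DivMod using (_mod_)
open import Data.Product using (Σ; ∃; _×_)
open import Relation.Binary.PropositionalEquality using (_≡_)
import Data.Rational as ℚ
import Data.Rational.Properties as ℚP
import Tactic.RingSolver as RS
open import Tactic.RingSolver.Core.AlmostCommutativeRing using (AlmostCommutativeRing; fromCommutativeRing)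
open import Level using (0ℓ)
open import Relation.Nullary.Decidable using (dec⇒maybe)

-- The constraint matrix depends on n, so products such as n x are not affine, and solving a
-- constraint for one coordinate would divide by a polynomial in n. Digits remove this: all growth
-- with n moves into the place values, only divisions by constants remain, and these become exact on
-- residue classes modulo a fixed number. The number of digits must not depend on n, hence the need
-- for one fixed power of n bounding P(n), whereas the hypothesis gives an unspecified bound for
-- each n. Extracting the power needs a point of P(n), because an empty system says nothing about
-- the signs of its rows; so emptiness is decided for all large n at once, which is constructive
-- since a polynomial has a computable sign for large n. The forms in the digits take the parameter
-- m = n - 1: the digits then run over 0, ..., m, and both ends of every range are affine in the
-- parameter. In each elimination the summation variable itself runs over all integers of its range;
-- residue classes are imposed only on what remains.

ℚ-ring : AlmostCommutativeRing 0ℓ 0ℓ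
ℚ-ring = fromCommutativeRing ℚP.+-*-commutativeRing λ x → dec⇒maybe (ℚ.0ℚ ℚP.≟ x)

-- The embedding of the integers into the rationals, and reciprocals.

module Embedding where

  open import Data.Nat using (ℕ; suc)
  open import Data.Integer as ℤ using (ℤ; +_)
  import Data.Integer.Properties as ℤP
  open import Data.Integer.Tactic.RingSolver using (solve-∀)
  import Data.Rational.Unnormalised as ℚᵘ
  import Data.Rational.Unnormalised.Properties as ℚᵘP
  open ℚ using (ℚ; 0ℚ; 1ℚ; toℚᵘ)
  open import Relation.Binary.PropositionalEquality

  ι : ℤ → ℚ
  ι = ℤtoℚ

  ι-toℚᵘ : ∀ z → toℚᵘ (ι z) ℚᵘ.≃ ℚᵘ.mkℚᵘ z 0
  ι-toℚᵘ z = ℚP.toℚᵘ-fromℚᵘ (ℚᵘ.mkℚᵘ z 0)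

  ι-+ : ∀ a b → ι (a ℤ.+ b) ≡ ι a ℚ.+ ι b
  ι-+ a b = ℚP.toℚᵘ-injective (begin
      toℚᵘ (ι (a ℤ.+ b))                     ≈⟨ ι-toℚᵘ (a ℤ.+ b) ⟩
      ℚᵘ.mkℚᵘ (a ℤ.+ b) 0                    ≈⟨ ℚᵘ.*≡* (eq a b) ⟩
      ℚᵘ.mkℚᵘ a 0 ℚᵘ.+ ℚᵘ.mkℚᵘ b 0           ≈⟨ ℚᵘP.+-cong (ι-toℚᵘ a) (ι-toℚᵘ b) ⟨
      toℚᵘ (ι a) ℚᵘ.+ toℚᵘ (ι b)             ≈⟨ ℚP.toℚᵘ-homo-+ (ι a) (ι b) ⟨
      toℚᵘ (ι a ℚ.+ ι b)                     ∎)
    where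
    open ℚᵘP.≃-Reasoning
    eq : ∀ a b → (a ℤ.+ b) ℤ.* + 1 ≡ (a ℤ.* + 1 ℤ.+ b ℤ.* + 1) ℤ.* + 1
    eq = solve-∀

  ι-* : ∀ a b → ι (a ℤ.* b) ≡ ι a ℚ.* ι b
  ι-* a b = ℚP.toℚᵘ-injective (begin
      toℚᵘ (ι (a ℤ.* b))                     ≈⟨ ι-toℚᵘ (a ℤ.* b) ⟩
      ℚᵘ.mkℚᵘ a 0 ℚᵘ.* ℚᵘ.mkℚᵘ b 0           ≈⟨ ℚᵘP.*-cong (ι-toℚᵘ a) (ι-toℚᵘ b) ⟨
      toℚᵘ (ι a) ℚᵘ.* toℚᵘ (ι b)             ≈⟨ ℚP.toℚᵘ-homo-* (ι a) (ι b) ⟨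
      toℚᵘ (ι a ℚ.* ι b)                     ∎)
    where open ℚᵘP.≃-Reasoning

  ι-neg : ∀ a → ι (ℤ.- a) ≡ ℚ.- ι a
  ι-neg a = lem (ι (ℤ.- a)) (ι a) (trans (sym (ι-+ (ℤ.- a) a)) (cong ι (ℤP.+-inverseˡ a)))
    where
    r : ∀ x y → x ≡ (x ℚ.+ y) ℚ.+ ℚ.- y
    r = RS.solve-∀ ℚ-ring
    s : ∀ y → 0ℚ ℚ.+ ℚ.- y ≡ ℚ.- y
    s = RS.solve-∀ ℚ-ring
    lem : ∀ x y → x ℚ.+ y ≡ 0ℚ → x ≡ ℚ.- y
    lem x y e = trans (r x y) (trans (cong (ℚ._+ ℚ.- y) e) (s y))

  ι-mono : ∀ {a b} → a ℤ.≤ b → ι a ℚ.≤ ι b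
  ι-mono {a} {b} a≤b = ℚP.toℚᵘ-cancel-≤
    (ℚᵘP.≤-respˡ-≃ (ℚᵘP.≃-sym (ι-toℚᵘ a)) (ℚᵘP.≤-respʳ-≃ (ℚᵘP.≃-sym (ι-toℚᵘ b))
      (ℚᵘ.*≤* (ℤP.*-monoʳ-≤-nonNeg (+ 1) a≤b))))

  ι-cancel : ∀ {a b} → ι a ℚ.≤ ι b → a ℤ.≤ b
  ι-cancel {a} {b} p = ℤP.*-cancelʳ-≤-pos a b (+ 1)
    (ℚᵘP.drop-*≤* (ℚᵘP.≤-respˡ-≃ (ι-toℚᵘ a) (ℚᵘP.≤-respʳ-≃ (ι-toℚᵘ b) (ℚP.toℚᵘ-mono-≤ p))))

  recip : ℕ → ℚ
  recip k = + 1 ℚ./ suc k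

  recip-inverse : ∀ k → ι (+ suc k) ℚ.* recip k ≡ 1ℚ
  recip-inverse k = ℚP.toℚᵘ-injective (begin
      toℚᵘ (ι (+ suc k) ℚ.* recip k)                       ≈⟨ ℚP.toℚᵘ-homo-* (ι (+ suc k)) (recip k) ⟩
      toℚᵘ (ι (+ suc k)) ℚᵘ.* toℚᵘ (recip k)               ≈⟨ ℚᵘP.*-cong (ι-toℚᵘ (+ suc k)) (ℚP.toℚᵘ-fromℚᵘ (ℚᵘ.mkℚᵘ (+ 1) k)) ⟩
      ℚᵘ.mkℚᵘ (+ suc k) 0 ℚᵘ.* ℚᵘ.mkℚᵘ (+ 1) k              ≈⟨ ℚᵘ.*≡* (trans (eq (+ suc k)) (cong (λ t → + 1 ℤ.* + suc t) (sym (ℕP.+-identityʳ k)))) ⟩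
      ℚᵘ.1ℚᵘ                                               ∎)
    where
    open ℚᵘP.≃-Reasoning
    import Data.Nat.Properties as ℕP
    eq : ∀ a → a ℤ.* + 1 ℤ.* + 1 ≡ + 1 ℤ.* a
    eq = solve-∀

  recip-nonneg : ∀ k → 0ℚ ℚ.≤ recip k
  recip-nonneg k = ℚP.nonNegative⁻¹ (recip k) {{ℚP.normalize-nonNeg 1 (suc k)}}

-- Finite sums over intervals and over boxes.

module Sums where

  open import Data.Nat as ℕ using (ℕ; zero; suc; _<_; z<s; s<s; s≤s)
  import Data.Nat.Properties as ℕP
  open import Data.Vec using (Vec; []; _∷_; _++_)
  open import Data.Vec.Relation.Unary.All using (All; []; _∷_)

  open ℚ using (ℚ; 0ℚ; _+_; _*_)
  open import Relation.Binary.PropositionalEquality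
  open ≡-Reasoning

  ∑ : ℕ → (ℕ → ℚ) → ℚ
  ∑ zero    f = 0ℚ
  ∑ (suc b) f = f 0 + ∑ b (λ i → f (suc i))

  ∑-cong-< : ∀ b {f g} → (∀ i → i < b → f i ≡ g i) → ∑ b f ≡ ∑ b g
  ∑-cong-< zero    e = refl
  ∑-cong-< (suc b) e = cong₂ _+_ (e 0 z<s) (∑-cong-< b (λ i i<b → e (suc i) (s<s i<b)))

  ∑-cong : ∀ b {f g} → (∀ i → f i ≡ g i) → ∑ b f ≡ ∑ b g
  ∑-cong b e = ∑-cong-< b (λ i _ → e i)

  ∑-zero : ∀ b {f} → (∀ i → i < b → f i ≡ 0ℚ) → ∑ b f ≡ 0ℚ
  ∑-zero zero    e = refl
  ∑-zero (suc b) e = cong₂ _+_ (e 0 z<s) (∑-zero b (λ i i<b → e (suc i) (s<s i<b)))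

  ∑-+ : ∀ b f g → ∑ b (λ i → f i + g i) ≡ ∑ b f + ∑ b g
  ∑-+ zero    f g = refl
  ∑-+ (suc b) f g = trans (cong (f 0 + g 0 +_) (∑-+ b _ _)) (r (f 0) (g 0) _ _)
    where
    r : ∀ a b c d → (a + b) + (c + d) ≡ (a + c) + (b + d)
    r = RS.solve-∀ ℚ-ring

  ∑-*ˡ : ∀ b c f → ∑ b (λ i → c * f i) ≡ c * ∑ b f
  ∑-*ˡ zero    c f = sym (ℚP.*-zeroʳ c)
  ∑-*ˡ (suc b) c f = trans (cong (c * f 0 +_) (∑-*ˡ b c _)) (sym (ℚP.*-distribˡ-+ c _ _))

  ∑-append : ∀ a b f → ∑ (a ℕ.+ b) f ≡ ∑ a f + ∑ b (λ i → f (a ℕ.+ i))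
  ∑-append zero    b f = sym (ℚP.+-identityˡ _)
  ∑-append (suc a) b f = trans (cong (f 0 +_) (∑-append a b _)) (sym (ℚP.+-assoc (f 0) _ _))

  ∑-swap : ∀ a b (f : ℕ → ℕ → ℚ) → ∑ a (λ i → ∑ b (λ j → f i j)) ≡ ∑ b (λ j → ∑ a (λ i → f i j))
  ∑-swap zero    b f = sym (∑-zero b (λ _ _ → refl))
  ∑-swap (suc a) b f = trans (cong (∑ b (f 0) +_) (∑-swap a b _)) (sym (∑-+ b (f 0) _))

  -- Division with remainder of the index by `M`. It serves twice: for residue classes modulo `M`,
  -- and for splitting off the lowest digit in base `M`.
  ∑-blocks : ∀ m M f → ∑ (m ℕ.* M) f ≡ ∑ m (λ q → ∑ M (λ r → f (r ℕ.+ q ℕ.* M)))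
  ∑-blocks zero    M f = refl
  ∑-blocks (suc m) M f = begin
    ∑ (M ℕ.+ m ℕ.* M) f                                    ≡⟨ ∑-append M (m ℕ.* M) f ⟩
    ∑ M f + ∑ (m ℕ.* M) (λ i → f (M ℕ.+ i))                ≡⟨ cong₂ _+_ (∑-cong M (λ r → cong f (sym (ℕP.+-identityʳ r)))) (∑-blocks m M _) ⟩
    ∑ M (λ r → f (r ℕ.+ 0)) + ∑ m (λ q → ∑ M (λ r → f (M ℕ.+ (r ℕ.+ q ℕ.* M))))
      ≡⟨ cong (∑ M (λ r → f (r ℕ.+ 0)) +_) (∑-cong m (λ q → ∑-cong M (λ r → cong f (eq r (q ℕ.* M))))) ⟩
    ∑ M (λ r → f (r ℕ.+ 0)) + ∑ m (λ q → ∑ M (λ r → f (r ℕ.+ (M ℕ.+ q ℕ.* M)))) ∎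
    where
    eq : ∀ r t → M ℕ.+ (r ℕ.+ t) ≡ r ℕ.+ (M ℕ.+ t)
    eq r t = trans (sym (ℕP.+-assoc M r t)) (trans (cong (ℕ._+ t) (ℕP.+-comm M r)) (ℕP.+-assoc r M t))

  ∑-single : ∀ b j f → j < b → (∀ i → i ≢ j → f i ≡ 0ℚ) → ∑ b f ≡ f j
  ∑-single (suc b) zero    f j<b z =
    trans (cong (f 0 +_) (∑-zero b (λ i _ → z (suc i) (λ ())))) (ℚP.+-identityʳ (f 0))
  ∑-single (suc b) (suc j) f (s≤s j<b) z =
    trans (cong₂ _+_ (z 0 (λ ())) (∑-single b j _ j<b (λ i i≢j → z (suc i) (λ e → i≢j (ℕP.suc-injective e)))))
          (ℚP.+-identityˡ _)

  telescope : ∀ b f (S : ℕ → ℚ) → (∀ i → f i ≡ S (suc i) + ℚ.- S i) → ∑ b f ≡ S b + ℚ.- S 0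
  telescope zero    f S e = sym (ℚP.+-inverseʳ (S 0))
  telescope (suc b) f S e = trans (cong₂ _+_ (e 0) (telescope b _ (λ i → S (suc i)) (λ i → e (suc i)))) (r (S 1) (S 0) (S (suc b)))
    where
    r : ∀ a b c → (a + ℚ.- b) + (c + ℚ.- a) ≡ c + ℚ.- b
    r = RS.solve-∀ ℚ-ring

  -- Sum over {0,…,b-1}^D, the head coordinate being the innermost summation variable.
  box : ℕ → (D : ℕ) → (Vec ℕ D → ℚ) → ℚ
  box b zero    F = F []
  box b (suc D) F = box b D (λ v → ∑ b (λ x → F (x ∷ v)))

  box-cong-< : ∀ b D {F G} → (∀ v → All (_< b) v → F v ≡ G v) → box b D F ≡ box b D G
  box-cong-< b zero    e = e [] []
  box-cong-< b (suc D) e = box-cong-< b D (λ v v<b → ∑-cong-< b (λ x x<b → e (x ∷ v) (x<b ∷ v<b)))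

  box-cong : ∀ b D {F G} → (∀ v → F v ≡ G v) → box b D F ≡ box b D G
  box-cong b D e = box-cong-< b D (λ v _ → e v)

  box-+ : ∀ b D F G → box b D (λ v → F v + G v) ≡ box b D F + box b D G
  box-+ b zero    F G = refl
  box-+ b (suc D) F G = trans (box-cong b D (λ v → ∑-+ b _ _)) (box-+ b D _ _)

  box-zero : ∀ b D → box b D (λ _ → 0ℚ) ≡ 0ℚ
  box-zero b zero    = refl
  box-zero b (suc D) = trans (box-cong b D (λ v → ∑-zero b (λ _ _ → refl))) (box-zero b D)

  box-++ : ∀ b p q F → box b (p ℕ.+ q) F ≡ box b q (λ w → box b p (λ u → F (u ++ w)))
  box-++ b zero    q F = refl
  box-++ b (suc p) q F = box-++ b p q _

-- Indicators of inequalities between integers.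

module Indicator where

  open import Data.Nat as ℕ using (ℕ; suc)
  open import Data.Integer as ℤ using (ℤ; +_; -[1+_])
  import Data.Integer.Properties as ℤP
  open import Data.Integer.Tactic.RingSolver using (solve-∀)
  import Data.Integer.DivMod as ℤD
  open import Data.Sum using (_⊎_; inj₁; inj₂)
  open import Data.Empty using (⊥; ⊥-elim)
  open import Relation.Binary.PropositionalEquality
  open ℚ using (ℚ; 0ℚ; 1ℚ)

  -1ℤ : ℤ
  -1ℤ = -[1+ 0 ]

  NonNeg : ℤ → Set
  NonNeg a = + 0 ℤ.≤ a

  -- Strict negativity written as -1 - a ≥ 0, so that the negation of an inequality between affine
  -- forms is again one and no strict indicators arise. Being a record, it lets `a` be inferred.
  record Neg (a : ℤ) : Set where
    constructor neg
    field nonneg : NonNeg (-1ℤ ℤ.+ -1ℤ ℤ.* a)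

  sign : ∀ a → NonNeg a ⊎ Neg a
  sign (+ n)    = inj₁ (ℤ.+≤+ ℕ.z≤n)
  sign -[1+ n ] = inj₂ (neg (subst NonNeg (eq (+ suc n)) (ℤ.+≤+ (ℕ.z≤n {n}))))
    where
    eq : ∀ a → -1ℤ ℤ.+ a ≡ -1ℤ ℤ.+ -1ℤ ℤ.* (ℤ.- a)
    eq = solve-∀

  NonNeg-+ : ∀ {a b c} → NonNeg a → NonNeg b → a ℤ.+ b ≡ c → NonNeg c
  NonNeg-+ p q e = subst NonNeg e (ℤP.+-mono-≤ p q)

  NonNeg-* : ∀ {a b} → NonNeg a → NonNeg b → NonNeg (a ℤ.* b)
  NonNeg-* {+ m} {+ n} p q = subst NonNeg (ℤP.pos-* m n) (ℤ.+≤+ ℕ.z≤n)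

  +-NonNeg : ∀ n → NonNeg (+ n)
  +-NonNeg n = ℤ.+≤+ ℕ.z≤n

  NonNeg-Neg : ∀ {a} → NonNeg a → Neg a → ⊥
  NonNeg-Neg {a} p (neg q) with NonNeg-+ p q (eq a)
    where
    eq : ∀ a → a ℤ.+ (-1ℤ ℤ.+ -1ℤ ℤ.* a) ≡ -1ℤ
    eq = solve-∀
  ... | ()

  χ : ℤ → ℚ
  χ (+ _)    = 1ℚ
  χ -[1+ _ ] = 0ℚ

  χ-yes : ∀ {a} → NonNeg a → χ a ≡ 1ℚ
  χ-yes {+ _} _ = refl

  χ-no : ∀ {a} → Neg a → χ a ≡ 0ℚ
  χ-no {+ n}      p = ⊥-elim (NonNeg-Neg (+-NonNeg n) p)
  χ-no { -[1+ _ ]} p = refl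

  χ-no-by : ∀ a {b} → NonNeg b → b ≡ -1ℤ ℤ.+ -1ℤ ℤ.* a → χ a ≡ 0ℚ
  χ-no-by a p e = χ-no (neg {a} (subst NonNeg e p))

  χ-iff : ∀ {a b} → (NonNeg a → NonNeg b) → (NonNeg b → NonNeg a) → χ a ≡ χ b
  χ-iff {a} {b} f g with sign a | sign b
  ... | inj₁ p | _      = trans (χ-yes p) (sym (χ-yes (f p)))
  ... | inj₂ p | inj₁ q = ⊥-elim (NonNeg-Neg (g q) p)
  ... | inj₂ p | inj₂ q = trans (χ-no p) (sym (χ-no q))

  χ-absorb : ∀ {a b} → (NonNeg a → NonNeg b) → χ a ℚ.* χ b ≡ χ a
  χ-absorb {a} {b} f with sign a
  ... | inj₁ p = trans (cong (χ a ℚ.*_) (χ-yes (f p))) (ℚP.*-identityʳ (χ a))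
  ... | inj₂ p = trans (cong (ℚ._* χ b) (χ-no p)) (trans (ℚP.*-zeroˡ (χ b)) (sym (χ-no p)))

  -- Here `a` and `b` will be two bounds on the same variable and `d` their difference, in which the
  -- variable cancels: which bound is the sharper one is a condition on the remaining variables
  -- only.
  χ-min₁ : ∀ a b {d} → NonNeg d → a ℤ.+ d ≡ b → χ a ℚ.* χ b ≡ χ a
  χ-min₁ a b p e = χ-absorb {a} {b} (λ q → NonNeg-+ q p e)

  χ-min₂ : ∀ a b {d} → Neg d → a ℤ.+ d ≡ b → χ a ℚ.* χ b ≡ χ b
  χ-min₂ a b {d} (neg p) refl = trans (ℚP.*-comm (χ a) (χ b)) (χ-absorb {b} {a} (λ q → NonNeg-+ (NonNeg-+ q p refl) (+-NonNeg 1) (eq a d)))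
    where
    eq : ∀ a d → (a ℤ.+ d) ℤ.+ (-1ℤ ℤ.+ -1ℤ ℤ.* d) ℤ.+ + 1 ≡ a
    eq = solve-∀

  -- Exactly one of a and -1 - a is nonnegative, so the weighted sum is an if-then-else that can be
  -- written with sums and products of indicators.
  χ-choose : ∀ {a b} {A B T} → (NonNeg a → A ≡ T) → (Neg a → B ≡ T) → b ≡ -1ℤ ℤ.+ -1ℤ ℤ.* a →
             χ a ℚ.* A ℚ.+ χ b ℚ.* B ≡ T
  χ-choose {a} {A = A} {B} {T} f g refl with sign a
  ... | inj₁ p = trans (cong₂ ℚ._+_ (cong₂ ℚ._*_ (χ-yes p) (f p)) (cong (ℚ._* B) (χ-no { -1ℤ ℤ.+ -1ℤ ℤ.* a} (neg (subst NonNeg (eq a) p))))) (r T B)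
    where
    eq : ∀ a → a ≡ -1ℤ ℤ.+ -1ℤ ℤ.* (-1ℤ ℤ.+ -1ℤ ℤ.* a)
    eq = solve-∀
    r : ∀ t b → 1ℚ ℚ.* t ℚ.+ 0ℚ ℚ.* b ≡ t
    r = RS.solve-∀ ℚ-ring
  ... | inj₂ p = trans (cong₂ ℚ._+_ (cong (ℚ._* A) (χ-no p)) (cong₂ ℚ._*_ (χ-yes (Neg.nonneg p)) (g p))) (r T A)
    where
    r : ∀ t a → 0ℚ ℚ.* a ℚ.+ 1ℚ ℚ.* t ≡ t
    r = RS.solve-∀ ℚ-ring

  -- Otherwise t plus the floored quotient of κ by s = k + 1 is at most -1; since the remainder of κ
  -- is at most s - 1, this forces s t + κ ≤ -1.
  floor-fwd : ∀ k t κ → NonNeg (+ suc k ℤ.* t ℤ.+ κ) → NonNeg (t ℤ.+ κ ℤD./ℕ suc k)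
  floor-fwd k t κ p with sign (t ℤ.+ κ ℤD./ℕ suc k)
  ... | inj₁ q = q
  ... | inj₂ (neg q) = ⊥-elim (NonNeg-Neg p
      (neg (NonNeg-+ (NonNeg-* (+-NonNeg (suc k)) q) r<
        (trans (eq t (κ ℤD./ℕ suc k) (+ (κ ℤD.%ℕ suc k)) (+ suc k))
               (cong (λ u → -1ℤ ℤ.+ -1ℤ ℤ.* (+ suc k ℤ.* t ℤ.+ u)) (sym (ℤD.a≡a%ℕn+[a/ℕn]*n κ (suc k))))))))
    where
    r< : NonNeg (+ suc k ℤ.+ -1ℤ ℤ.+ ℤ.- + (κ ℤD.%ℕ suc k))
    r< = ℤP.i≤j⇒0≤j-i (ℤ.+≤+ (ℕ.s≤s⁻¹ (ℤD.n%ℕd<d κ (suc k))))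
    eq : ∀ t q r s → s ℤ.* (-1ℤ ℤ.+ -1ℤ ℤ.* (t ℤ.+ q)) ℤ.+ (s ℤ.+ -1ℤ ℤ.+ ℤ.- r) ≡ -1ℤ ℤ.+ -1ℤ ℤ.* (s ℤ.* t ℤ.+ (r ℤ.+ q ℤ.* s))
    eq = solve-∀

  floor-bwd : ∀ k t κ → NonNeg (t ℤ.+ κ ℤD./ℕ suc k) → NonNeg (+ suc k ℤ.* t ℤ.+ κ)
  floor-bwd k t κ p = NonNeg-+ (NonNeg-* (+-NonNeg (suc k)) p) (+-NonNeg (κ ℤD.%ℕ suc k))
      (trans (eq t (κ ℤD./ℕ suc k) (+ (κ ℤD.%ℕ suc k)) (+ suc k))
             (cong (λ u → + suc k ℤ.* t ℤ.+ u) (sym (ℤD.a≡a%ℕn+[a/ℕn]*n κ (suc k)))))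
    where
    eq : ∀ t q r s → s ℤ.* (t ℤ.+ q) ℤ.+ r ≡ s ℤ.* t ℤ.+ (r ℤ.+ q ℤ.* s)
    eq = solve-∀

  -- As t is an integer, only κ has to be rounded. This makes the bounds on a summation variable
  -- integral, and it also governs carries, where the divisor is the base.
  χ-floor : ∀ k t κ → χ (+ suc k ℤ.* t ℤ.+ κ) ≡ χ (t ℤ.+ κ ℤD./ℕ suc k)
  χ-floor k t κ = χ-iff (floor-fwd k t κ) (floor-bwd k t κ)

-- Affine forms, step polynomials and Newton series.

module StepPolynomials where

  open import Data.Nat as ℕ using (ℕ; zero; suc)
  open import Data.Integer as ℤ using (ℤ; +_)
  import Data.Integer.Properties as ℤP
  open import Data.Integer.Tactic.RingSolver using (solve-∀)
  open import Data.Fin using (Fin; zero; suc)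
  open import Data.Vec using (Vec; []; _∷_; lookup; zipWith)
  open import Data.List using (List; []; _∷_; map)
  open import Relation.Binary.PropositionalEquality
  open ≡-Reasoning
  open ℚ using (ℚ; 0ℚ; 1ℚ)
  open Embedding
  open Indicator

  infixl 6 _⊞_ _⊟_ _⊕_
  infixl 7 _⊡_ _⊗_

  -- Affine forms in D variables and the parameter n, written prm.
  data Lin (D : ℕ) : Set where
    con : ℤ → Lin D
    prm : Lin D
    var : Fin D → Lin D
    _⊞_ : Lin D → Lin D → Lin D
    _⊡_ : ℤ → Lin D → Lin D

  _⊟_ : ∀ {D} → Lin D → Lin D → Lin D
  a ⊟ b = a ⊞ -1ℤ ⊡ b

  ⟦_⟧ℓ : ∀ {D} → Lin D → ℕ → Vec ℕ D → ℤ
  ⟦ con z ⟧ℓ n y = z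
  ⟦ prm ⟧ℓ   n y = + n
  ⟦ var i ⟧ℓ n y = + lookup y i
  ⟦ a ⊞ b ⟧ℓ n y = ⟦ a ⟧ℓ n y ℤ.+ ⟦ b ⟧ℓ n y
  ⟦ z ⊡ a ⟧ℓ n y = z ℤ.* ⟦ a ⟧ℓ n y

  -- ind a is the indicator function of a ≥ 0.
  data Fn (D : ℕ) : Set where
    con : ℚ → Fn D
    lin : Lin D → Fn D
    ind : Lin D → Fn D
    _⊕_ : Fn D → Fn D → Fn D
    _⊗_ : Fn D → Fn D → Fn D

  ⟦_⟧ : ∀ {D} → Fn D → ℕ → Vec ℕ D → ℚ
  ⟦ con q ⟧ n y = q
  ⟦ lin a ⟧ n y = ι (⟦ a ⟧ℓ n y)
  ⟦ ind a ⟧ n y = χ (⟦ a ⟧ℓ n y)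
  ⟦ f ⊕ g ⟧ n y = ⟦ f ⟧ n y ℚ.+ ⟦ g ⟧ n y
  ⟦ f ⊗ g ⟧ n y = ⟦ f ⟧ n y ℚ.* ⟦ g ⟧ n y

  coef : ∀ {D} → Lin (suc D) → ℤ
  coef (con z)       = + 0
  coef prm           = + 0
  coef (var zero)    = + 1
  coef (var (suc i)) = + 0
  coef (a ⊞ b)       = coef a ℤ.+ coef b
  coef (z ⊡ a)       = z ℤ.* coef a

  rest : ∀ {D} → Lin (suc D) → Lin D
  rest (con z)       = con z
  rest prm           = prm
  rest (var zero)    = con (+ 0)
  rest (var (suc i)) = var i
  rest (a ⊞ b)       = rest a ⊞ rest b
  rest (z ⊡ a)       = z ⊡ rest a

  coef-rest : ∀ {D} (a : Lin (suc D)) n x y → ⟦ a ⟧ℓ n (x ∷ y) ≡ coef a ℤ.* + x ℤ.+ ⟦ rest a ⟧ℓ n y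
  coef-rest (con z)       n x y = sym (ℤP.+-identityˡ z)
  coef-rest prm           n x y = refl
  coef-rest (var zero)    n x y = eq (+ x)
    where
    eq : ∀ x → x ≡ + 1 ℤ.* x ℤ.+ + 0
    eq = solve-∀
  coef-rest (var (suc i)) n x y = refl
  coef-rest (a ⊞ b)       n x y = trans (cong₂ ℤ._+_ (coef-rest a n x y) (coef-rest b n x y)) (eq (coef a) (coef b) (+ x) (⟦ rest a ⟧ℓ n y) (⟦ rest b ⟧ℓ n y))
    where
    eq : ∀ a b x r s → (a ℤ.* x ℤ.+ r) ℤ.+ (b ℤ.* x ℤ.+ s) ≡ (a ℤ.+ b) ℤ.* x ℤ.+ (r ℤ.+ s)
    eq = solve-∀
  coef-rest (z ⊡ a)       n x y = trans (cong (z ℤ.*_) (coef-rest a n x y)) (eq z (coef a) (+ x) (⟦ rest a ⟧ℓ n y))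
    where
    eq : ∀ z a x r → z ℤ.* (a ℤ.* x ℤ.+ r) ≡ (z ℤ.* a) ℤ.* x ℤ.+ z ℤ.* r
    eq = solve-∀

  -- `prm` survives along with the variables because the parameter is restricted to a residue class
  -- just as they are.
  hom : ∀ {D} → Lin D → Lin D
  hom (con z) = con (+ 0)
  hom prm     = prm
  hom (var i) = var i
  hom (a ⊞ b) = hom a ⊞ hom b
  hom (z ⊡ a) = z ⊡ hom a

  res : ∀ {D} → ℕ → Vec ℕ D → Vec ℕ D → Vec ℕ D
  res M = zipWith (λ r t → r ℕ.+ t ℕ.* M)

  res-ℤ : ∀ M r t → + (r ℕ.+ t ℕ.* M) ≡ + M ℤ.* + t ℤ.+ + r
  res-ℤ M r t = trans (ℤP.pos-+ r (t ℕ.* M)) (trans (cong (λ u → + r ℤ.+ u) (ℤP.pos-* t M)) (eq (+ r) (+ t) (+ M)))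
    where
    eq : ∀ r t m → r ℤ.+ t ℤ.* m ≡ m ℤ.* t ℤ.+ r
    eq = solve-∀

  lookup-res : ∀ {D} M (ρ v : Vec ℕ D) i → + lookup (res M ρ v) i ≡ + M ℤ.* + lookup v i ℤ.+ + lookup ρ i
  lookup-res M (r ∷ ρ) (t ∷ v) zero    = res-ℤ M r t
  lookup-res M (r ∷ ρ) (t ∷ v) (suc i) = lookup-res M ρ v i

  -- On a residue class everything but a number fixed by the class carries the factor `M`. Hence
  -- division by a divisor of `M` is exact up to rounding one constant.
  hom-res : ∀ {D} (a : Lin D) M ρ₀ ρ n v →
            ⟦ a ⟧ℓ (ρ₀ ℕ.+ n ℕ.* M) (res M ρ v) ≡ + M ℤ.* ⟦ hom a ⟧ℓ n v ℤ.+ ⟦ a ⟧ℓ ρ₀ ρ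
  hom-res (con z) M ρ₀ ρ n v = eq (+ M) z
    where
    eq : ∀ m z → z ≡ m ℤ.* + 0 ℤ.+ z
    eq = solve-∀
  hom-res prm     M ρ₀ ρ n v = res-ℤ M ρ₀ n
  hom-res (var i) M ρ₀ ρ n v = lookup-res M ρ v i
  hom-res (a ⊞ b) M ρ₀ ρ n v = trans (cong₂ ℤ._+_ (hom-res a M ρ₀ ρ n v) (hom-res b M ρ₀ ρ n v))
    (eq (+ M) (⟦ hom a ⟧ℓ n v) (⟦ hom b ⟧ℓ n v) (⟦ a ⟧ℓ ρ₀ ρ) (⟦ b ⟧ℓ ρ₀ ρ))
    where
    eq : ∀ m a b r s → (m ℤ.* a ℤ.+ r) ℤ.+ (m ℤ.* b ℤ.+ s) ≡ m ℤ.* (a ℤ.+ b) ℤ.+ (r ℤ.+ s)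
    eq = solve-∀
  hom-res (z ⊡ a) M ρ₀ ρ n v = trans (cong (z ℤ.*_) (hom-res a M ρ₀ ρ n v)) (eq (+ M) z (⟦ hom a ⟧ℓ n v) (⟦ a ⟧ℓ ρ₀ ρ))
    where
    eq : ∀ m z a r → z ℤ.* (m ℤ.* a ℤ.+ r) ≡ m ℤ.* (z ℤ.* a) ℤ.+ z ℤ.* r
    eq = solve-∀

  -- The falling factorial x(x-1)⋯(x-k+1). In this basis the antidifference merely raises the degree
  -- by one and divides by k + 1. The argument is an integer because values of affine forms are
  -- substituted for it.
  ff : ℕ → ℤ → ℚ
  ff zero    x = 1ℚ
  ff (suc k) x = ff k x ℚ.* ι (x ℤ.+ -1ℤ ℤ.* + k)

  -- The recursion splits off the last factor; here the first one is split off.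
  ff-shift : ∀ k x → ff (suc k) (x ℤ.+ + 1) ≡ ι (x ℤ.+ + 1) ℚ.* ff k x
  ff-shift zero    x = trans (ℚP.*-identityˡ _) (trans (cong ι (eq x)) (sym (ℚP.*-identityʳ _)))
    where
    eq : ∀ x → x ℤ.+ + 1 ℤ.+ -1ℤ ℤ.* + 0 ≡ x ℤ.+ + 1
    eq = solve-∀
  ff-shift (suc k) x = trans (cong₂ ℚ._*_ (ff-shift k x) (cong ι (eq x (+ k)))) (ℚP.*-assoc (ι (x ℤ.+ + 1)) (ff k x) _)
    where
    eq : ∀ x k → x ℤ.+ + 1 ℤ.+ -1ℤ ℤ.* (+ 1 ℤ.+ k) ≡ x ℤ.+ -1ℤ ℤ.* k
    eq = solve-∀

  -- Both terms contain `ff k x`, and the remaining factors differ by (x + 1) - (x - k) = k + 1.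
  ff-difference : ∀ k x → ff (suc k) (x ℤ.+ + 1) ℚ.+ ℚ.- ff (suc k) x ≡ ι (+ suc k) ℚ.* ff k x
  ff-difference k x = begin
    ff (suc k) (x ℤ.+ + 1) ℚ.+ ℚ.- ff (suc k) x                           ≡⟨ cong (ℚ._+ ℚ.- ff (suc k) x) (ff-shift k x) ⟩
    ι (x ℤ.+ + 1) ℚ.* ff k x ℚ.+ ℚ.- (ff k x ℚ.* ι (x ℤ.+ -1ℤ ℤ.* + k))   ≡⟨ r (ι (x ℤ.+ + 1)) (ff k x) (ι (x ℤ.+ -1ℤ ℤ.* + k)) ⟩
    (ι (x ℤ.+ + 1) ℚ.+ ℚ.- ι (x ℤ.+ -1ℤ ℤ.* + k)) ℚ.* ff k x              ≡⟨ cong (λ t → (ι (x ℤ.+ + 1) ℚ.+ t) ℚ.* ff k x) (sym (ι-neg (x ℤ.+ -1ℤ ℤ.* + k))) ⟩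
    (ι (x ℤ.+ + 1) ℚ.+ ι (ℤ.- (x ℤ.+ -1ℤ ℤ.* + k))) ℚ.* ff k x            ≡⟨ cong (ℚ._* ff k x) (sym (ι-+ (x ℤ.+ + 1) (ℤ.- (x ℤ.+ -1ℤ ℤ.* + k)))) ⟩
    ι ((x ℤ.+ + 1) ℤ.+ ℤ.- (x ℤ.+ -1ℤ ℤ.* + k)) ℚ.* ff k x                ≡⟨ cong (λ t → ι t ℚ.* ff k x) (eq x (+ k)) ⟩
    ι (+ suc k) ℚ.* ff k x ∎
    where
    r : ∀ a f b → a ℚ.* f ℚ.+ ℚ.- (f ℚ.* b) ≡ (a ℚ.+ ℚ.- b) ℚ.* f
    r = RS.solve-∀ ℚ-ring
    eq : ∀ x k → (x ℤ.+ + 1) ℤ.+ ℤ.- (x ℤ.+ -1ℤ ℤ.* k) ≡ + 1 ℤ.+ k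
    eq = solve-∀

  ff-mulx : ∀ k x → ι x ℚ.* ff k x ≡ ff (suc k) x ℚ.+ ι (+ k) ℚ.* ff k x
  ff-mulx k x = begin
    ι x ℚ.* ff k x                                                        ≡⟨ cong (λ t → ι t ℚ.* ff k x) (eq x (+ k)) ⟩
    ι ((x ℤ.+ -1ℤ ℤ.* + k) ℤ.+ + k) ℚ.* ff k x                            ≡⟨ cong (ℚ._* ff k x) (ι-+ (x ℤ.+ -1ℤ ℤ.* + k) (+ k)) ⟩
    (ι (x ℤ.+ -1ℤ ℤ.* + k) ℚ.+ ι (+ k)) ℚ.* ff k x                        ≡⟨ r (ff k x) (ι (x ℤ.+ -1ℤ ℤ.* + k)) (ι (+ k)) ⟩
    ff (suc k) x ℚ.+ ι (+ k) ℚ.* ff k x ∎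
    where
    r : ∀ f a b → (a ℚ.+ b) ℚ.* f ≡ f ℚ.* a ℚ.+ b ℚ.* f
    r = RS.solve-∀ ℚ-ring
    eq : ∀ x k → x ≡ (x ℤ.+ -1ℤ ℤ.* k) ℤ.+ k
    eq = solve-∀

  -- A list of coefficients c₀, c₁, … stands for the Newton series ∑ⱼ cⱼ x(x-1)⋯(x-k-j+1) in a further variable x.
  newton : ∀ {D} → ℕ → List (Fn D) → ℕ → Vec ℕ D → ℤ → ℚ
  newton k []       n y x = 0ℚ
  newton k (c ∷ cs) n y x = ⟦ c ⟧ n y ℚ.* ff k x ℚ.+ newton (suc k) cs n y x

  newton-scale : ∀ {D} (f : Fn D) k l n y x → newton k (map (f ⊗_) l) n y x ≡ ⟦ f ⟧ n y ℚ.* newton k l n y x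
  newton-scale f k []      n y x = sym (ℚP.*-zeroʳ (⟦ f ⟧ n y))
  newton-scale f k (c ∷ l) n y x = trans (cong (⟦ f ⟧ n y ℚ.* ⟦ c ⟧ n y ℚ.* ff k x ℚ.+_) (newton-scale f (suc k) l n y x)) (r (⟦ f ⟧ n y) (⟦ c ⟧ n y) _ _)
    where
    r : ∀ f c a b → f ℚ.* c ℚ.* a ℚ.+ f ℚ.* b ≡ f ℚ.* (c ℚ.* a ℚ.+ b)
    r = RS.solve-∀ ℚ-ring

  -- The argument `p` is what the preceding coefficient hands on: x times the k-th falling factorial
  -- is the next one plus k times itself.
  mulx : ∀ {D} → ℕ → Fn D → List (Fn D) → List (Fn D)
  mulx k p []       = p ∷ []
  mulx k p (c ∷ cs) = (p ⊕ con (ι (+ k)) ⊗ c) ∷ mulx (suc k) c cs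

  newton-mulx : ∀ {D} k (p : Fn D) l n y x →
                newton k (mulx k p l) n y x ≡ ⟦ p ⟧ n y ℚ.* ff k x ℚ.+ ι x ℚ.* newton k l n y x
  newton-mulx k p []       n y x = cong (⟦ p ⟧ n y ℚ.* ff k x ℚ.+_) (sym (ℚP.*-zeroʳ (ι x)))
  newton-mulx k p (c ∷ cs) n y x = begin
    (P ℚ.+ ι (+ k) ℚ.* C) ℚ.* F ℚ.+ newton (suc k) (mulx (suc k) c cs) n y x   ≡⟨ cong ((P ℚ.+ ι (+ k) ℚ.* C) ℚ.* F ℚ.+_) (newton-mulx (suc k) c cs n y x) ⟩
    (P ℚ.+ ι (+ k) ℚ.* C) ℚ.* F ℚ.+ (C ℚ.* F′ ℚ.+ ι x ℚ.* R)                   ≡⟨ r₁ P (ι (+ k)) C F F′ (ι x) R ⟩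
    P ℚ.* F ℚ.+ (C ℚ.* (F′ ℚ.+ ι (+ k) ℚ.* F) ℚ.+ ι x ℚ.* R)                   ≡⟨ cong (λ t → P ℚ.* F ℚ.+ (C ℚ.* t ℚ.+ ι x ℚ.* R)) (sym (ff-mulx k x)) ⟩
    P ℚ.* F ℚ.+ (C ℚ.* (ι x ℚ.* F) ℚ.+ ι x ℚ.* R)                              ≡⟨ r₂ P F C (ι x) R ⟩
    P ℚ.* F ℚ.+ ι x ℚ.* (C ℚ.* F ℚ.+ R) ∎
    where
    P F F′ C R : ℚ
    P  = ⟦ p ⟧ n y
    C  = ⟦ c ⟧ n y
    F  = ff k x
    F′ = ff (suc k) x
    R  = newton (suc k) cs n y x
    r₁ : ∀ p k c f g x r → (p ℚ.+ k ℚ.* c) ℚ.* f ℚ.+ (c ℚ.* g ℚ.+ x ℚ.* r) ≡ p ℚ.* f ℚ.+ (c ℚ.* (g ℚ.+ k ℚ.* f) ℚ.+ x ℚ.* r)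
    r₁ = RS.solve-∀ ℚ-ring
    r₂ : ∀ p f c x r → p ℚ.* f ℚ.+ (c ℚ.* (x ℚ.* f) ℚ.+ x ℚ.* r) ≡ p ℚ.* f ℚ.+ x ℚ.* (c ℚ.* f ℚ.+ r)
    r₂ = RS.solve-∀ ℚ-ring

  ffFn : ∀ {D} → ℕ → Lin D → Fn D
  ffFn zero    a = con 1ℚ
  ffFn (suc k) a = ffFn k a ⊗ lin (a ⊟ con (+ k))

  ffFn-ff : ∀ {D} k (a : Lin D) n y → ⟦ ffFn k a ⟧ n y ≡ ff k (⟦ a ⟧ℓ n y)
  ffFn-ff zero    a n y = refl
  ffFn-ff (suc k) a n y = cong (ℚ._* ι (⟦ a ⟧ℓ n y ℤ.+ -1ℤ ℤ.* + k)) (ffFn-ff k a n y)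

  antidiff : ∀ {D} → ℕ → List (Fn D) → Lin D → Fn D
  antidiff k []       a = con 0ℚ
  antidiff k (c ∷ cs) a = c ⊗ con (recip k) ⊗ ffFn (suc k) a ⊕ antidiff (suc k) cs a

  -- The value of `antidiff` as a function on the integers: telescoping steps through x, x + 1, ...,
  -- whereas `antidiff` takes affine forms as arguments.
  antinewton : ∀ {D} → ℕ → List (Fn D) → ℕ → Vec ℕ D → ℤ → ℚ
  antinewton k []       n y x = 0ℚ
  antinewton k (c ∷ cs) n y x = ⟦ c ⟧ n y ℚ.* recip k ℚ.* ff (suc k) x ℚ.+ antinewton (suc k) cs n y x

  antidiff-eval : ∀ {D} k l (a : Lin D) n y → ⟦ antidiff k l a ⟧ n y ≡ antinewton k l n y (⟦ a ⟧ℓ n y)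
  antidiff-eval k []       a n y = refl
  antidiff-eval k (c ∷ cs) a n y = cong₂ ℚ._+_ (cong (⟦ c ⟧ n y ℚ.* recip k ℚ.*_) (ffFn-ff (suc k) a n y)) (antidiff-eval (suc k) cs a n y)

  antinewton-difference : ∀ {D} k l n (y : Vec ℕ D) x →
    newton k l n y x ≡ antinewton k l n y (x ℤ.+ + 1) ℚ.+ ℚ.- antinewton k l n y x
  antinewton-difference k []       n y x = refl
  antinewton-difference k (c ∷ cs) n y x = begin
    C ℚ.* F ℚ.+ newton (suc k) cs n y x                                     ≡⟨ cong (C ℚ.* F ℚ.+_) (antinewton-difference (suc k) cs n y x) ⟩
    C ℚ.* F ℚ.+ (A ℚ.+ ℚ.- B)                                               ≡⟨ r₀ C F (A ℚ.+ ℚ.- B) ⟩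
    C ℚ.* (1ℚ ℚ.* F) ℚ.+ (A ℚ.+ ℚ.- B)                                      ≡⟨ cong (λ t → C ℚ.* (t ℚ.* F) ℚ.+ (A ℚ.+ ℚ.- B)) (sym (recip-inverse k)) ⟩
    C ℚ.* (ι (+ suc k) ℚ.* recip k ℚ.* F) ℚ.+ (A ℚ.+ ℚ.- B)                 ≡⟨ r₁ C (ι (+ suc k)) (recip k) F A B ⟩
    C ℚ.* recip k ℚ.* (ι (+ suc k) ℚ.* F) ℚ.+ (A ℚ.+ ℚ.- B)                 ≡⟨ cong (λ t → C ℚ.* recip k ℚ.* t ℚ.+ (A ℚ.+ ℚ.- B)) (sym (ff-difference k x)) ⟩
    C ℚ.* recip k ℚ.* (ff (suc k) (x ℤ.+ + 1) ℚ.+ ℚ.- ff (suc k) x) ℚ.+ (A ℚ.+ ℚ.- B)   ≡⟨ r₂ (C ℚ.* recip k) (ff (suc k) (x ℤ.+ + 1)) (ff (suc k) x) A B ⟩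
    (C ℚ.* recip k ℚ.* ff (suc k) (x ℤ.+ + 1) ℚ.+ A) ℚ.+ ℚ.- (C ℚ.* recip k ℚ.* ff (suc k) x ℚ.+ B) ∎
    where
    C F A B : ℚ
    C = ⟦ c ⟧ n y
    F = ff k x
    A = antinewton (suc k) cs n y (x ℤ.+ + 1)
    B = antinewton (suc k) cs n y x
    r₀ : ∀ c f a → c ℚ.* f ℚ.+ a ≡ c ℚ.* (1ℚ ℚ.* f) ℚ.+ a
    r₀ = RS.solve-∀ ℚ-ring
    r₁ : ∀ c i r f a b → c ℚ.* (i ℚ.* r ℚ.* f) ℚ.+ (a ℚ.+ ℚ.- b) ≡ c ℚ.* r ℚ.* (i ℚ.* f) ℚ.+ (a ℚ.+ ℚ.- b)
    r₁ = RS.solve-∀ ℚ-ring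
    r₂ : ∀ c f g a b → c ℚ.* (f ℚ.+ ℚ.- g) ℚ.+ (a ℚ.+ ℚ.- b) ≡ (c ℚ.* f ℚ.+ a) ℚ.+ ℚ.- (c ℚ.* g ℚ.+ b)
    r₂ = RS.solve-∀ ℚ-ring

-- Summation of a step polynomial over one variable.

module Elimination where

  open import Data.Nat as ℕ using (ℕ; suc)
  import Data.Nat.Properties as ℕP
  import Data.Nat.DivMod as ℕD
  open import Data.Nat.Divisibility using (_∣_; ∣-trans; m∣m*n; n∣m*n; ∣-refl)
  open import Data.Integer as ℤ using (ℤ; +_; -[1+_])
  import Data.Integer.Properties as ℤP
  import Data.Integer.DivMod as ℤD
  open import Data.Integer.Tactic.RingSolver using (solve-∀)
  open import Data.Vec using (Vec; []; _∷_)
  open import Data.List using (List; []; _∷_; map)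
  open import Data.Product using (∃; _×_; _,_)
  open import Data.Sum using (inj₁; inj₂)
  open import Data.Unit using (⊤; tt)

  open import Relation.Binary.PropositionalEquality
  open ≡-Reasoning
  open ℚ using (ℚ; 0ℚ; 1ℚ)
  open Embedding
  open Sums
  open Indicator
  open StepPolynomials

  -- The range of summation consists of `a` points below the interval, `k` points inside it and `r`
  -- points above; the sum telescopes on the middle part. The upper value is taken at e + 1 because
  -- e itself belongs to the interval.
  segment-sum : ∀ a k r c e (g S : ℤ → ℚ) → (∀ x → g x ≡ S (x ℤ.+ + 1) ℚ.+ ℚ.- S x) →
    c ≡ -1ℤ ℤ.* + a → e ≡ + a ℤ.+ + k ℤ.+ -1ℤ →
    ∑ (a ℕ.+ (k ℕ.+ r)) (λ x → χ (+ x ℤ.+ c) ℚ.* χ (e ℤ.+ -1ℤ ℤ.* + x) ℚ.* g (+ x))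
      ≡ S (e ℤ.+ + 1) ℚ.+ ℚ.- S (-1ℤ ℤ.* c)
  segment-sum a k r c e g S ΔS refl refl = begin
    ∑ (a ℕ.+ (k ℕ.+ r)) f                                        ≡⟨ ∑-append a (k ℕ.+ r) f ⟩
    ∑ a f ℚ.+ ∑ (k ℕ.+ r) (λ i → f (a ℕ.+ i))                    ≡⟨ cong₂ ℚ._+_ (∑-zero a below) (∑-append k r (λ i → f (a ℕ.+ i))) ⟩
    0ℚ ℚ.+ (∑ k (λ i → f (a ℕ.+ i)) ℚ.+ ∑ r (λ i → f (a ℕ.+ (k ℕ.+ i))))
      ≡⟨ cong₂ (λ s t → 0ℚ ℚ.+ (s ℚ.+ t)) (trans (∑-cong-< k inside) (telescope k (λ i → g (+ (a ℕ.+ i))) (λ i → S (+ (a ℕ.+ i))) step)) (∑-zero r above) ⟩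
    0ℚ ℚ.+ (S (+ (a ℕ.+ k)) ℚ.+ ℚ.- S (+ (a ℕ.+ 0)) ℚ.+ 0ℚ)      ≡⟨ r₀ (S (+ (a ℕ.+ k))) (S (+ (a ℕ.+ 0))) ⟩
    S (+ (a ℕ.+ k)) ℚ.+ ℚ.- S (+ (a ℕ.+ 0))                      ≡⟨ cong₂ (λ s t → S s ℚ.+ ℚ.- S t) (trans (ℤP.pos-+ a k) (e₁ (+ a) (+ k))) (trans (ℤP.pos-+ a 0) (e₂ (+ a))) ⟩
    S (e ℤ.+ + 1) ℚ.+ ℚ.- S (-1ℤ ℤ.* c) ∎
    where
    f : ℕ → ℚ
    f x = χ (+ x ℤ.+ c) ℚ.* χ (e ℤ.+ -1ℤ ℤ.* + x) ℚ.* g (+ x)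
    r₀ : ∀ s t → 0ℚ ℚ.+ (s ℚ.+ ℚ.- t ℚ.+ 0ℚ) ≡ s ℚ.+ ℚ.- t
    r₀ = RS.solve-∀ ℚ-ring
    e₁ : ∀ a k → a ℤ.+ k ≡ (a ℤ.+ k ℤ.+ -1ℤ) ℤ.+ + 1
    e₁ = solve-∀
    e₂ : ∀ a → a ℤ.+ + 0 ≡ -1ℤ ℤ.* (-1ℤ ℤ.* a)
    e₂ = solve-∀
    zero-l : ∀ y z → 0ℚ ℚ.* y ℚ.* z ≡ 0ℚ
    zero-l = RS.solve-∀ ℚ-ring
    zero-r : ∀ y z → y ℚ.* 0ℚ ℚ.* z ≡ 0ℚ
    zero-r = RS.solve-∀ ℚ-ring
    one : ∀ z → 1ℚ ℚ.* 1ℚ ℚ.* z ≡ z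
    one = RS.solve-∀ ℚ-ring
    below : ∀ x → x ℕ.< a → f x ≡ 0ℚ
    below x x<a = trans (cong (λ t → t ℚ.* χ (e ℤ.+ -1ℤ ℤ.* + x) ℚ.* g (+ x)) (χ-no-by (+ x ℤ.+ c)
        (ℤP.i≤j⇒0≤j-i (ℤ.+≤+ x<a)) (eq (+ x) (+ a)))) (zero-l (χ (e ℤ.+ -1ℤ ℤ.* + x)) (g (+ x)))
      where
      eq : ∀ x a → a ℤ.+ ℤ.- (+ 1 ℤ.+ x) ≡ -1ℤ ℤ.+ -1ℤ ℤ.* (x ℤ.+ -1ℤ ℤ.* a)
      eq = solve-∀
    inside : ∀ i → i ℕ.< k → f (a ℕ.+ i) ≡ g (+ (a ℕ.+ i))
    inside i i<k = trans (cong₂ (λ s t → s ℚ.* t ℚ.* g (+ (a ℕ.+ i)))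
        (χ-yes (subst NonNeg (trans (eq₁ (+ i) (+ a)) (cong (ℤ._+ c) (sym (ℤP.pos-+ a i)))) (+-NonNeg i)))
        (χ-yes (subst NonNeg (trans (eq₂ (+ i) (+ a) (+ k)) (cong (λ t → e ℤ.+ -1ℤ ℤ.* t) (sym (ℤP.pos-+ a i)))) (ℤP.i≤j⇒0≤j-i (ℤ.+≤+ i<k)))))
        (one (g (+ (a ℕ.+ i))))
      where
      eq₁ : ∀ i a → i ≡ (a ℤ.+ i) ℤ.+ -1ℤ ℤ.* a
      eq₁ = solve-∀
      eq₂ : ∀ i a k → k ℤ.+ ℤ.- (+ 1 ℤ.+ i) ≡ a ℤ.+ k ℤ.+ -1ℤ ℤ.+ -1ℤ ℤ.* (a ℤ.+ i)
      eq₂ = solve-∀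
    above : ∀ i → i ℕ.< r → f (a ℕ.+ (k ℕ.+ i)) ≡ 0ℚ
    above i _ = trans (cong (λ t → χ (+ x ℤ.+ c) ℚ.* t ℚ.* g (+ x)) (χ-no-by (e ℤ.+ -1ℤ ℤ.* + x)
        (+-NonNeg i) (trans (eq (+ i) (+ a) (+ k)) (cong (λ t → -1ℤ ℤ.+ -1ℤ ℤ.* (e ℤ.+ -1ℤ ℤ.* t)) (sym pos-x))))) (zero-r (χ (+ x ℤ.+ c)) (g (+ x)))
      where
      x : ℕ
      x = a ℕ.+ (k ℕ.+ i)
      pos-x : + x ≡ + a ℤ.+ (+ k ℤ.+ + i)
      pos-x = trans (ℤP.pos-+ a (k ℕ.+ i)) (cong (λ t → + a ℤ.+ t) (ℤP.pos-+ k i))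
      eq : ∀ i a k → i ≡ -1ℤ ℤ.+ -1ℤ ℤ.* (a ℤ.+ k ℤ.+ -1ℤ ℤ.+ -1ℤ ℤ.* (a ℤ.+ (k ℤ.+ i)))
      eq = solve-∀
    step : ∀ i → g (+ (a ℕ.+ i)) ≡ S (+ (a ℕ.+ suc i)) ℚ.+ ℚ.- S (+ (a ℕ.+ i))
    step i = trans (ΔS (+ (a ℕ.+ i))) (cong (λ t → S t ℚ.+ ℚ.- S (+ (a ℕ.+ i))) (cong +_ (trans (ℕP.+-assoc a i 1) (cong (a ℕ.+_) (ℕP.+-comm i 1)))))

  NonNeg⇒+ : ∀ {z} → NonNeg z → ∃ λ m → z ≡ + m
  NonNeg⇒+ {+ m} _ = m , refl

  module _ {D : ℕ} (M ρ₀ : ℕ) (ρ : Vec ℕ D) where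

    -- An eliminator for G sends l, c, e to the sum of G(x) times the Newton series l over the x ≤ n with x + c ≥ 0
    -- and e - x ≥ 0; with this accumulated data, a product of step functions is eliminated by composition.
    Eliminator : Set
    Eliminator = List (Fn D) → Lin D → Lin D → Fn D

    offset : Lin (suc D) → Lin D
    offset a = + M ⊡ hom (rest a) ⊞ con (⟦ rest a ⟧ℓ ρ₀ ρ)

    -- The rounded quotient of `offset a` by j + 1. When j + 1 divides `M`, rounding affects only
    -- the constant, so the bound is an affine form with integer coefficients.
    bound : ℕ → Lin (suc D) → Lin D
    bound j a = + (M ℕ./ suc j) ⊡ hom (rest a) ⊞ con (⟦ rest a ⟧ℓ ρ₀ ρ ℤD./ℕ suc j)

    -- A applied to the smaller of the two forms.
    tighten : Lin D → Lin D → (Lin D → Fn D) → Fn D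
    tighten u v A = ind (v ⊟ u) ⊗ A u ⊕ ind (con -1ℤ ⊞ -1ℤ ⊡ (v ⊟ u)) ⊗ A v

    top : Lin D
    top = + M ⊡ prm ⊞ con (+ ρ₀)

    -- The indicator tests the length e + c + 1 of the interval from -c to e. Length zero may pass,
    -- since the difference then vanishes; for negative length the difference would count a reversed
    -- interval.
    segment : Eliminator
    segment l c e = ind (e ⊞ c ⊞ con (+ 1)) ⊗
      (antidiff 0 l (e ⊞ con (+ 1)) ⊕ con (ℚ.- 1ℚ) ⊗ antidiff 0 l (-1ℤ ⊡ c))

    -- Ends the chain of eliminators. `segment` needs c ≤ 0 and e at most `top`; comparing once more
    -- with these two gives a correct result for arbitrary `c` and `e`, so that no invariant has to
    -- be carried through `elim`.
    clamped : Eliminator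
    clamped l c e = tighten c (con (+ 0)) (λ c → tighten e top (segment l c))

    elimInd : ℤ → Lin (suc D) → Eliminator → Eliminator
    elimInd (+ 0)     a k l c e = ind (offset a) ⊗ k l c e
    elimInd (+ suc j) a k l c e = tighten c (bound j a) (λ c → k l c e)
    elimInd -[1+ j ]  a k l c e = tighten e (bound j a) (λ e → k l c e)

    elim : Fn (suc D) → Eliminator → Eliminator
    elim (con q) k l c e = k (map (con q ⊗_) l) c e
    -- The form is its coefficient times x plus `offset a`: the first term re-expands x times the
    -- series, the second scales the series.
    elim (lin a) k l c e = k (map (con (ι (coef a)) ⊗_) (mulx 0 (con 0ℚ) l)) c e ⊕ k (map (lin (offset a) ⊗_) l) c e
    elim (ind a) k       = elimInd (coef a) a k
    elim (f ⊕ g) k l c e = elim f k l c e ⊕ elim g k l c e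
    elim (f ⊗ g) k       = elim f (elim g k)

    eliminate : Fn (suc D) → Fn D
    -- The series of the constant 1, and the range from 0 to ρ₀ + nM.
    eliminate f = elim f clamped (con 1ℚ ∷ []) (con (+ 0)) top

  -- The absolute value of the coefficient, with 1 in place of 0: an indicator that is constant in x
  -- imposes no divisibility.
  lead : ℤ → ℕ
  lead (+ 0)     = 1
  lead (+ suc k) = suc k
  lead -[1+ k ]  = suc k

  lead-pred : ∀ z → ∃ λ k → lead z ≡ suc k
  lead-pred (+ 0)     = 0 , refl
  lead-pred (+ suc k) = k , refl
  lead-pred -[1+ k ]  = k , refl

  Divisible : ∀ {D} → ℕ → Fn (suc D) → Set
  Divisible M (con q) = ⊤
  Divisible M (lin a) = ⊤
  Divisible M (ind a) = lead (coef a) ∣ M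
  Divisible M (f ⊕ g) = Divisible M f × Divisible M g
  Divisible M (f ⊗ g) = Divisible M f × Divisible M g

  Divisible-∣ : ∀ {D M M′} (f : Fn (suc D)) → M ∣ M′ → Divisible M f → Divisible M′ f
  Divisible-∣ (con q) d p       = tt
  Divisible-∣ (lin a) d p       = tt
  Divisible-∣ (ind a) d p       = ∣-trans p d
  Divisible-∣ (f ⊕ g) d (p , q) = Divisible-∣ f d p , Divisible-∣ g d q
  Divisible-∣ (f ⊗ g) d (p , q) = Divisible-∣ f d p , Divisible-∣ g d q

  -- The product of all leading coefficients serves as common multiple; the form `suc k` records
  -- that it is nonzero.
  modulus : ∀ {D} (f : Fn (suc D)) → ∃ λ k → Divisible (suc k) f
  modulus (con q) = 0 , tt
  modulus (lin a) = 0 , tt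
  modulus (ind a) with lead (coef a) | lead-pred (coef a)
  ... | .(suc k) | k , refl = k , ∣-refl
  modulus (f ⊕ g) with modulus f | modulus g
  ... | k , p | m , q = _ , Divisible-∣ f (m∣m*n (suc m)) p , Divisible-∣ g (n∣m*n (suc k)) q
  modulus (f ⊗ g) with modulus f | modulus g
  ... | k , p | m , q = _ , Divisible-∣ f (m∣m*n (suc m)) p , Divisible-∣ g (n∣m*n (suc k)) q

  module _ {D : ℕ} (M ρ₀ : ℕ) (ρ : Vec ℕ D) (n : ℕ) (v : Vec ℕ D) where

    private
      N : ℕ
      N = ρ₀ ℕ.+ n ℕ.* M

      Y : Vec ℕ D
      Y = res M ρ v

    between : Lin D → Lin D → ℕ → ℚ
    between c e x = χ (+ x ℤ.+ ⟦ c ⟧ℓ n v) ℚ.* χ (⟦ e ⟧ℓ n v ℤ.+ -1ℤ ℤ.* + x)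

    Correct : Eliminator M ρ₀ ρ → (ℕ → ℚ) → Set
    Correct k G = ∀ l c e → ⟦ k l c e ⟧ n v ≡ ∑ (suc N) (λ x → between c e x ℚ.* (G x ℚ.* newton 0 l n v (+ x)))

    tighten-correct : ∀ u w A {T} → (NonNeg (⟦ w ⟧ℓ n v ℤ.+ -1ℤ ℤ.* ⟦ u ⟧ℓ n v) → ⟦ A u ⟧ n v ≡ T) →
      (Neg (⟦ w ⟧ℓ n v ℤ.+ -1ℤ ℤ.* ⟦ u ⟧ℓ n v) → ⟦ A w ⟧ n v ≡ T) → ⟦ tighten M ρ₀ ρ u w A ⟧ n v ≡ T
    tighten-correct u w A p q = χ-choose p q refl

    eval-offset : ∀ a x → ⟦ a ⟧ℓ N (x ∷ Y) ≡ coef a ℤ.* + x ℤ.+ ⟦ offset M ρ₀ ρ a ⟧ℓ n v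
    eval-offset a x = trans (coef-rest a N x Y) (cong (λ t → coef a ℤ.* + x ℤ.+ t) (hom-res (rest a) M ρ₀ ρ n v))

    eval-top : ⟦ top M ρ₀ ρ ⟧ℓ n v ≡ + N
    eval-top = sym (res-ℤ M ρ₀ n)

    segment-correct : ∀ l c e → NonNeg (+ 0 ℤ.+ -1ℤ ℤ.* ⟦ c ⟧ℓ n v) → NonNeg (+ N ℤ.+ -1ℤ ℤ.* ⟦ e ⟧ℓ n v) →
      ⟦ segment M ρ₀ ρ l c e ⟧ n v ≡ ∑ (suc N) (λ x → between c e x ℚ.* newton 0 l n v (+ x))
    segment-correct l c e c≤0 e≤N with sign (⟦ e ⟧ℓ n v ℤ.+ ⟦ c ⟧ℓ n v ℤ.+ + 1)
    -- Negative length: no x meets both bounds, so every summand vanishes.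
    ... | inj₂ (neg p) = trans (cong (ℚ._* ⟦ F ⟧ n v) (χ-no {E ℤ.+ C ℤ.+ + 1} (neg p))) (trans (ℚP.*-zeroˡ (⟦ F ⟧ n v))
        (sym (∑-zero (suc N) (λ x _ → trans (cong (ℚ._* newton 0 l n v (+ x)) (vanish x)) (ℚP.*-zeroˡ (newton 0 l n v (+ x)))))))
      where
      F : Fn D
      F = antidiff 0 l (e ⊞ con (+ 1)) ⊕ con (ℚ.- 1ℚ) ⊗ antidiff 0 l (-1ℤ ⊡ c)
      C E : ℤ
      C = ⟦ c ⟧ℓ n v
      E = ⟦ e ⟧ℓ n v
      vanish : ∀ x → between c e x ≡ 0ℚ
      vanish x with sign (+ x ℤ.+ C)
      ... | inj₂ q = trans (cong (ℚ._* χ (E ℤ.+ -1ℤ ℤ.* + x)) (χ-no q)) (ℚP.*-zeroˡ (χ (E ℤ.+ -1ℤ ℤ.* + x)))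
      ... | inj₁ q = trans (cong (χ (+ x ℤ.+ C) ℚ.*_) (χ-no-by (E ℤ.+ -1ℤ ℤ.* + x) (NonNeg-+ (NonNeg-+ p q refl) (+-NonNeg 1) refl) (eq E C (+ x))))
                           (ℚP.*-zeroʳ (χ (+ x ℤ.+ C)))
        where
        eq : ∀ e c x → -1ℤ ℤ.+ -1ℤ ℤ.* (e ℤ.+ c ℤ.+ + 1) ℤ.+ (x ℤ.+ c) ℤ.+ + 1 ≡ -1ℤ ℤ.+ -1ℤ ℤ.* (e ℤ.+ -1ℤ ℤ.* x)
        eq = solve-∀
    -- The three natural numbers are the length of the interval and the numbers of points below and
    -- above it, N + 1 in total.
    ... | inj₁ p with NonNeg⇒+ p | NonNeg⇒+ c≤0 | NonNeg⇒+ e≤N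
    ... | k , k≡ | a , a≡ | r , r≡ = begin
      χ (E ℤ.+ C ℤ.+ + 1) ℚ.* (⟦ antidiff 0 l (e ⊞ con (+ 1)) ⟧ n v ℚ.+ ℚ.- 1ℚ ℚ.* ⟦ antidiff 0 l (-1ℤ ⊡ c) ⟧ n v)
        ≡⟨ cong₂ ℚ._*_ (χ-yes p) (cong₂ (λ s t → s ℚ.+ ℚ.- 1ℚ ℚ.* t) (antidiff-eval 0 l (e ⊞ con (+ 1)) n v) (antidiff-eval 0 l (-1ℤ ⊡ c) n v)) ⟩
      1ℚ ℚ.* (S (E ℤ.+ + 1) ℚ.+ ℚ.- 1ℚ ℚ.* S (-1ℤ ℤ.* C))   ≡⟨ r₀ (S (E ℤ.+ + 1)) (S (-1ℤ ℤ.* C)) ⟩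
      S (E ℤ.+ + 1) ℚ.+ ℚ.- S (-1ℤ ℤ.* C)                   ≡⟨ segment-sum a k r C E (newton 0 l n v) S (antinewton-difference 0 l n v) C≡ E≡ ⟨
      ∑ (a ℕ.+ (k ℕ.+ r)) (λ x → between c e x ℚ.* newton 0 l n v (+ x))   ≡⟨ cong (λ b → ∑ b (λ x → between c e x ℚ.* newton 0 l n v (+ x))) size ⟩
      ∑ (suc N) (λ x → between c e x ℚ.* newton 0 l n v (+ x)) ∎
      where
      C E : ℤ
      C = ⟦ c ⟧ℓ n v
      E = ⟦ e ⟧ℓ n v
      S : ℤ → ℚ
      S = antinewton 0 l n v
      r₀ : ∀ s t → 1ℚ ℚ.* (s ℚ.+ ℚ.- 1ℚ ℚ.* t) ≡ s ℚ.+ ℚ.- t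
      r₀ = RS.solve-∀ ℚ-ring
      C≡ : C ≡ -1ℤ ℤ.* + a
      C≡ = trans (eq C) (cong (-1ℤ ℤ.*_) a≡)
        where
        eq : ∀ c → c ≡ -1ℤ ℤ.* (+ 0 ℤ.+ -1ℤ ℤ.* c)
        eq = solve-∀
      E≡ : E ≡ + a ℤ.+ + k ℤ.+ -1ℤ
      E≡ = trans (eq E C) (cong₂ (λ s t → s ℤ.+ t ℤ.+ -1ℤ) a≡ k≡)
        where
        eq : ∀ e c → e ≡ (+ 0 ℤ.+ -1ℤ ℤ.* c) ℤ.+ (e ℤ.+ c ℤ.+ + 1) ℤ.+ -1ℤ
        eq = solve-∀
      size : a ℕ.+ (k ℕ.+ r) ≡ suc N
      size = ℤP.+-injective (begin
          + (a ℕ.+ (k ℕ.+ r))                                              ≡⟨ trans (ℤP.pos-+ a (k ℕ.+ r)) (cong (λ t → + a ℤ.+ t) (ℤP.pos-+ k r)) ⟩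
          + a ℤ.+ (+ k ℤ.+ + r)                                            ≡⟨ cong₂ ℤ._+_ (sym a≡) (cong₂ ℤ._+_ (sym k≡) (sym r≡)) ⟩
          (+ 0 ℤ.+ -1ℤ ℤ.* C) ℤ.+ ((E ℤ.+ C ℤ.+ + 1) ℤ.+ (+ N ℤ.+ -1ℤ ℤ.* E))   ≡⟨ eq E C (+ N) ⟩
          + 1 ℤ.+ + N ∎)
        where
        eq : ∀ e c m → (+ 0 ℤ.+ -1ℤ ℤ.* c) ℤ.+ ((e ℤ.+ c ℤ.+ + 1) ℤ.+ (m ℤ.+ -1ℤ ℤ.* e)) ≡ + 1 ℤ.+ m
        eq = solve-∀

    -- The comparison decides which of the two lower bounds absorbs the other. The hypotheses may
    -- use its outcome: `clamped-correct` obtains c ≤ 0 in this way.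
    pick-lower : ∀ c c′ e (g : ℕ → ℚ) A →
      (NonNeg (⟦ c′ ⟧ℓ n v ℤ.+ -1ℤ ℤ.* ⟦ c ⟧ℓ n v) → ⟦ A c ⟧ n v ≡ ∑ (suc N) (λ x → between c e x ℚ.* g x)) →
      (Neg (⟦ c′ ⟧ℓ n v ℤ.+ -1ℤ ℤ.* ⟦ c ⟧ℓ n v) → ⟦ A c′ ⟧ n v ≡ ∑ (suc N) (λ x → between c′ e x ℚ.* g x)) →
      ⟦ tighten M ρ₀ ρ c c′ A ⟧ n v ≡ ∑ (suc N) (λ x → between c e x ℚ.* (χ (+ x ℤ.+ ⟦ c′ ⟧ℓ n v) ℚ.* g x))
    pick-lower c c′ e g A hyp₁ hyp₂ = tighten-correct c c′ A
        (λ p → trans (hyp₁ p) (∑-cong (suc N) (λ x → sym (trans (r₀ (a x) (b x) (u x) (g x))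
                 (cong (λ t → t ℚ.* u x ℚ.* g x) (χ-min₁ (+ x ℤ.+ ⟦ c ⟧ℓ n v) (+ x ℤ.+ ⟦ c′ ⟧ℓ n v) p (eq (+ x) (⟦ c ⟧ℓ n v) (⟦ c′ ⟧ℓ n v))))))))
        (λ p → trans (hyp₂ p) (∑-cong (suc N) (λ x → sym (trans (r₀ (a x) (b x) (u x) (g x))
                 (cong (λ t → t ℚ.* u x ℚ.* g x) (χ-min₂ (+ x ℤ.+ ⟦ c ⟧ℓ n v) (+ x ℤ.+ ⟦ c′ ⟧ℓ n v) p (eq (+ x) (⟦ c ⟧ℓ n v) (⟦ c′ ⟧ℓ n v))))))))
      where
      a b u : ℕ → ℚ
      a x = χ (+ x ℤ.+ ⟦ c ⟧ℓ n v)
      b x = χ (+ x ℤ.+ ⟦ c′ ⟧ℓ n v)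
      u x = χ (⟦ e ⟧ℓ n v ℤ.+ -1ℤ ℤ.* + x)
      eq : ∀ x c d → (x ℤ.+ c) ℤ.+ (d ℤ.+ -1ℤ ℤ.* c) ≡ x ℤ.+ d
      eq = solve-∀
      r₀ : ∀ a b u g → a ℚ.* u ℚ.* (b ℚ.* g) ≡ a ℚ.* b ℚ.* u ℚ.* g
      r₀ = RS.solve-∀ ℚ-ring

    pick-upper : ∀ c e e′ (g : ℕ → ℚ) A →
      (NonNeg (⟦ e′ ⟧ℓ n v ℤ.+ -1ℤ ℤ.* ⟦ e ⟧ℓ n v) → ⟦ A e ⟧ n v ≡ ∑ (suc N) (λ x → between c e x ℚ.* g x)) →
      (Neg (⟦ e′ ⟧ℓ n v ℤ.+ -1ℤ ℤ.* ⟦ e ⟧ℓ n v) → ⟦ A e′ ⟧ n v ≡ ∑ (suc N) (λ x → between c e′ x ℚ.* g x)) →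
      ⟦ tighten M ρ₀ ρ e e′ A ⟧ n v ≡ ∑ (suc N) (λ x → between c e x ℚ.* (χ (⟦ e′ ⟧ℓ n v ℤ.+ -1ℤ ℤ.* + x) ℚ.* g x))
    pick-upper c e e′ g A hyp₁ hyp₂ = tighten-correct e e′ A
        (λ p → trans (hyp₁ p) (∑-cong (suc N) (λ x → sym (trans (r₀ (u x) (a x) (b x) (g x))
                 (cong (λ t → u x ℚ.* t ℚ.* g x) (χ-min₁ (⟦ e ⟧ℓ n v ℤ.+ -1ℤ ℤ.* + x) (⟦ e′ ⟧ℓ n v ℤ.+ -1ℤ ℤ.* + x) p (eq (+ x) (⟦ e ⟧ℓ n v) (⟦ e′ ⟧ℓ n v))))))))
        (λ p → trans (hyp₂ p) (∑-cong (suc N) (λ x → sym (trans (r₀ (u x) (a x) (b x) (g x))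
                 (cong (λ t → u x ℚ.* t ℚ.* g x) (χ-min₂ (⟦ e ⟧ℓ n v ℤ.+ -1ℤ ℤ.* + x) (⟦ e′ ⟧ℓ n v ℤ.+ -1ℤ ℤ.* + x) p (eq (+ x) (⟦ e ⟧ℓ n v) (⟦ e′ ⟧ℓ n v))))))))
      where
      a b u : ℕ → ℚ
      a x = χ (⟦ e ⟧ℓ n v ℤ.+ -1ℤ ℤ.* + x)
      b x = χ (⟦ e′ ⟧ℓ n v ℤ.+ -1ℤ ℤ.* + x)
      u x = χ (+ x ℤ.+ ⟦ c ⟧ℓ n v)
      eq : ∀ x c d → (c ℤ.+ -1ℤ ℤ.* x) ℤ.+ (d ℤ.+ -1ℤ ℤ.* c) ≡ d ℤ.+ -1ℤ ℤ.* x
      eq = solve-∀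
      r₀ : ∀ u a b g → u ℚ.* a ℚ.* (b ℚ.* g) ≡ u ℚ.* (a ℚ.* b) ℚ.* g
      r₀ = RS.solve-∀ ℚ-ring

    eval-top-≥ : ∀ x → x ℕ.< suc N → NonNeg (⟦ top M ρ₀ ρ ⟧ℓ n v ℤ.+ -1ℤ ℤ.* + x)
    eval-top-≥ x (ℕ.s≤s x≤N) = subst NonNeg (trans (eq (+ N) (+ x)) (cong (λ t → t ℤ.+ -1ℤ ℤ.* + x) (sym eval-top))) (ℤP.i≤j⇒0≤j-i (ℤ.+≤+ x≤N))
      where
      eq : ∀ m x → m ℤ.+ ℤ.- x ≡ m ℤ.+ -1ℤ ℤ.* x
      eq = solve-∀

    -- The inserted bounds x ≥ 0 and x ≤ N hold throughout the range of summation, so they do not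
    -- change the sum.
    clamped-correct : Correct (clamped M ρ₀ ρ) (λ _ → 1ℚ)
    clamped-correct l c e = trans
        (pick-lower c (con (+ 0)) e g (λ c → tighten M ρ₀ ρ e (top M ρ₀ ρ) (segment M ρ₀ ρ l c)) (λ p → below c p) (λ _ → below (con (+ 0)) (+-NonNeg 0)))
        (∑-cong (suc N) (λ x → cong (λ t → between c e x ℚ.* (t ℚ.* g x)) (χ-yes (NonNeg-+ (+-NonNeg x) (+-NonNeg 0) refl))))
      where
      g : ℕ → ℚ
      g x = newton 0 l n v (+ x)
      below : ∀ c → NonNeg (+ 0 ℤ.+ -1ℤ ℤ.* ⟦ c ⟧ℓ n v) →
        ⟦ tighten M ρ₀ ρ e (top M ρ₀ ρ) (segment M ρ₀ ρ l c) ⟧ n v ≡ ∑ (suc N) (λ x → between c e x ℚ.* g x)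
      below c p = trans
        (pick-upper c e (top M ρ₀ ρ) g (segment M ρ₀ ρ l c)
          (λ q → segment-correct l c e p (subst (λ t → NonNeg (t ℤ.+ -1ℤ ℤ.* ⟦ e ⟧ℓ n v)) eval-top q))
          (λ _ → segment-correct l c (top M ρ₀ ρ) p (subst (λ t → NonNeg (+ N ℤ.+ -1ℤ ℤ.* t)) (sym eval-top) (ℤP.≤-reflexive (sym (eq (+ N)))))))
        (∑-cong-< (suc N) (λ x x≤N → cong (between c e x ℚ.*_) (trans (cong (ℚ._* g x) (χ-yes (eval-top-≥ x x≤N))) (ℚP.*-identityˡ (g x)))))
        where
        eq : ∀ m → m ℤ.+ -1ℤ ℤ.* m ≡ + 0
        eq = solve-∀

    -- The integer `s` is x for a positive and -x for a negative coefficient, which treats lower and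
    -- upper bounds alike.
    χ-bound : ∀ j a x → suc j ∣ M → ∀ s → ⟦ a ⟧ℓ N (x ∷ Y) ≡ + suc j ℤ.* s ℤ.+ ⟦ offset M ρ₀ ρ a ⟧ℓ n v →
      χ (⟦ a ⟧ℓ N (x ∷ Y)) ≡ χ (s ℤ.+ ⟦ bound M ρ₀ ρ j a ⟧ℓ n v)
    χ-bound j a x d s e = begin
      χ (⟦ a ⟧ℓ N (x ∷ Y))                                   ≡⟨ cong χ e ⟩
      χ (+ suc j ℤ.* s ℤ.+ (+ M ℤ.* H ℤ.+ κ))                ≡⟨ cong (λ m → χ (+ suc j ℤ.* s ℤ.+ (m ℤ.* H ℤ.+ κ))) M≡ ⟩
      χ (+ suc j ℤ.* s ℤ.+ (+ q ℤ.* + suc j ℤ.* H ℤ.+ κ))    ≡⟨ cong χ (eq₁ (+ suc j) s (+ q) H κ) ⟩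
      χ (+ suc j ℤ.* (s ℤ.+ + q ℤ.* H) ℤ.+ κ)                ≡⟨ χ-floor j (s ℤ.+ + q ℤ.* H) κ ⟩
      χ (s ℤ.+ + q ℤ.* H ℤ.+ κ ℤD./ℕ suc j)                  ≡⟨ cong χ (ℤP.+-assoc s (+ q ℤ.* H) (κ ℤD./ℕ suc j)) ⟩
      χ (s ℤ.+ (+ q ℤ.* H ℤ.+ κ ℤD./ℕ suc j)) ∎
      where
      H κ : ℤ
      H = ⟦ hom (rest a) ⟧ℓ n v
      κ = ⟦ rest a ⟧ℓ ρ₀ ρ
      q : ℕ
      q = M ℕ./ suc j
      M≡ : + M ≡ + q ℤ.* + suc j
      M≡ = trans (cong +_ (sym (ℕD.m/n*n≡m d))) (ℤP.pos-* q (suc j))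
      eq₁ : ∀ j s q h k → j ℤ.* s ℤ.+ (q ℤ.* j ℤ.* h ℤ.+ k) ≡ j ℤ.* (s ℤ.+ q ℤ.* h) ℤ.+ k
      eq₁ = solve-∀

    elimInd-correct : ∀ z a k G → coef a ≡ z → lead z ∣ M → Correct k G →
      Correct (elimInd M ρ₀ ρ z a k) (λ x → χ (⟦ a ⟧ℓ N (x ∷ Y)) ℚ.* G x)
    elimInd-correct (+ 0) a k G z≡ d hyp l c e = begin
      A ℚ.* ⟦ k l c e ⟧ n v                                                            ≡⟨ cong (A ℚ.*_) (hyp l c e) ⟩
      A ℚ.* ∑ (suc N) (λ x → between c e x ℚ.* (G x ℚ.* g x))                          ≡⟨ ∑-*ˡ (suc N) A (λ x → between c e x ℚ.* (G x ℚ.* g x)) ⟨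
      ∑ (suc N) (λ x → A ℚ.* (between c e x ℚ.* (G x ℚ.* g x)))                        ≡⟨ ∑-cong (suc N) (λ x → trans (r₀ A (between c e x) (G x) (g x)) (cong (λ t → between c e x ℚ.* (t ℚ.* G x ℚ.* g x)) (χa x))) ⟩
      ∑ (suc N) (λ x → between c e x ℚ.* (χ (⟦ a ⟧ℓ N (x ∷ Y)) ℚ.* G x ℚ.* g x)) ∎
      where
      A : ℚ
      A = χ (⟦ offset M ρ₀ ρ a ⟧ℓ n v)
      g : ℕ → ℚ
      g x = newton 0 l n v (+ x)
      r₀ : ∀ a b c d → a ℚ.* (b ℚ.* (c ℚ.* d)) ≡ b ℚ.* (a ℚ.* c ℚ.* d)
      r₀ = RS.solve-∀ ℚ-ring
      χa : ∀ x → A ≡ χ (⟦ a ⟧ℓ N (x ∷ Y))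
      χa x = cong χ (sym (trans (eval-offset a x) (trans (cong (λ t → t ℤ.* + x ℤ.+ ⟦ offset M ρ₀ ρ a ⟧ℓ n v) z≡) (ℤP.+-identityˡ (⟦ offset M ρ₀ ρ a ⟧ℓ n v)))))
    elimInd-correct (+ suc j) a k G z≡ d hyp l c e = trans
        (pick-lower c (bound M ρ₀ ρ j a) e (λ x → G x ℚ.* g x) (λ c → k l c e) (λ _ → hyp l c e) (λ _ → hyp l (bound M ρ₀ ρ j a) e))
        (∑-cong (suc N) (λ x → cong (between c e x ℚ.*_) (trans (cong (ℚ._* (G x ℚ.* g x)) (sym (χ-bound j a x d (+ x)
            (trans (eval-offset a x) (cong (λ t → t ℤ.* + x ℤ.+ ⟦ offset M ρ₀ ρ a ⟧ℓ n v) z≡))))) (sym (ℚP.*-assoc (χ (⟦ a ⟧ℓ N (x ∷ Y))) (G x) (g x))))))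
      where
      g : ℕ → ℚ
      g x = newton 0 l n v (+ x)
    elimInd-correct -[1+ j ] a k G z≡ d hyp l c e = trans
        (pick-upper c e (bound M ρ₀ ρ j a) (λ x → G x ℚ.* g x) (λ e → k l c e) (λ _ → hyp l c e) (λ _ → hyp l c (bound M ρ₀ ρ j a)))
        (∑-cong (suc N) (λ x → cong (between c e x ℚ.*_) (trans (cong (ℚ._* (G x ℚ.* g x)) (sym (trans (χ-bound j a x d (-1ℤ ℤ.* + x)
            (trans (eval-offset a x) (cong (ℤ._+ ⟦ offset M ρ₀ ρ a ⟧ℓ n v) (trans (cong (ℤ._* + x) z≡) (eq (+ suc j) (+ x))))))
            (cong χ (ℤP.+-comm (-1ℤ ℤ.* + x) (⟦ bound M ρ₀ ρ j a ⟧ℓ n v)))))) (sym (ℚP.*-assoc (χ (⟦ a ⟧ℓ N (x ∷ Y))) (G x) (g x))))))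
      where
      g : ℕ → ℚ
      g x = newton 0 l n v (+ x)
      eq : ∀ j x → (ℤ.- j) ℤ.* x ≡ j ℤ.* (-1ℤ ℤ.* x)
      eq = solve-∀

    elim-correct : ∀ f k G → Divisible M f → Correct k G → Correct (elim M ρ₀ ρ f k) (λ x → ⟦ f ⟧ N (x ∷ Y) ℚ.* G x)
    elim-correct (con q) k G d hyp l c e = trans (hyp (map (con q ⊗_) l) c e)
      (∑-cong (suc N) (λ x → cong (between c e x ℚ.*_) (trans (cong (G x ℚ.*_) (newton-scale (con q) 0 l n v (+ x))) (r₀ (G x) q (newton 0 l n v (+ x))))))
      where
      r₀ : ∀ a b c → a ℚ.* (b ℚ.* c) ≡ b ℚ.* a ℚ.* c
      r₀ = RS.solve-∀ ℚ-ring
    elim-correct (lin a) k G d hyp l c e = begin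
      ⟦ k l₁ c e ⟧ n v ℚ.+ ⟦ k l₂ c e ⟧ n v        ≡⟨ cong₂ ℚ._+_ (hyp l₁ c e) (hyp l₂ c e) ⟩
      ∑ (suc N) (λ x → between c e x ℚ.* (G x ℚ.* newton 0 l₁ n v (+ x))) ℚ.+ ∑ (suc N) (λ x → between c e x ℚ.* (G x ℚ.* newton 0 l₂ n v (+ x)))
        ≡⟨ ∑-+ (suc N) (λ x → between c e x ℚ.* (G x ℚ.* newton 0 l₁ n v (+ x))) (λ x → between c e x ℚ.* (G x ℚ.* newton 0 l₂ n v (+ x))) ⟨
      ∑ (suc N) (λ x → between c e x ℚ.* (G x ℚ.* newton 0 l₁ n v (+ x)) ℚ.+ between c e x ℚ.* (G x ℚ.* newton 0 l₂ n v (+ x)))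
        ≡⟨ ∑-cong (suc N) (λ x → trans (cong₂ (λ s t → between c e x ℚ.* (G x ℚ.* s) ℚ.+ between c e x ℚ.* (G x ℚ.* t)) (ev₁ x) (newton-scale (lin (offset M ρ₀ ρ a)) 0 l n v (+ x)))
             (trans (r₀ (between c e x) (G x) (ι (coef a)) (ι (+ x)) (g x) (ι B)) (cong (λ t → between c e x ℚ.* (t ℚ.* G x ℚ.* g x)) (sym (ev₂ x))))) ⟩
      ∑ (suc N) (λ x → between c e x ℚ.* (ι (⟦ a ⟧ℓ N (x ∷ Y)) ℚ.* G x ℚ.* g x)) ∎
      where
      l₁ l₂ : List (Fn D)
      l₁ = map (con (ι (coef a)) ⊗_) (mulx 0 (con 0ℚ) l)
      l₂ = map (lin (offset M ρ₀ ρ a) ⊗_) l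
      g : ℕ → ℚ
      g x = newton 0 l n v (+ x)
      B : ℤ
      B = ⟦ offset M ρ₀ ρ a ⟧ℓ n v
      ev₁ : ∀ x → newton 0 l₁ n v (+ x) ≡ ι (coef a) ℚ.* (0ℚ ℚ.* 1ℚ ℚ.+ ι (+ x) ℚ.* g x)
      ev₁ x = trans (newton-scale (con (ι (coef a))) 0 (mulx 0 (con 0ℚ) l) n v (+ x)) (cong (ι (coef a) ℚ.*_) (newton-mulx 0 (con 0ℚ) l n v (+ x)))
      ev₂ : ∀ x → ι (⟦ a ⟧ℓ N (x ∷ Y)) ≡ ι (coef a) ℚ.* ι (+ x) ℚ.+ ι B
      ev₂ x = trans (cong ι (eval-offset a x)) (trans (ι-+ (coef a ℤ.* + x) B) (cong (ℚ._+ ι B) (ι-* (coef a) (+ x))))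
      r₀ : ∀ w G α x g b → w ℚ.* (G ℚ.* (α ℚ.* (0ℚ ℚ.* 1ℚ ℚ.+ x ℚ.* g))) ℚ.+ w ℚ.* (G ℚ.* (b ℚ.* g)) ≡ w ℚ.* ((α ℚ.* x ℚ.+ b) ℚ.* G ℚ.* g)
      r₀ = RS.solve-∀ ℚ-ring
    elim-correct (ind a) k G d hyp = elimInd-correct (coef a) a k G refl d hyp
    elim-correct (f ⊕ h) k G (d₁ , d₂) hyp l c e = begin
      ⟦ elim M ρ₀ ρ f k l c e ⟧ n v ℚ.+ ⟦ elim M ρ₀ ρ h k l c e ⟧ n v   ≡⟨ cong₂ ℚ._+_ (elim-correct f k G d₁ hyp l c e) (elim-correct h k G d₂ hyp l c e) ⟩
      ∑ (suc N) (λ x → w x ℚ.* (F x ℚ.* G x ℚ.* g x)) ℚ.+ ∑ (suc N) (λ x → w x ℚ.* (H x ℚ.* G x ℚ.* g x))   ≡⟨ ∑-+ (suc N) (λ x → w x ℚ.* (F x ℚ.* G x ℚ.* g x)) (λ x → w x ℚ.* (H x ℚ.* G x ℚ.* g x)) ⟨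
      ∑ (suc N) (λ x → w x ℚ.* (F x ℚ.* G x ℚ.* g x) ℚ.+ w x ℚ.* (H x ℚ.* G x ℚ.* g x))   ≡⟨ ∑-cong (suc N) (λ x → r₀ (w x) (F x) (H x) (G x) (g x)) ⟩
      ∑ (suc N) (λ x → w x ℚ.* ((F x ℚ.+ H x) ℚ.* G x ℚ.* g x)) ∎
      where
      w F H g : ℕ → ℚ
      w = between c e
      F x = ⟦ f ⟧ N (x ∷ Y)
      H x = ⟦ h ⟧ N (x ∷ Y)
      g x = newton 0 l n v (+ x)
      r₀ : ∀ w f h G g → w ℚ.* (f ℚ.* G ℚ.* g) ℚ.+ w ℚ.* (h ℚ.* G ℚ.* g) ≡ w ℚ.* ((f ℚ.+ h) ℚ.* G ℚ.* g)
      r₀ = RS.solve-∀ ℚ-ring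
    elim-correct (f ⊗ h) k G (d₁ , d₂) hyp l c e = trans
      (elim-correct f (elim M ρ₀ ρ h k) (λ x → ⟦ h ⟧ N (x ∷ Y) ℚ.* G x) d₁ (elim-correct h k G d₂ hyp) l c e)
      (∑-cong (suc N) (λ x → cong (λ t → between c e x ℚ.* (t ℚ.* newton 0 l n v (+ x))) (sym (ℚP.*-assoc (⟦ f ⟧ N (x ∷ Y)) (⟦ h ⟧ N (x ∷ Y)) (G x)))))

    eliminate-correct : ∀ f → Divisible M f → ⟦ eliminate M ρ₀ ρ f ⟧ n v ≡ ∑ (suc N) (λ x → ⟦ f ⟧ N (x ∷ Y))
    eliminate-correct f d = trans
      (elim-correct f (clamped M ρ₀ ρ) (λ _ → 1ℚ) d clamped-correct (con 1ℚ ∷ []) (con (+ 0)) (top M ρ₀ ρ))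
      (∑-cong-< (suc N) (λ x x≤N → trans (cong₂ (λ s t → s ℚ.* t ℚ.* (⟦ f ⟧ N (x ∷ Y) ℚ.* 1ℚ ℚ.* (1ℚ ℚ.* 1ℚ ℚ.+ 0ℚ)))
          (χ-yes (NonNeg-+ (+-NonNeg x) (+-NonNeg 0) refl)) (χ-yes (eval-top-≥ x x≤N))) (r₀ (⟦ f ⟧ N (x ∷ Y)))))
      where
      r₀ : ∀ t → 1ℚ ℚ.* 1ℚ ℚ.* (t ℚ.* 1ℚ ℚ.* (1ℚ ℚ.* 1ℚ ℚ.+ 0ℚ)) ≡ t
      r₀ = RS.solve-∀ ℚ-ring

-- Signs of integer polynomials at infinity.

module EventualSign where

  open import Data.Nat as ℕ using (ℕ; zero; suc)
  import Data.Nat.Properties as ℕP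
  open import Data.Integer as ℤ using (ℤ; +_; -[1+_])
  import Data.Integer.Properties as ℤP
  open import Data.Integer.Tactic.RingSolver using (solve-∀)
  open import Data.List using ([]; _∷_)
  open import Data.Product using (∃; _,_)
  open import Relation.Binary.PropositionalEquality
  open Indicator

  Eventually : (ℕ → Set) → Set
  Eventually P = ∃ λ N → ∀ n → N ℕ.≤ n → P n

  ev-map : ∀ {P Q : ℕ → Set} → (∀ n → P n → Q n) → Eventually P → Eventually Q
  ev-map f (N , p) = N , λ n n≥N → f n (p n n≥N)

  ev-zip : ∀ {P Q R : ℕ → Set} → (∀ n → P n → Q n → R n) → Eventually P → Eventually Q → Eventually R
  ev-zip f (N , p) (M , q) = N ℕ.⊔ M , λ n le →
    f n (p n (ℕP.≤-trans (ℕP.m≤m⊔n N M) le)) (q n (ℕP.≤-trans (ℕP.m≤n⊔m N M) le))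

  always : ∀ {P : ℕ → Set} → (∀ n → P n) → Eventually P
  always p = 0 , λ n _ → p n

  ev-≥ : ∀ k → Eventually (k ℕ.≤_)
  ev-≥ k = k , λ n p → p

  record Pos (z : ℤ) : Set where
    constructor mkPos
    field nonneg : NonNeg (z ℤ.+ -1ℤ)

  -- Trichotomy in the ordered ring of germs at infinity, kept as data because the elimination
  -- branches on it.
  data EvSign (f : ℕ → ℤ) : Set where
    ev-zero : Eventually (λ n → f n ≡ + 0) → EvSign f
    ev-pos  : Eventually (λ n → Pos (f n)) → EvSign f
    ev-neg  : Eventually (λ n → Neg (f n)) → EvSign f

  const-sign : ∀ z → EvSign (λ _ → z)
  const-sign (+ zero)  = ev-zero (always λ _ → refl)
  const-sign (+ suc k) = ev-pos (always λ _ → mkPos (ℤ.+≤+ ℕ.z≤n))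
  const-sign -[1+ k ]  = ev-neg (always λ _ → neg (subst NonNeg (eq (+ suc k)) (ℤ.+≤+ (ℕ.z≤n {k}))))
    where
    eq : ∀ a → -1ℤ ℤ.+ a ≡ -1ℤ ℤ.+ -1ℤ ℤ.* (ℤ.- a)
    eq = solve-∀

  EvSign-ext : ∀ {f g} → Eventually (λ n → g n ≡ f n) → EvSign f → EvSign g
  EvSign-ext e (ev-zero h) = ev-zero (ev-zip (λ n e p → trans e p) e h)
  EvSign-ext e (ev-pos h)  = ev-pos (ev-zip (λ n e p → subst Pos (sym e) p) e h)
  EvSign-ext e (ev-neg h)  = ev-neg (ev-zip (λ n e p → subst Neg (sym e) p) e h)

  abs+ : ∀ a → NonNeg (a ℤ.+ + ℤ.∣ a ∣)
  abs+ (+ n)    = ℤ.+≤+ ℕ.z≤n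
  abs+ -[1+ n ] = ℤP.≤-reflexive (sym (ℤP.+-inverseˡ (+ suc n)))

  abs- : ∀ a → NonNeg (+ ℤ.∣ a ∣ ℤ.+ -1ℤ ℤ.* a)
  abs- (+ n)    = ℤP.≤-reflexive (sym (eq (+ n)))
    where
    eq : ∀ a → a ℤ.+ -1ℤ ℤ.* a ≡ + 0
    eq = solve-∀
  abs- -[1+ n ] = NonNeg-+ (+-NonNeg (suc n)) (+-NonNeg (suc n)) (eq (+ suc n))
    where
    eq : ∀ a → a ℤ.+ a ≡ a ℤ.+ -1ℤ ℤ.* (ℤ.- a)
    eq = solve-∀

  -- The value is a + n q(n). If q(n) is nonzero for large n, it is at least 1 in absolute value,
  -- and once n > |a| the sign of q(n) wins; otherwise the constant a is left.
  poly-sign : ∀ p → EvSign (λ n → evalℤ p (+ n))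
  poly-sign []       = const-sign (+ 0)
  poly-sign (a ∷ as) with poly-sign as
  ... | ev-zero h = EvSign-ext (ev-map (λ n e → trans (cong (λ t → a ℤ.+ + n ℤ.* t) e) (eq a (+ n))) h) (const-sign a)
    where
    eq : ∀ a n → a ℤ.+ n ℤ.* + 0 ≡ a
    eq = solve-∀
  ... | ev-pos h = ev-pos (ev-zip (λ n p le → mkPos (NonNeg-+ (NonNeg-+ (abs+ a) (ℤP.i≤j⇒0≤j-i (ℤ.+≤+ le)) refl) (NonNeg-* (+-NonNeg n) (Pos.nonneg p)) (eq a (+ ℤ.∣ a ∣) (+ n) (evalℤ as (+ n))))) h (ev-≥ (suc ℤ.∣ a ∣)))
    where
    eq : ∀ a b n e → (a ℤ.+ b) ℤ.+ (n ℤ.+ ℤ.- (+ 1 ℤ.+ b)) ℤ.+ n ℤ.* (e ℤ.+ -1ℤ) ≡ (a ℤ.+ n ℤ.* e) ℤ.+ -1ℤ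
    eq = solve-∀
  ... | ev-neg h = ev-neg (ev-zip (λ n p le → neg (NonNeg-+ (NonNeg-+ (abs- a) (ℤP.i≤j⇒0≤j-i (ℤ.+≤+ le)) refl) (NonNeg-* (+-NonNeg n) (Neg.nonneg p)) (eq a (+ ℤ.∣ a ∣) (+ n) (evalℤ as (+ n))))) h (ev-≥ (suc ℤ.∣ a ∣)))
    where
    eq : ∀ a b n e → (b ℤ.+ -1ℤ ℤ.* a) ℤ.+ (n ℤ.+ ℤ.- (+ 1 ℤ.+ b)) ℤ.+ n ℤ.* (-1ℤ ℤ.+ -1ℤ ℤ.* e) ≡ -1ℤ ℤ.+ -1ℤ ℤ.* (a ℤ.+ n ℤ.* e)
    eq = solve-∀

-- Eventually polynomial and quasi-polynomial functions.

module QuasiPolynomials where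

  open import Data.Nat as ℕ using (ℕ; zero; suc)
  import Data.Nat.Properties as ℕP
  import Data.Nat.DivMod as ℕD
  open import Data.Nat.DivMod using (_mod_)
  open import Data.Nat.Tactic.RingSolver using (solve-∀)
  open import Data.Integer using (+_)
  import Data.Integer.Properties as ℤP
  open import Data.Fin as Fin using (Fin; toℕ)
  import Data.Fin.Properties as FinP
  open import Data.Vec using (Vec; []; _∷_)
  open import Data.List using ([]; _∷_; map)
  open import Data.Product using (Σ; ∃; _,_; proj₁; proj₂)
  open import Relation.Binary.PropositionalEquality
  open ≡-Reasoning
  open ℚ using (ℚ; 0ℚ; 1ℚ)
  open Embedding
  open Sums
  open EventualSign

  _+ᵖ_ : QPoly → QPoly → QPoly
  []       +ᵖ q        = q
  (a ∷ as) +ᵖ []       = a ∷ as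
  (a ∷ as) +ᵖ (b ∷ bs) = (a ℚ.+ b) ∷ (as +ᵖ bs)

  _*ᵖ_ : QPoly → QPoly → QPoly
  []       *ᵖ q = []
  (a ∷ as) *ᵖ q = map (a ℚ.*_) q +ᵖ (0ℚ ∷ (as *ᵖ q))

  _∘ᵖ_ : QPoly → QPoly → QPoly
  []       ∘ᵖ q = []
  (a ∷ as) ∘ᵖ q = (a ∷ []) +ᵖ (q *ᵖ (as ∘ᵖ q))

  eval-+ᵖ : ∀ p q t → evalℚ (p +ᵖ q) t ≡ evalℚ p t ℚ.+ evalℚ q t
  eval-+ᵖ []       q        t = sym (ℚP.+-identityˡ (evalℚ q t))
  eval-+ᵖ (a ∷ as) []       t = sym (ℚP.+-identityʳ (evalℚ (a ∷ as) t))
  eval-+ᵖ (a ∷ as) (b ∷ bs) t = trans (cong (λ u → a ℚ.+ b ℚ.+ t ℚ.* u) (eval-+ᵖ as bs t)) (r a b t (evalℚ as t) (evalℚ bs t))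
    where
    r : ∀ a b t u v → a ℚ.+ b ℚ.+ t ℚ.* (u ℚ.+ v) ≡ (a ℚ.+ t ℚ.* u) ℚ.+ (b ℚ.+ t ℚ.* v)
    r = RS.solve-∀ ℚ-ring

  eval-map* : ∀ a q t → evalℚ (map (a ℚ.*_) q) t ≡ a ℚ.* evalℚ q t
  eval-map* a []       t = sym (ℚP.*-zeroʳ a)
  eval-map* a (b ∷ bs) t = trans (cong (λ u → a ℚ.* b ℚ.+ t ℚ.* u) (eval-map* a bs t)) (r a b t (evalℚ bs t))
    where
    r : ∀ a b t v → a ℚ.* b ℚ.+ t ℚ.* (a ℚ.* v) ≡ a ℚ.* (b ℚ.+ t ℚ.* v)
    r = RS.solve-∀ ℚ-ring

  eval-*ᵖ : ∀ p q t → evalℚ (p *ᵖ q) t ≡ evalℚ p t ℚ.* evalℚ q t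
  eval-*ᵖ []       q t = sym (ℚP.*-zeroˡ (evalℚ q t))
  eval-*ᵖ (a ∷ as) q t = trans (eval-+ᵖ (map (a ℚ.*_) q) (0ℚ ∷ (as *ᵖ q)) t)
    (trans (cong₂ (λ u v → u ℚ.+ (0ℚ ℚ.+ t ℚ.* v)) (eval-map* a q t) (eval-*ᵖ as q t)) (r a t (evalℚ as t) (evalℚ q t)))
    where
    r : ∀ a t u v → a ℚ.* v ℚ.+ (0ℚ ℚ.+ t ℚ.* (u ℚ.* v)) ≡ (a ℚ.+ t ℚ.* u) ℚ.* v
    r = RS.solve-∀ ℚ-ring

  eval-∘ᵖ : ∀ p q t → evalℚ (p ∘ᵖ q) t ≡ evalℚ p (evalℚ q t)
  eval-∘ᵖ []       q t = refl
  eval-∘ᵖ (a ∷ as) q t = trans (eval-+ᵖ (a ∷ []) (q *ᵖ (as ∘ᵖ q)) t)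
    (trans (cong₂ ℚ._+_ (r a t) (eval-*ᵖ q (as ∘ᵖ q) t)) (cong (λ u → a ℚ.+ evalℚ q t ℚ.* u) (eval-∘ᵖ as q t)))
    where
    r : ∀ a t → a ℚ.+ t ℚ.* 0ℚ ≡ a
    r = RS.solve-∀ ℚ-ring

  EP : (ℕ → ℚ) → Set
  EP g = Σ QPoly λ p → Eventually (λ n → g n ≡ evalℚ p (ℕtoℚ n))

  EP-ext : ∀ {g h} → (∀ n → g n ≡ h n) → EP h → EP g
  EP-ext e (p , q) = p , ev-map (λ n → trans (e n)) q

  EP-const : ∀ {g} c → Eventually (λ n → g n ≡ c) → EP g
  EP-const c h = c ∷ [] , ev-map (λ n e → trans e (sym (r c (ℕtoℚ n)))) h
    where
    r : ∀ a t → a ℚ.+ t ℚ.* 0ℚ ≡ a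
    r = RS.solve-∀ ℚ-ring

  EP-+ : ∀ {g h} → EP g → EP h → EP (λ n → g n ℚ.+ h n)
  EP-+ (p , hp) (q , hq) = p +ᵖ q , ev-zip (λ n e f → trans (cong₂ ℚ._+_ e f) (sym (eval-+ᵖ p q (ℕtoℚ n)))) hp hq

  EP-* : ∀ {g h} → EP g → EP h → EP (λ n → g n ℚ.* h n)
  EP-* (p , hp) (q , hq) = p *ᵖ q , ev-zip (λ n e f → trans (cong₂ ℚ._*_ e f) (sym (eval-*ᵖ p q (ℕtoℚ n)))) hp hq

  EP-dilate : ∀ {g} k → EP g → EP (λ n → g (n ℕ.* suc k))
  EP-dilate k (p , N , h) = p ∘ᵖ (0ℚ ∷ ℕtoℚ (suc k) ∷ []) , N , λ n le →
    trans (h (n ℕ.* suc k) (ℕP.≤-trans le (ℕP.m≤m*n n (suc k))))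
      (trans (cong (evalℚ p) (trans (cong ι (ℤP.pos-* n (suc k))) (trans (ι-* (+ n) (+ suc k)) (r (ℕtoℚ n) (ℕtoℚ (suc k))))))
             (sym (eval-∘ᵖ p (0ℚ ∷ ℕtoℚ (suc k) ∷ []) (ℕtoℚ n))))
    where
    r : ∀ t s → t ℚ.* s ≡ 0ℚ ℚ.+ t ℚ.* (s ℚ.+ t ℚ.* 0ℚ)
    r = RS.solve-∀ ℚ-ring

  -- Quasi-polynomial of period suc k.
  QPeriod : ℕ → (ℕ → ℚ) → Set
  QPeriod k g = ∀ ρ → EP (λ t → g (ρ ℕ.+ t ℕ.* suc k))

  EQP : (ℕ → ℚ) → Set
  EQP g = ∃ λ k → QPeriod k g

  EQP-ext : ∀ {g h} → (∀ n → g n ≡ h n) → EQP h → EQP g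
  EQP-ext e (k , q) = k , λ ρ → EP-ext (λ t → e (ρ ℕ.+ t ℕ.* suc k)) (q ρ)

  EP⇒EQP : ∀ {g} → EP g → EQP g
  EP⇒EQP {g} (p , N , h) = 0 , λ ρ → p ∘ᵖ (ℕtoℚ ρ ∷ 1ℚ ∷ []) , N , λ t le →
    trans (h (ρ ℕ.+ t ℕ.* 1) (ℕP.≤-trans le (ℕP.≤-trans (ℕP.m≤m*n t 1) (ℕP.m≤n+m (t ℕ.* 1) ρ))))
      (trans (cong (evalℚ p) (trans (cong ι (trans (cong +_ (cong (ρ ℕ.+_) (ℕP.*-identityʳ t))) (ℤP.pos-+ ρ t))) (trans (ι-+ (+ ρ) (+ t)) (r (ℕtoℚ ρ) (ℕtoℚ t)))))
             (sym (eval-∘ᵖ p (ℕtoℚ ρ ∷ 1ℚ ∷ []) (ℕtoℚ t))))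
    where
    r : ∀ a t → a ℚ.+ t ≡ a ℚ.+ t ℚ.* (1ℚ ℚ.+ t ℚ.* 0ℚ)
    r = RS.solve-∀ ℚ-ring

  -- The offset ρ is arbitrary in `QPeriod`, not just a residue, so it is kept and only the step is
  -- dilated.
  QPeriod-refine : ∀ {g} k m ℓ → suc ℓ ≡ suc k ℕ.* suc m → QPeriod k g → QPeriod ℓ g
  QPeriod-refine {g} k m ℓ e q ρ = EP-ext (λ t → cong (λ u → g (ρ ℕ.+ u)) (trans (cong (t ℕ.*_) e) (eq t (suc k) (suc m)))) (EP-dilate m (q ρ))
    where
    eq : ∀ t k m → t ℕ.* (k ℕ.* m) ≡ t ℕ.* m ℕ.* k
    eq = solve-∀

  EQP-+ : ∀ {g h} → EQP g → EQP h → EQP (λ n → g n ℚ.+ h n)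
  EQP-+ {g} {h} (k , p) (m , q) = m ℕ.+ k ℕ.* suc m , λ ρ →
    EP-+ (QPeriod-refine {g} k m (m ℕ.+ k ℕ.* suc m) refl p ρ) (QPeriod-refine {h} m k (m ℕ.+ k ℕ.* suc m) (ℕP.*-comm (suc k) (suc m)) q ρ)

  EQP-∑ : ∀ b {g : ℕ → ℕ → ℚ} → (∀ i → EQP (g i)) → EQP (λ n → ∑ b (λ i → g i n))
  EQP-∑ zero    h = EP⇒EQP (EP-const 0ℚ (always λ _ → refl))
  EQP-∑ (suc b) {g} h = EQP-+ {g 0} {λ n → ∑ b (λ i → g (suc i) n)} (h 0) (EQP-∑ b {λ i → g (suc i)} (λ i → h (suc i)))

  EQP-box : ∀ b D {g : Vec ℕ D → ℕ → ℚ} → (∀ v → EQP (g v)) → EQP (λ n → box b D (λ v → g v n))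
  EQP-box b zero    h = h []
  EQP-box b (suc D) {g} h = EQP-box b D {λ v n → ∑ b (λ x → g (x ∷ v) n)} (λ v → EQP-∑ b {λ x → g (x ∷ v)} (λ x → h (x ∷ v)))

  common-period : ∀ M {g : ℕ → ℕ → ℚ} → (∀ ρ → ρ ℕ.< M → EQP (g ρ)) → ∃ λ k → ∀ ρ → ρ ℕ.< M → QPeriod k (g ρ)
  common-period zero    h = 0 , λ ρ ()
  common-period (suc M) {g} h with h 0 ℕ.z<s | common-period M {λ ρ → g (suc ρ)} (λ ρ ρ<M → h (suc ρ) (ℕ.s<s ρ<M))
  ... | k , p | m , q = m ℕ.+ k ℕ.* suc m , λ where
    zero    _           → QPeriod-refine {g 0} k m _ refl p
    (suc ρ) (ℕ.s≤s ρ<M) → QPeriod-refine {g (suc ρ)} m k _ (ℕP.*-comm (suc k) (suc m)) (q ρ ρ<M)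

  -- An offset ρ is divided by m + 1: the remainder selects the class, and the quotient becomes an
  -- offset within this class, which `QPeriod` allows to exceed the period.
  EQP-interleave : ∀ m {g} → (∀ ρ → ρ ℕ.< suc m → EQP (λ t → g (ρ ℕ.+ t ℕ.* suc m))) → EQP g
  EQP-interleave m {g} h with common-period (suc m) {λ ρ t → g (ρ ℕ.+ t ℕ.* suc m)} h
  ... | k , q = m ℕ.+ k ℕ.* suc m , λ ρ →
    EP-ext (λ t → cong g (begin
        ρ ℕ.+ t ℕ.* (suc k ℕ.* suc m)                                        ≡⟨ cong (ℕ._+ t ℕ.* (suc k ℕ.* suc m)) (ℕD.m≡m%n+[m/n]*n ρ (suc m)) ⟩
        ρ ℕD.% suc m ℕ.+ ρ ℕD./ suc m ℕ.* suc m ℕ.+ t ℕ.* (suc k ℕ.* suc m)  ≡⟨ eq (ρ ℕD.% suc m) (ρ ℕD./ suc m) (suc m) t (suc k) ⟩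
        ρ ℕD.% suc m ℕ.+ (ρ ℕD./ suc m ℕ.+ t ℕ.* suc k) ℕ.* suc m ∎))
      (q (ρ ℕD.% suc m) (ℕD.m%n<n ρ (suc m)) (ρ ℕD./ suc m))
    where
    eq : ∀ r q m t k → r ℕ.+ q ℕ.* m ℕ.+ t ℕ.* (k ℕ.* m) ≡ r ℕ.+ (q ℕ.+ t ℕ.* k) ℕ.* m
    eq = solve-∀

  EP-unshift : ∀ {g} → EP (λ t → g (suc t)) → EP g
  EP-unshift {g} (p , N , h) = p ∘ᵖ (ℚ.- 1ℚ ∷ 1ℚ ∷ []) , suc N , λ where
      (suc t) (ℕ.s≤s le) → trans (h t le) (trans (cong (evalℚ p) (pred t)) (sym (eval-∘ᵖ p (ℚ.- 1ℚ ∷ 1ℚ ∷ []) (ℕtoℚ (suc t)))))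
    where
    r : ∀ t → t ≡ ℚ.- 1ℚ ℚ.+ (1ℚ ℚ.+ t) ℚ.* (1ℚ ℚ.+ (1ℚ ℚ.+ t) ℚ.* 0ℚ)
    r = RS.solve-∀ ℚ-ring
    pred : ∀ t → ℕtoℚ t ≡ ℚ.- 1ℚ ℚ.+ ℕtoℚ (suc t) ℚ.* (1ℚ ℚ.+ ℕtoℚ (suc t) ℚ.* 0ℚ)
    pred t = trans (r (ℕtoℚ t)) (cong (λ u → ℚ.- 1ℚ ℚ.+ u ℚ.* (1ℚ ℚ.+ u ℚ.* 0ℚ)) (sym (ι-+ (+ 1) (+ t))))

  -- Undoes the passage from n to the parameter n - 1 of the digit forms.
  EQP-unshift : ∀ {g} → EQP (λ n → g (suc n)) → EQP g
  EQP-unshift {g} (k , q) = k , λ where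
    -- Without its first element, the class of offset 0 is the class of offset k of the shifted
    -- function.
    zero    → EP-unshift {λ t → g (t ℕ.* suc k)} (q k)
    (suc ρ) → q ρ

  upper-bound : ∀ s (h : Fin s → ℕ) → ∃ λ B → ∀ i → h i ℕ.≤ B
  upper-bound zero    h = 0 , λ ()
  upper-bound (suc s) h with upper-bound s (λ i → h (Fin.suc i))
  ... | B , p = h Fin.zero ℕ.⊔ B , λ where
    Fin.zero    → ℕP.m≤m⊔n (h Fin.zero) B
    (Fin.suc i) → ℕP.≤-trans (p i) (ℕP.m≤n⊔m (h Fin.zero) B)

  EQP⇒polynomials : ∀ {g} → EQP g → ∃ λ k → Σ (Fin (suc k) → QPoly) λ f →
    Eventually (λ n → g n ≡ evalℚ (f (n mod suc k)) (ℕtoℚ n))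
  -- Here B bounds the thresholds of all classes, and n ≥ B s makes the quotient of n by s at least
  -- B.
  EQP⇒polynomials {g} (k , q) = k , f , B ℕ.* s , good
    where
    s : ℕ
    s = suc k
    -- The linear polynomial (X - i)/s, which recovers t from i + t s.
    shift : ℕ → QPoly
    shift i = ℚ.- (ℕtoℚ i ℚ.* recip k) ∷ recip k ∷ []
    f : Fin s → QPoly
    f i = proj₁ (q (toℕ i)) ∘ᵖ shift (toℕ i)
    B : ℕ
    B = proj₁ (upper-bound s (λ i → proj₁ (proj₂ (q (toℕ i)))))
    shift-eval : ∀ i t → evalℚ (shift i) (ℕtoℚ (i ℕ.+ t ℕ.* s)) ≡ ℕtoℚ t
    shift-eval i t = begin
      ℚ.- (I ℚ.* recip k) ℚ.+ X ℚ.* (recip k ℚ.+ X ℚ.* 0ℚ)      ≡⟨ r₁ I (recip k) X ⟩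
      (X ℚ.+ ℚ.- I) ℚ.* recip k                                 ≡⟨ cong (λ u → (u ℚ.+ ℚ.- I) ℚ.* recip k) X≡ ⟩
      (I ℚ.+ ℕtoℚ t ℚ.* ℕtoℚ s ℚ.+ ℚ.- I) ℚ.* recip k           ≡⟨ r₂ I (ℕtoℚ t) (ℕtoℚ s) (recip k) ⟩
      ℕtoℚ t ℚ.* (ℕtoℚ s ℚ.* recip k)                           ≡⟨ cong (ℕtoℚ t ℚ.*_) (recip-inverse k) ⟩
      ℕtoℚ t ℚ.* 1ℚ                                             ≡⟨ ℚP.*-identityʳ (ℕtoℚ t) ⟩
      ℕtoℚ t ∎
      where
      I X : ℚ
      I = ℕtoℚ i
      X = ℕtoℚ (i ℕ.+ t ℕ.* s)
      X≡ : X ≡ I ℚ.+ ℕtoℚ t ℚ.* ℕtoℚ s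
      X≡ = trans (cong ι (ℤP.pos-+ i (t ℕ.* s))) (trans (ι-+ (+ i) (+ (t ℕ.* s))) (cong (I ℚ.+_) (trans (cong ι (ℤP.pos-* t s)) (ι-* (+ t) (+ s)))))
      r₁ : ∀ i r x → ℚ.- (i ℚ.* r) ℚ.+ x ℚ.* (r ℚ.+ x ℚ.* 0ℚ) ≡ (x ℚ.+ ℚ.- i) ℚ.* r
      r₁ = RS.solve-∀ ℚ-ring
      r₂ : ∀ i t s r → (i ℚ.+ t ℚ.* s ℚ.+ ℚ.- i) ℚ.* r ≡ t ℚ.* (s ℚ.* r)
      r₂ = RS.solve-∀ ℚ-ring
    good : ∀ n → B ℕ.* s ℕ.≤ n → g n ≡ evalℚ (f (n mod s)) (ℕtoℚ n)
    good n le = begin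
      g n                                              ≡⟨ cong g n≡ ⟩
      g (i ℕ.+ t ℕ.* s)                                ≡⟨ proj₂ (proj₂ (q i)) t (ℕP.≤-trans (proj₂ (upper-bound s (λ i → proj₁ (proj₂ (q (toℕ i))))) (n mod s)) B≤t) ⟩
      evalℚ (proj₁ (q i)) (ℕtoℚ t)                     ≡⟨ cong (evalℚ (proj₁ (q i))) (shift-eval i t) ⟨
      evalℚ (proj₁ (q i)) (evalℚ (shift i) (ℕtoℚ (i ℕ.+ t ℕ.* s)))   ≡⟨ eval-∘ᵖ (proj₁ (q i)) (shift i) (ℕtoℚ (i ℕ.+ t ℕ.* s)) ⟨
      evalℚ (f (n mod s)) (ℕtoℚ (i ℕ.+ t ℕ.* s))       ≡⟨ cong (λ u → evalℚ (f (n mod s)) (ℕtoℚ u)) (sym n≡) ⟩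
      evalℚ (f (n mod s)) (ℕtoℚ n) ∎
      where
      i t : ℕ
      i = toℕ (n mod s)
      t = n ℕD./ s
      n≡ : n ≡ i ℕ.+ t ℕ.* s
      n≡ = trans (ℕD.m≡m%n+[m/n]*n n s) (cong (ℕ._+ t ℕ.* s) (sym (FinP.toℕ-fromℕ< (ℕD.m%n<n n s))))
      B≤t : B ℕ.≤ t
      B≤t = subst (ℕ._≤ t) (ℕD.m*n/n≡m B s) (ℕD./-monoˡ-≤ s le)

-- Sums of step polynomials over boxes are quasi-polynomial.

module BoxSums where

  open import Data.Nat as ℕ using (ℕ; zero; suc)
  import Data.Nat.Properties as ℕP
  open import Data.Integer as ℤ using (ℤ; +_)
  import Data.Integer.Properties as ℤP
  open import Data.Integer.Tactic.RingSolver using (solve-∀)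
  open import Data.Fin using (zero; suc)
  open import Data.Vec using (Vec; []; _∷_)
  open import Data.List using ([]; _∷_)
  open import Data.Product using (_,_)
  open import Relation.Binary.PropositionalEquality
  open ≡-Reasoning
  open ℚ using (ℚ; 0ℚ; 1ℚ)
  open Embedding
  open Sums
  open Indicator
  open StepPolynomials
  open Elimination
  open EventualSign
  open QuasiPolynomials

  weakenℓ : ∀ {D} → Lin D → Lin (suc D)
  weakenℓ (con z) = con z
  weakenℓ prm     = prm
  weakenℓ (var i) = var (suc i)
  weakenℓ (a ⊞ b) = weakenℓ a ⊞ weakenℓ b
  weakenℓ (z ⊡ a) = z ⊡ weakenℓ a

  weakenℓ-eval : ∀ {D} (a : Lin D) n x v → ⟦ weakenℓ a ⟧ℓ n (x ∷ v) ≡ ⟦ a ⟧ℓ n v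
  weakenℓ-eval (con z) n x v = refl
  weakenℓ-eval prm     n x v = refl
  weakenℓ-eval (var i) n x v = refl
  weakenℓ-eval (a ⊞ b) n x v = cong₂ ℤ._+_ (weakenℓ-eval a n x v) (weakenℓ-eval b n x v)
  weakenℓ-eval (z ⊡ a) n x v = cong (z ℤ.*_) (weakenℓ-eval a n x v)

  weaken : ∀ {D} → Fn D → Fn (suc D)
  weaken (con q) = con q
  weaken (lin a) = lin (weakenℓ a)
  weaken (ind a) = ind (weakenℓ a)
  weaken (f ⊕ g) = weaken f ⊕ weaken g
  weaken (f ⊗ g) = weaken f ⊗ weaken g

  weaken-eval : ∀ {D} (f : Fn D) n x v → ⟦ weaken f ⟧ n (x ∷ v) ≡ ⟦ f ⟧ n v
  weaken-eval (con q) n x v = refl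
  weaken-eval (lin a) n x v = cong ι (weakenℓ-eval a n x v)
  weaken-eval (ind a) n x v = cong χ (weakenℓ-eval a n x v)
  weaken-eval (f ⊕ g) n x v = cong₂ ℚ._+_ (weaken-eval f n x v) (weaken-eval g n x v)
  weaken-eval (f ⊗ g) n x v = cong₂ ℚ._*_ (weaken-eval f n x v) (weaken-eval g n x v)

  box-∑-swap : ∀ b D M (F : ℕ → Vec ℕ D → ℚ) → box b D (λ v → ∑ M (λ r → F r v)) ≡ ∑ M (λ r → box b D (F r))
  box-∑-swap b D zero    F = box-zero b D
  box-∑-swap b D (suc M) F = trans (box-+ b D (F 0) (λ v → ∑ M (λ r → F (suc r) v))) (cong (box b D (F 0) ℚ.+_) (box-∑-swap b D M (λ r → F (suc r))))

  module _ (M ρ₀ n : ℕ) (ρ₀<M : ρ₀ ℕ.< M) where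

    private
      N : ℕ
      N = ρ₀ ℕ.+ n ℕ.* M

    -- Because ρ₀ < M, the range 0, ..., N lies in the first n + 1 full blocks of length M; the
    -- indicator removes the excess of the last block.
    ∑-residues : ∀ h → ∑ (suc N) h ≡ ∑ (suc n) (λ q → ∑ M (λ r → χ (+ N ℤ.+ -1ℤ ℤ.* + (r ℕ.+ q ℕ.* M)) ℚ.* h (r ℕ.+ q ℕ.* M)))
    ∑-residues h = begin
      ∑ (suc N) h                                              ≡⟨ ∑-cong-< (suc N) (λ z z≤N → sym (trans (cong (ℚ._* h z) (inside z z≤N)) (ℚP.*-identityˡ (h z)))) ⟩
      ∑ (suc N) f                                              ≡⟨ ℚP.+-identityʳ (∑ (suc N) f) ⟨
      ∑ (suc N) f ℚ.+ 0ℚ                                       ≡⟨ cong (∑ (suc N) f ℚ.+_) (∑-zero R (λ i _ → trans (cong (ℚ._* h (suc N ℕ.+ i)) (outside i)) (ℚP.*-zeroˡ (h (suc N ℕ.+ i))))) ⟨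
      ∑ (suc N) f ℚ.+ ∑ R (λ i → f (suc N ℕ.+ i))              ≡⟨ ∑-append (suc N) R f ⟨
      ∑ (suc N ℕ.+ R) f                                        ≡⟨ cong (λ b → ∑ b f) (ℕP.m+[n∸m]≡n N<) ⟩
      ∑ (suc n ℕ.* M) f                                        ≡⟨ ∑-blocks (suc n) M f ⟩
      ∑ (suc n) (λ q → ∑ M (λ r → f (r ℕ.+ q ℕ.* M))) ∎
      where
      f : ℕ → ℚ
      f z = χ (+ N ℤ.+ -1ℤ ℤ.* + z) ℚ.* h z
      N< : suc N ℕ.≤ suc n ℕ.* M
      N< = ℕP.+-monoˡ-≤ (n ℕ.* M) ρ₀<M
      R : ℕ
      R = suc n ℕ.* M ℕ.∸ suc N
      inside : ∀ z → z ℕ.< suc N → χ (+ N ℤ.+ -1ℤ ℤ.* + z) ≡ 1ℚ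
      inside z (ℕ.s≤s z≤N) = χ-yes (subst NonNeg (eq (+ N) (+ z)) (ℤP.i≤j⇒0≤j-i (ℤ.+≤+ z≤N)))
        where
        eq : ∀ m x → m ℤ.+ ℤ.- x ≡ m ℤ.+ -1ℤ ℤ.* x
        eq = solve-∀
      outside : ∀ i → χ (+ N ℤ.+ -1ℤ ℤ.* + (suc N ℕ.+ i)) ≡ 0ℚ
      outside i = χ-no-by (+ N ℤ.+ -1ℤ ℤ.* + (suc N ℕ.+ i)) (+-NonNeg i)
          (trans (eq (+ N) (+ i)) (cong (λ t → -1ℤ ℤ.+ -1ℤ ℤ.* (+ N ℤ.+ -1ℤ ℤ.* t)) (sym (ℤP.pos-+ (suc N) i))))
        where
        eq : ∀ m i → i ≡ -1ℤ ℤ.+ -1ℤ ℤ.* (m ℤ.+ -1ℤ ℤ.* (+ 1 ℤ.+ m ℤ.+ i))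
        eq = solve-∀

  -- The indicator of ρ + M v ≤ ρ₀ + M n, coordinatewise.
  window : ∀ {D} → ℕ → ℕ → Vec ℕ D → Fn D
  window M ρ₀ []      = con 1ℚ
  window M ρ₀ (r ∷ ρ) = ind ((+ M ⊡ prm ⊞ con (+ ρ₀)) ⊞ -1ℤ ⊡ (+ M ⊡ var zero ⊞ con (+ r))) ⊗ weaken (window M ρ₀ ρ)

  -- The residues run over a box whose size does not depend on n, so the outer sum has a fixed
  -- number of terms. The quotients need not fill their box: a residue above ρ₀ allows one quotient
  -- fewer, which `window` accounts for.
  box-residues : ∀ M ρ₀ n → ρ₀ ℕ.< M → ∀ D G →
    box (suc (ρ₀ ℕ.+ n ℕ.* M)) D G ≡ box M D (λ ρ → box (suc n) D (λ v → ⟦ window M ρ₀ ρ ⟧ n v ℚ.* G (res M ρ v)))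
  box-residues M ρ₀ n ρ₀<M zero    G = sym (ℚP.*-identityˡ (G []))
  box-residues M ρ₀ n ρ₀<M (suc D) G = begin
    box (suc N) D (λ y → ∑ (suc N) (λ x → G (x ∷ y)))
      ≡⟨ box-residues M ρ₀ n ρ₀<M D _ ⟩
    box M D (λ ρ → box (suc n) D (λ v → W ρ v ℚ.* ∑ (suc N) (λ x → G (x ∷ res M ρ v))))
      ≡⟨ box-cong M D (λ ρ → box-cong (suc n) D (λ v → inner ρ v)) ⟩
    box M D (λ ρ → box (suc n) D (λ v → ∑ M (λ r → ∑ (suc n) (λ q → H ρ v r q))))
      ≡⟨ box-cong M D (λ ρ → box-∑-swap (suc n) D M (λ r v → ∑ (suc n) (λ q → H ρ v r q))) ⟩
    box M D (λ ρ → ∑ M (λ r → box (suc n) D (λ v → ∑ (suc n) (λ q → H ρ v r q)))) ∎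
    where
    N : ℕ
    N = ρ₀ ℕ.+ n ℕ.* M
    W : Vec ℕ D → Vec ℕ D → ℚ
    W ρ v = ⟦ window M ρ₀ ρ ⟧ n v
    H : Vec ℕ D → Vec ℕ D → ℕ → ℕ → ℚ
    H ρ v r q = ⟦ window M ρ₀ (r ∷ ρ) ⟧ n (q ∷ v) ℚ.* G (res M (r ∷ ρ) (q ∷ v))
    r₀ : ∀ w c g → w ℚ.* (c ℚ.* g) ≡ c ℚ.* w ℚ.* g
    r₀ = RS.solve-∀ ℚ-ring
    term : ∀ ρ v r q → W ρ v ℚ.* (χ (+ N ℤ.+ -1ℤ ℤ.* + (r ℕ.+ q ℕ.* M)) ℚ.* G ((r ℕ.+ q ℕ.* M) ∷ res M ρ v)) ≡ H ρ v r q
    term ρ v r q = trans (r₀ (W ρ v) (χ (+ N ℤ.+ -1ℤ ℤ.* + (r ℕ.+ q ℕ.* M))) (G ((r ℕ.+ q ℕ.* M) ∷ res M ρ v))) (cong₂ (λ s t → s ℚ.* t ℚ.* G ((r ℕ.+ q ℕ.* M) ∷ res M ρ v))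
      (cong χ (cong₂ (λ s t → s ℤ.+ -1ℤ ℤ.* t) (res-ℤ M ρ₀ n) (res-ℤ M r q)))
      (sym (weaken-eval (window M ρ₀ ρ) n q v)))
    inner : ∀ ρ v → W ρ v ℚ.* ∑ (suc N) (λ x → G (x ∷ res M ρ v)) ≡ ∑ M (λ r → ∑ (suc n) (λ q → H ρ v r q))
    inner ρ v = begin
      W ρ v ℚ.* ∑ (suc N) (λ x → G (x ∷ res M ρ v))
        ≡⟨ cong (W ρ v ℚ.*_) (∑-residues M ρ₀ n ρ₀<M (λ x → G (x ∷ res M ρ v))) ⟩
      W ρ v ℚ.* ∑ (suc n) (λ q → ∑ M (λ r → h r q))
        ≡⟨ ∑-*ˡ (suc n) (W ρ v) (λ q → ∑ M (λ r → h r q)) ⟨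
      ∑ (suc n) (λ q → W ρ v ℚ.* ∑ M (λ r → h r q))
        ≡⟨ ∑-cong (suc n) (λ q → sym (∑-*ˡ M (W ρ v) (λ r → h r q))) ⟩
      ∑ (suc n) (λ q → ∑ M (λ r → W ρ v ℚ.* h r q))
        ≡⟨ ∑-cong (suc n) (λ q → ∑-cong M (λ r → term ρ v r q)) ⟩
      ∑ (suc n) (λ q → ∑ M (λ r → H ρ v r q))
        ≡⟨ ∑-swap (suc n) M (λ q r → H ρ v r q) ⟩
      ∑ M (λ r → ∑ (suc n) (λ q → H ρ v r q)) ∎
      where
      h : ℕ → ℕ → ℚ
      h r q = χ (+ N ℤ.+ -1ℤ ℤ.* + (r ℕ.+ q ℕ.* M)) ℚ.* G ((r ℕ.+ q ℕ.* M) ∷ res M ρ v)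

  slope : Lin 0 → ℤ
  slope (con z) = + 0
  slope prm     = + 1
  slope (a ⊞ b) = slope a ℤ.+ slope b
  slope (z ⊡ a) = z ℤ.* slope a

  intercept : Lin 0 → ℤ
  intercept (con z) = z
  intercept prm     = + 0
  intercept (a ⊞ b) = intercept a ℤ.+ intercept b
  intercept (z ⊡ a) = z ℤ.* intercept a

  affine-poly : Lin 0 → ZPoly
  affine-poly a = intercept a ∷ slope a ∷ []

  affine-eval : ∀ a n → ⟦ a ⟧ℓ n [] ≡ evalℤ (affine-poly a) (+ n)
  affine-eval (con z) n = eq z (+ n)
    where
    eq : ∀ z n → z ≡ z ℤ.+ n ℤ.* (+ 0 ℤ.+ n ℤ.* + 0)
    eq = solve-∀
  affine-eval prm n = eq (+ n)
    where
    eq : ∀ n → n ≡ + 0 ℤ.+ n ℤ.* (+ 1 ℤ.+ n ℤ.* + 0)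
    eq = solve-∀
  affine-eval (a ⊞ b) n = trans (cong₂ ℤ._+_ (affine-eval a n) (affine-eval b n)) (eq (+ n) (intercept a) (slope a) (intercept b) (slope b))
    where
    eq : ∀ n i s j t → (i ℤ.+ n ℤ.* (s ℤ.+ n ℤ.* + 0)) ℤ.+ (j ℤ.+ n ℤ.* (t ℤ.+ n ℤ.* + 0)) ≡ (i ℤ.+ j) ℤ.+ n ℤ.* ((s ℤ.+ t) ℤ.+ n ℤ.* + 0)
    eq = solve-∀
  affine-eval (z ⊡ a) n = trans (cong (z ℤ.*_) (affine-eval a n)) (eq (+ n) z (intercept a) (slope a))
    where
    eq : ∀ n z i s → z ℤ.* (i ℤ.+ n ℤ.* (s ℤ.+ n ℤ.* + 0)) ≡ z ℤ.* i ℤ.+ n ℤ.* (z ℤ.* s ℤ.+ n ℤ.* + 0)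
    eq = solve-∀

  EP-Fn : (f : Fn 0) → EP (λ n → ⟦ f ⟧ n [])
  EP-Fn (con q) = EP-const q (always λ _ → refl)
  EP-Fn (lin a) = ι (intercept a) ∷ ι (slope a) ∷ [] , always λ n → begin
      ι (⟦ a ⟧ℓ n [])                                        ≡⟨ cong ι (trans (affine-eval a n) (eq (+ n) (intercept a) (slope a))) ⟩
      ι (intercept a ℤ.+ + n ℤ.* slope a)                    ≡⟨ trans (ι-+ (intercept a) (+ n ℤ.* slope a)) (cong (ι (intercept a) ℚ.+_) (ι-* (+ n) (slope a))) ⟩
      ι (intercept a) ℚ.+ ℕtoℚ n ℚ.* ι (slope a)             ≡⟨ r (ι (intercept a)) (ι (slope a)) (ℕtoℚ n) ⟩
      ι (intercept a) ℚ.+ ℕtoℚ n ℚ.* (ι (slope a) ℚ.+ ℕtoℚ n ℚ.* 0ℚ) ∎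
    where
    eq : ∀ n i s → i ℤ.+ n ℤ.* (s ℤ.+ n ℤ.* + 0) ≡ i ℤ.+ n ℤ.* s
    eq = solve-∀
    r : ∀ i s n → i ℚ.+ n ℚ.* s ≡ i ℚ.+ n ℚ.* (s ℚ.+ n ℚ.* 0ℚ)
    r = RS.solve-∀ ℚ-ring
  EP-Fn (ind a) with EvSign-ext {g = λ n → ⟦ a ⟧ℓ n []} (always (affine-eval a)) (poly-sign (affine-poly a))
  ... | ev-zero h = EP-const 1ℚ (ev-map (λ n e → cong χ e) h)
  ... | ev-pos h  = EP-const 1ℚ (ev-map (λ n p → χ-yes (NonNeg-+ (Pos.nonneg p) (+-NonNeg 1) (eq (⟦ a ⟧ℓ n [])))) h)
    where
    eq : ∀ z → z ℤ.+ -1ℤ ℤ.+ + 1 ≡ z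
    eq = solve-∀
  ... | ev-neg h  = EP-const 0ℚ (ev-map (λ n p → χ-no p) h)
  EP-Fn (f ⊕ g) = EP-+ (EP-Fn f) (EP-Fn g)
  EP-Fn (f ⊗ g) = EP-* (EP-Fn f) (EP-Fn g)

  -- Induction on `D` for all `f` at once, since elimination changes the summand. For fixed ρ₀ the
  -- sum becomes a fixed number of sums over boxes with one variable less.
  EQP-box-sum : ∀ D (f : Fn D) → EQP (λ n → box (suc n) D (⟦ f ⟧ n))
  EQP-box-sum zero    f = EP⇒EQP (EP-Fn f)
  EQP-box-sum (suc D) f with modulus f
  ... | m , d = EQP-interleave m {λ n → box (suc n) (suc D) (⟦ f ⟧ n)} λ ρ₀ ρ₀<M →
    EQP-ext (λ n → reduce ρ₀ ρ₀<M n)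
      (EQP-box (suc m) D {λ ρ n → box (suc n) D (⟦ summand ρ₀ ρ ⟧ n)} (λ ρ → EQP-box-sum D (summand ρ₀ ρ)))
    where
    M : ℕ
    M = suc m
    summand : ℕ → Vec ℕ D → Fn D
    summand ρ₀ ρ = window M ρ₀ ρ ⊗ eliminate M ρ₀ ρ f
    reduce : ∀ ρ₀ → ρ₀ ℕ.< M → ∀ n → box (suc (ρ₀ ℕ.+ n ℕ.* M)) (suc D) (⟦ f ⟧ (ρ₀ ℕ.+ n ℕ.* M))
               ≡ box M D (λ ρ → box (suc n) D (⟦ summand ρ₀ ρ ⟧ n))
    reduce ρ₀ ρ₀<M n = trans (box-residues M ρ₀ n ρ₀<M D _)
      (box-cong M D (λ ρ → box-cong (suc n) D (λ v → cong (⟦ window M ρ₀ ρ ⟧ n v ℚ.*_) (sym (eliminate-correct M ρ₀ ρ n v f d)))))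

-- Fourier-Motzkin elimination over germs of polynomials.

module FourierMotzkin where

  open import Data.Nat using (ℕ; zero; suc)
  open import Data.Integer as ℤ using (ℤ; +_; -[1+_])
  import Data.Integer.Properties as ℤP
  open import Data.Integer.Tactic.RingSolver using (solve-∀)
  open import Data.Vec as Vec using (Vec; []; _∷_; zipWith)
  open import Data.List using (List; []; _∷_; map; _++_)
  open import Data.List.Relation.Unary.All as All using (All; []; _∷_)
  open import Data.List.Relation.Unary.All.Properties using (map⁺; map⁻; ++⁺; ++⁻ˡ; ++⁻ʳ)
  open import Data.Product using (∃; _×_; _,_; proj₁; proj₂)
  open import Data.Sum using (_⊎_; inj₁; inj₂)
  open import Data.Empty using (⊥-elim)
  open import Relation.Nullary using (¬_)
  open import Relation.Binary.PropositionalEquality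
  open ≡-Reasoning
  open ℚ using (ℚ; 0ℚ; 1ℚ)
  open Embedding
  open Indicator
  open EventualSign

  _+ᶻ_ : ZPoly → ZPoly → ZPoly
  []       +ᶻ q        = q
  (a ∷ as) +ᶻ []       = a ∷ as
  (a ∷ as) +ᶻ (b ∷ bs) = (a ℤ.+ b) ∷ (as +ᶻ bs)

  _*ᶻ_ : ZPoly → ZPoly → ZPoly
  []       *ᶻ q = []
  (a ∷ as) *ᶻ q = map (a ℤ.*_) q +ᶻ (+ 0 ∷ (as *ᶻ q))

  eval-+ᶻ : ∀ p q t → evalℤ (p +ᶻ q) t ≡ evalℤ p t ℤ.+ evalℤ q t
  eval-+ᶻ []       q        t = sym (ℤP.+-identityˡ (evalℤ q t))
  eval-+ᶻ (a ∷ as) []       t = sym (ℤP.+-identityʳ (evalℤ (a ∷ as) t))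
  eval-+ᶻ (a ∷ as) (b ∷ bs) t = trans (cong (λ u → a ℤ.+ b ℤ.+ t ℤ.* u) (eval-+ᶻ as bs t)) (r a b t (evalℤ as t) (evalℤ bs t))
    where
    r : ∀ a b t u v → a ℤ.+ b ℤ.+ t ℤ.* (u ℤ.+ v) ≡ (a ℤ.+ t ℤ.* u) ℤ.+ (b ℤ.+ t ℤ.* v)
    r = solve-∀

  eval-map*ᶻ : ∀ a q t → evalℤ (map (a ℤ.*_) q) t ≡ a ℤ.* evalℤ q t
  eval-map*ᶻ a []       t = sym (ℤP.*-zeroʳ a)
  eval-map*ᶻ a (b ∷ bs) t = trans (cong (λ u → a ℤ.* b ℤ.+ t ℤ.* u) (eval-map*ᶻ a bs t)) (r a b t (evalℤ bs t))
    where
    r : ∀ a b t v → a ℤ.* b ℤ.+ t ℤ.* (a ℤ.* v) ≡ a ℤ.* (b ℤ.+ t ℤ.* v)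
    r = solve-∀

  eval-*ᶻ : ∀ p q t → evalℤ (p *ᶻ q) t ≡ evalℤ p t ℤ.* evalℤ q t
  eval-*ᶻ []       q t = sym (ℤP.*-zeroˡ (evalℤ q t))
  eval-*ᶻ (a ∷ as) q t = trans (eval-+ᶻ (map (a ℤ.*_) q) (+ 0 ∷ (as *ᶻ q)) t)
    (trans (cong₂ (λ u v → u ℤ.+ (+ 0 ℤ.+ t ℤ.* v)) (eval-map*ᶻ a q t) (eval-*ᶻ as q t)) (r a t (evalℤ as t) (evalℤ q t)))
    where
    r : ∀ a t u v → a ℤ.* v ℤ.+ (+ 0 ℤ.+ t ℤ.* (u ℤ.* v)) ≡ (a ℤ.+ t ℤ.* u) ℤ.* v
    r = solve-∀

  -- A row (a₁, …, a_d, c) stands for the constraint a₁ x₁ + ⋯ + a_d x_d + c ≥ 0.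
  Row : ℕ → Set
  Row d = Vec ZPoly (suc d)

  val : ∀ {d} → Row d → ℕ → Vec ℚ d → ℚ
  val {zero}  (c ∷ _) n _        = ι (evalℤ c (+ n))
  val {suc d} (a ∷ r) n (x ∷ xs) = ι (evalℤ a (+ n)) ℚ.* x ℚ.+ val r n xs

  Holds : ∀ {d} → ℕ → Vec ℚ d → Row d → Set
  Holds n x r = 0ℚ ℚ.≤ val r n x

  Sat : ∀ {d} → List (Row d) → ℕ → Vec ℚ d → Set
  Sat S n x = All (Holds n x) S

  combine : ∀ {d} → ZPoly → Row d → ZPoly → Row d → Row d
  combine p r q s = zipWith (λ u w → (p *ᶻ u) +ᶻ (q *ᶻ w)) r s

  eval-combine : ∀ p u q w n → ι (evalℤ ((p *ᶻ u) +ᶻ (q *ᶻ w)) (+ n)) ≡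
    ι (evalℤ p (+ n)) ℚ.* ι (evalℤ u (+ n)) ℚ.+ ι (evalℤ q (+ n)) ℚ.* ι (evalℤ w (+ n))
  eval-combine p u q w n = trans (cong ι (eval-+ᶻ (p *ᶻ u) (q *ᶻ w) (+ n))) (trans (ι-+ (evalℤ (p *ᶻ u) (+ n)) (evalℤ (q *ᶻ w) (+ n)))
    (cong₂ ℚ._+_ (trans (cong ι (eval-*ᶻ p u (+ n))) (ι-* (evalℤ p (+ n)) (evalℤ u (+ n))))
                 (trans (cong ι (eval-*ᶻ q w (+ n))) (ι-* (evalℤ q (+ n)) (evalℤ w (+ n))))))

  val-combine : ∀ {d} p (r : Row d) q s n x →
    val (combine p r q s) n x ≡ ι (evalℤ p (+ n)) ℚ.* val r n x ℚ.+ ι (evalℤ q (+ n)) ℚ.* val s n x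
  val-combine {zero} p (c ∷ []) q (e ∷ []) n [] = eval-combine p c q e n
  val-combine {suc d} p (a ∷ r) q (b ∷ s) n (x ∷ xs) = trans (cong₂ (λ u v → u ℚ.* x ℚ.+ v) (eval-combine p a q b n) (val-combine p r q s n xs))
      (eq (ι (evalℤ p (+ n))) (ι (evalℤ q (+ n))) (ι (evalℤ a (+ n))) (ι (evalℤ b (+ n))) x (val r n xs) (val s n xs))
    where
    eq : ∀ p q a b x r s → (p ℚ.* a ℚ.+ q ℚ.* b) ℚ.* x ℚ.+ (p ℚ.* r ℚ.+ q ℚ.* s) ≡ p ℚ.* (a ℚ.* x ℚ.+ r) ℚ.+ q ℚ.* (b ℚ.* x ℚ.+ s)
    eq = RS.solve-∀ ℚ-ring

  0≤-+ : ∀ {p q r} → 0ℚ ℚ.≤ p → 0ℚ ℚ.≤ q → p ℚ.+ q ≡ r → 0ℚ ℚ.≤ r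
  0≤-+ 0≤p 0≤q refl = ℚP.+-mono-≤ 0≤p 0≤q

  0≤-* : ∀ {p q r} → 0ℚ ℚ.≤ p → 0ℚ ℚ.≤ q → p ℚ.* q ≡ r → 0ℚ ℚ.≤ r
  0≤-* {p} {q} 0≤p 0≤q refl = ℚP.nonNegative⁻¹ (p ℚ.* q) {{ℚP.nonNeg*nonNeg⇒nonNeg p {{ℚ.nonNegative 0≤p}} q {{ℚ.nonNegative 0≤q}}}}

  ≤⇒0≤ : ∀ {p q} → p ℚ.≤ q → 0ℚ ℚ.≤ q ℚ.+ ℚ.- p
  ≤⇒0≤ {p} {q} le = subst (ℚ._≤ q ℚ.+ ℚ.- p) (ℚP.+-inverseʳ p) (ℚP.+-monoˡ-≤ (ℚ.- p) le)

  0≤⇒≤ : ∀ {p q} → 0ℚ ℚ.≤ q ℚ.+ ℚ.- p → p ℚ.≤ q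
  0≤⇒≤ {p} {q} le = subst₂ ℚ._≤_ (ℚP.+-identityˡ p) (eq p q) (ℚP.+-monoˡ-≤ p le)
    where
    eq : ∀ p q → q ℚ.+ ℚ.- p ℚ.+ p ≡ q
    eq = RS.solve-∀ ℚ-ring

  ¬0≤-1 : ¬ (0ℚ ℚ.≤ ℚ.- 1ℚ)
  ¬0≤-1 (ℚ.*≤* ())

  -- The reciprocal of |z|; the value at 0 is a default, and the lemmas that invert with it assume a
  -- sign.
  rinv : ℤ → ℚ
  rinv (+ 0)     = 0ℚ
  rinv (+ suc k) = recip k
  rinv -[1+ k ]  = recip k

  rinv-nonneg : ∀ z → 0ℚ ℚ.≤ rinv z
  rinv-nonneg (+ 0)     = ℚP.≤-refl
  rinv-nonneg (+ suc k) = recip-nonneg k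
  rinv-nonneg -[1+ k ]  = recip-nonneg k

  rinv-pos : ∀ {z} → Pos z → ι z ℚ.* rinv z ≡ 1ℚ
  rinv-pos {+ suc k} _ = recip-inverse k
  rinv-pos {+ 0} (mkPos ())
  rinv-pos { -[1+ k ]} (mkPos ())

  rinv-neg : ∀ {z} → Neg z → ℚ.- ι z ℚ.* rinv z ≡ 1ℚ
  rinv-neg {+ n} p = ⊥-elim (NonNeg-Neg (+-NonNeg n) p)
  rinv-neg { -[1+ k ]} _ = trans (cong (ℚ._* recip k) (sym (ι-neg -[1+ k ]))) (recip-inverse k)

  ι-pos : ∀ {z} → Pos z → 0ℚ ℚ.≤ ι z
  ι-pos {z} (mkPos p) = ι-mono (NonNeg-+ p (+-NonNeg 1) (eq z))
    where
    eq : ∀ z → z ℤ.+ -1ℤ ℤ.+ + 1 ≡ z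
    eq = solve-∀

  ι-neg-nonneg : ∀ {z} → Neg z → 0ℚ ℚ.≤ ℚ.- ι z
  ι-neg-nonneg {z} (neg p) = subst (0ℚ ℚ.≤_) (ι-neg z) (ι-mono (NonNeg-+ p (+-NonNeg 1) (eq z)))
    where
    eq : ∀ z → -1ℤ ℤ.+ -1ℤ ℤ.* z ℤ.+ + 1 ≡ ℤ.- z
    eq = solve-∀

  lower : ℤ → ℚ → ℚ
  lower a ℓ = ℚ.- (ℓ ℚ.* rinv a)

  upper : ℤ → ℚ → ℚ
  upper b κ = κ ℚ.* rinv b

  lower-sound : ∀ a ℓ x → Pos a → 0ℚ ℚ.≤ ι a ℚ.* x ℚ.+ ℓ → lower a ℓ ℚ.≤ x
  lower-sound a ℓ x pos h = 0≤⇒≤ (0≤-* (rinv-nonneg a) h (trans (r₁ (rinv a) (ι a) x ℓ) (trans (cong (λ t → t ℚ.* x ℚ.+ ℓ ℚ.* rinv a) (rinv-pos pos)) (r₂ x (ℓ ℚ.* rinv a)))))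
    where
    r₁ : ∀ i a x l → i ℚ.* (a ℚ.* x ℚ.+ l) ≡ a ℚ.* i ℚ.* x ℚ.+ l ℚ.* i
    r₁ = RS.solve-∀ ℚ-ring
    r₂ : ∀ x m → 1ℚ ℚ.* x ℚ.+ m ≡ x ℚ.+ ℚ.- (ℚ.- m)
    r₂ = RS.solve-∀ ℚ-ring

  lower-complete : ∀ a ℓ x → Pos a → lower a ℓ ℚ.≤ x → 0ℚ ℚ.≤ ι a ℚ.* x ℚ.+ ℓ
  lower-complete a ℓ x pos h = 0≤-* (ι-pos pos) (≤⇒0≤ h) (trans (r₁ (rinv a) (ι a) x ℓ) (trans (cong (λ t → ι a ℚ.* x ℚ.+ ℓ ℚ.* t) (rinv-pos pos)) (cong (ι a ℚ.* x ℚ.+_) (ℚP.*-identityʳ ℓ))))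
    where
    r₁ : ∀ i a x l → a ℚ.* (x ℚ.+ ℚ.- (ℚ.- (l ℚ.* i))) ≡ a ℚ.* x ℚ.+ l ℚ.* (a ℚ.* i)
    r₁ = RS.solve-∀ ℚ-ring

  upper-sound : ∀ b κ x → Neg b → 0ℚ ℚ.≤ ι b ℚ.* x ℚ.+ κ → x ℚ.≤ upper b κ
  upper-sound b κ x ng h = 0≤⇒≤ (0≤-* (rinv-nonneg b) h (trans (r₁ (rinv b) (ι b) x κ) (trans (cong (λ t → κ ℚ.* rinv b ℚ.+ ℚ.- (t ℚ.* x)) (rinv-neg ng)) (cong (λ t → κ ℚ.* rinv b ℚ.+ ℚ.- t) (ℚP.*-identityˡ x)))))
    where
    r₁ : ∀ i b x k → i ℚ.* (b ℚ.* x ℚ.+ k) ≡ k ℚ.* i ℚ.+ ℚ.- (ℚ.- b ℚ.* i ℚ.* x)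
    r₁ = RS.solve-∀ ℚ-ring

  upper-complete : ∀ b κ x → Neg b → x ℚ.≤ upper b κ → 0ℚ ℚ.≤ ι b ℚ.* x ℚ.+ κ
  upper-complete b κ x ng h = 0≤-* (ι-neg-nonneg ng) (≤⇒0≤ h) (trans (r₁ (rinv b) (ι b) x κ) (trans (cong (λ t → ι b ℚ.* x ℚ.+ κ ℚ.* t) (rinv-neg ng)) (cong (ι b ℚ.* x ℚ.+_) (ℚP.*-identityʳ κ))))
    where
    r₁ : ∀ i b x k → ℚ.- b ℚ.* (k ℚ.* i ℚ.+ ℚ.- x) ≡ b ℚ.* x ℚ.+ k ℚ.* (ℚ.- b ℚ.* i)
    r₁ = RS.solve-∀ ℚ-ring

  -- Multiply the hypothesis, which is the resolvent of the two rows, by 1/(a|b|).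
  lower≤upper : ∀ a ℓ b κ → Pos a → Neg b → 0ℚ ℚ.≤ ℚ.- ι b ℚ.* ℓ ℚ.+ ι a ℚ.* κ → lower a ℓ ℚ.≤ upper b κ
  lower≤upper a ℓ b κ pos ng h = 0≤⇒≤ (0≤-* (0≤-* (rinv-nonneg a) (rinv-nonneg b) refl) h
      (trans (r₁ (rinv a) (rinv b) (ι a) (ι b) ℓ κ) (trans (cong₂ (λ s t → κ ℚ.* rinv b ℚ.* s ℚ.+ ℓ ℚ.* rinv a ℚ.* t) (rinv-pos pos) (rinv-neg ng)) (r₂ (κ ℚ.* rinv b) (ℓ ℚ.* rinv a)))))
    where
    r₁ : ∀ i j a b l k → i ℚ.* j ℚ.* (ℚ.- b ℚ.* l ℚ.+ a ℚ.* k) ≡ k ℚ.* j ℚ.* (a ℚ.* i) ℚ.+ l ℚ.* i ℚ.* (ℚ.- b ℚ.* j)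
    r₁ = RS.solve-∀ ℚ-ring
    r₂ : ∀ u v → u ℚ.* 1ℚ ℚ.+ v ℚ.* 1ℚ ≡ u ℚ.+ ℚ.- (ℚ.- v)
    r₂ = RS.solve-∀ ℚ-ring

  below-all : ∀ us → ∃ λ x → All (x ℚ.≤_) us
  below-all []       = 0ℚ , []
  below-all (u ∷ us) with below-all us
  ... | x , p = u ℚ.⊓ x , ℚP.p⊓q≤p u x ∷ All.map (ℚP.≤-trans (ℚP.p⊓q≤q u x)) p

  -- The witness is the maximum of the lower bounds and of some number below all upper bounds, which
  -- also covers empty lists.
  between-all : ∀ ls us → All (λ l → All (l ℚ.≤_) us) ls → ∃ λ x → All (ℚ._≤ x) ls × All (x ℚ.≤_) us
  between-all []       us []       with below-all us
  ... | x , p = x , [] , p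
  between-all (l ∷ ls) us (h ∷ hs) with between-all ls us hs
  ... | x , p , q = l ℚ.⊔ x , ℚP.p≤p⊔q l x ∷ All.map (λ le → ℚP.≤-trans le (ℚP.p≤q⊔p l x)) p , All.zipWith (λ (s , t) → ℚP.⊔-lub s t) (h , q)

  cross : ∀ {A B C : Set} → (A → B → C) → List A → List B → List C
  cross f []       bs = []
  cross f (a ∷ as) bs = map (f a) bs ++ cross f as bs

  cross⁺ : ∀ {A B C : Set} {P : C → Set} (f : A → B → C) {as bs} → All (λ a → All (λ b → P (f a b)) bs) as → All P (cross f as bs)
  cross⁺ f []       = []
  cross⁺ f (p ∷ ps) = ++⁺ (map⁺ p) (cross⁺ f ps)

  cross⁻ : ∀ {A B C : Set} {P : C → Set} (f : A → B → C) as {bs} → All P (cross f as bs) → All (λ a → All (λ b → P (f a b)) bs) as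
  cross⁻ f []       ps = []
  cross⁻ f (a ∷ as) {bs} ps = map⁻ (++⁻ˡ (map (f a) bs) ps) ∷ cross⁻ f as (++⁻ʳ (map (f a) bs) ps)

  leading : ∀ {d} → ℕ → Row (suc d) → ℤ
  leading n (a ∷ _) = evalℤ a (+ n)

  -- Which row goes where is decided once for all large n. The exchange with `S` therefore holds for
  -- every n, and only the signs are eventual.
  record Split {d} (S : List (Row (suc d))) : Set where
    field
      pos ng zer : List (Row (suc d))
      join  : ∀ {n x} → Sat pos n x → Sat ng n x → Sat zer n x → Sat S n x
      to-pos : ∀ {n x} → Sat S n x → Sat pos n x
      to-ng  : ∀ {n x} → Sat S n x → Sat ng n x
      to-zer : ∀ {n x} → Sat S n x → Sat zer n x
      signs : Eventually (λ n → All (λ r → Pos (leading n r)) pos × All (λ r → Neg (leading n r)) ng × All (λ r → leading n r ≡ + 0) zer)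

  split : ∀ {d} (S : List (Row (suc d))) → Split S
  split [] = record { pos = [] ; ng = [] ; zer = [] ; join = λ _ _ _ → [] ; to-pos = λ _ → [] ; to-ng = λ _ → [] ; to-zer = λ _ → []
                    ; signs = always λ _ → [] , [] , [] }
  split (r@(a ∷ _) ∷ S) with split S | poly-sign a
  ... | R | ev-zero h = record { pos = pos ; ng = ng ; zer = r ∷ zer
      ; join = λ { p q (z ∷ zs) → z ∷ join p q zs } ; to-pos = λ { (_ ∷ p) → to-pos p } ; to-ng = λ { (_ ∷ p) → to-ng p } ; to-zer = λ { (z ∷ p) → z ∷ to-zer p }
      ; signs = ev-zip (λ n e (x , y , z) → x , y , (e ∷ z)) h signs }
    where open Split R
  ... | R | ev-pos h = record { pos = r ∷ pos ; ng = ng ; zer = zer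
      ; join = λ { (z ∷ zs) p q → z ∷ join zs p q } ; to-pos = λ { (z ∷ p) → z ∷ to-pos p } ; to-ng = λ { (_ ∷ p) → to-ng p } ; to-zer = λ { (_ ∷ p) → to-zer p }
      ; signs = ev-zip (λ n e (x , y , z) → (e ∷ x) , y , z) h signs }
    where open Split R
  ... | R | ev-neg h = record { pos = pos ; ng = r ∷ ng ; zer = zer
      ; join = λ { p (z ∷ zs) q → z ∷ join p zs q } ; to-pos = λ { (_ ∷ p) → to-pos p } ; to-ng = λ { (z ∷ p) → z ∷ to-ng p } ; to-zer = λ { (_ ∷ p) → to-zer p }
      ; signs = ev-zip (λ n e (x , y , z) → x , (e ∷ y) , z) h signs }
    where open Split R

  -- If the head of the first row is positive and that of the second negative, both multipliers are
  -- positive and the heads cancel. Cross-multiplication, instead of division, keeps the entries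
  -- polynomials in n.
  resolve : ∀ {d} → Row (suc d) → Row (suc d) → Row d
  resolve (a ∷ r) (b ∷ s) = combine ((-1ℤ ∷ []) *ᶻ b) r a s

  val-resolve : ∀ {d} (r s : Row (suc d)) n y →
    val (resolve r s) n y ≡ ℚ.- ι (leading n s) ℚ.* val (Vec.tail r) n y ℚ.+ ι (leading n r) ℚ.* val (Vec.tail s) n y
  val-resolve (a ∷ r) (b ∷ s) n y = trans (val-combine ((-1ℤ ∷ []) *ᶻ b) r a s n y) (cong (λ t → t ℚ.* val r n y ℚ.+ ι (evalℤ a (+ n)) ℚ.* val s n y)
      (trans (cong ι (trans (eval-*ᶻ (-1ℤ ∷ []) b (+ n)) (eq (evalℤ b (+ n)) (+ n)))) (ι-neg (evalℤ b (+ n)))))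
    where
    eq : ∀ b n → (-1ℤ ℤ.+ n ℤ.* + 0) ℤ.* b ≡ ℤ.- b
    eq = solve-∀

  val-∷ : ∀ {d} (r : Row (suc d)) n x y → val r n (x ∷ y) ≡ ι (leading n r) ℚ.* x ℚ.+ val (Vec.tail r) n y
  val-∷ (a ∷ r) n x y = refl

  module _ {d : ℕ} {S : List (Row (suc d))} (R : Split S) where

    open Split R

    project : List (Row d)
    project = map Vec.tail zer ++ cross resolve pos ng

    Signs : ℕ → Set
    Signs n = All (λ r → Pos (leading n r)) pos × All (λ r → Neg (leading n r)) ng × All (λ r → leading n r ≡ + 0) zer

    val-zero : ∀ n x (y : Vec ℚ d) (r : Row (suc d)) → leading n r ≡ + 0 → val r n (x ∷ y) ≡ val (Vec.tail r) n y
    val-zero n x y r e = trans (val-∷ r n x y) (trans (cong (λ t → ι t ℚ.* x ℚ.+ val (Vec.tail r) n y) e) (eq x (val (Vec.tail r) n y)))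
      where
      eq : ∀ x v → 0ℚ ℚ.* x ℚ.+ v ≡ v
      eq = RS.solve-∀ ℚ-ring

    -- The resolvents make every lower bound at most every upper bound, so some rational x lies
    -- between them. Integers would not do here, which is why the elimination takes place over the
    -- rationals.
    lift : ∀ n → Signs n → ∀ y → Sat project n y → ∃ λ x → Sat S n (x ∷ y)
    lift n (sp , sn , sz) y h = x , join
        (All.zipWith (λ {r} → lo-ok {r}) (sp , map⁻ (proj₁ (proj₂ X))))
        (All.zipWith (λ {r} → up-ok {r}) (sn , map⁻ (proj₂ (proj₂ X))))
        (All.zipWith (λ {r} → zer-ok {r}) (sz , map⁻ (++⁻ˡ (map Vec.tail zer) h)))
      where
      lo up : Row (suc d) → ℚ
      lo r = lower (leading n r) (val (Vec.tail r) n y)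
      up r = upper (leading n r) (val (Vec.tail r) n y)
      compatible : ∀ {r q} → Pos (leading n r) → Neg (leading n q) × Holds n y (resolve r q) → lo r ℚ.≤ up q
      compatible {r} {q} s (t , p) =
        lower≤upper (leading n r) (val (Vec.tail r) n y) (leading n q) (val (Vec.tail q) n y) s t (subst (0ℚ ℚ.≤_) (val-resolve r q n y) p)
      row : ∀ {r} → Pos (leading n r) × All (λ q → Holds n y (resolve r q)) ng → All (lo r ℚ.≤_) (map up ng)
      row {r} (s , ps) = map⁺ (All.zipWith (λ {q} → compatible {r} {q} s) (sn , ps))
      ordered : All (λ l → All (l ℚ.≤_) (map up ng)) (map lo pos)
      ordered = map⁺ (All.zipWith (λ {r} → row {r}) (sp , cross⁻ resolve pos (++⁻ʳ (map Vec.tail zer) h)))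
      X : ∃ λ x → All (ℚ._≤ x) (map lo pos) × All (x ℚ.≤_) (map up ng)
      X = between-all (map lo pos) (map up ng) ordered
      x : ℚ
      x = proj₁ X
      lo-ok : ∀ {r} → Pos (leading n r) × (lo r ℚ.≤ x) → Holds n (x ∷ y) r
      lo-ok {r} (s , le) = subst (0ℚ ℚ.≤_) (sym (val-∷ r n x y)) (lower-complete (leading n r) (val (Vec.tail r) n y) x s le)
      up-ok : ∀ {r} → Neg (leading n r) × (x ℚ.≤ up r) → Holds n (x ∷ y) r
      up-ok {r} (s , le) = subst (0ℚ ℚ.≤_) (sym (val-∷ r n x y)) (upper-complete (leading n r) (val (Vec.tail r) n y) x s le)
      zer-ok : ∀ {r} → (leading n r ≡ + 0) × Holds n y (Vec.tail r) → Holds n (x ∷ y) r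
      zer-ok {r} (s , le) = subst (0ℚ ℚ.≤_) (sym (val-zero n x y r s)) le

    -- Each resolvent is a nonnegative combination of two rows of `S`.
    drop-head : ∀ n → Signs n → ∀ x y → Sat S n (x ∷ y) → Sat project n y
    drop-head n (sp , sn , sz) x y h = ++⁺
        (map⁺ (All.zipWith (λ {r} → zer-ok {r}) (sz , to-zer h)))
        (cross⁺ resolve (All.zipWith (λ {r} (s , p) → All.zipWith (λ {q} → resolved {r} {q} s p) (sn , to-ng h)) (sp , to-pos h)))
      where
      eq : ∀ a b x l k → ℚ.- b ℚ.* (a ℚ.* x ℚ.+ l) ℚ.+ a ℚ.* (b ℚ.* x ℚ.+ k) ≡ ℚ.- b ℚ.* l ℚ.+ a ℚ.* k
      eq = RS.solve-∀ ℚ-ring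
      zer-ok : ∀ {r} → (leading n r ≡ + 0) × Holds n (x ∷ y) r → Holds n y (Vec.tail r)
      zer-ok {r} (s , p) = subst (0ℚ ℚ.≤_) (val-zero n x y r s) p
      resolved : ∀ {r q} → Pos (leading n r) → Holds n (x ∷ y) r → Neg (leading n q) × Holds n (x ∷ y) q → Holds n y (resolve r q)
      resolved {r} {q} s p (t , p′) = 0≤-+ (0≤-* (ι-neg-nonneg t) p refl) (0≤-* (ι-pos s) p′ refl)
        (trans (cong₂ (λ u v → ℚ.- ι (leading n q) ℚ.* u ℚ.+ ι (leading n r) ℚ.* v) (val-∷ r n x y) (val-∷ q n x y))
          (trans (eq (ι (leading n r)) (ι (leading n q)) x (val (Vec.tail r) n y) (val (Vec.tail q) n y)) (sym (val-resolve r q n y))))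

  EvFeasible : ∀ {d} → List (Row d) → Set
  EvFeasible S = Eventually (λ n → ∃ λ x → Sat S n x) ⊎ Eventually (λ n → ∀ x → ¬ Sat S n x)

  -- Emptiness cannot alternate with n: after all coordinates are eliminated, the rows are single
  -- polynomials, and each has an eventual sign.
  feasible? : ∀ d (S : List (Row d)) → EvFeasible S
  feasible? zero []             = inj₁ (always λ n → [] , [])
  feasible? zero (r@(c ∷ []) ∷ S) with feasible? zero S | poly-sign c
  ... | inj₂ h | _         = inj₂ (ev-map (λ { n f x (_ ∷ p) → f x p }) h)
  ... | inj₁ h | ev-neg g  = inj₂ (ev-map (λ { n p [] (q ∷ _) → NonNeg-Neg (ι-cancel q) p }) g)
  ... | inj₁ h | ev-pos g  = inj₁ (ev-zip (λ { n ([] , p) q → [] , (ι-pos q ∷ p) }) h g)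
  ... | inj₁ h | ev-zero g = inj₁ (ev-zip (λ { n ([] , p) q → [] , (subst (λ t → 0ℚ ℚ.≤ ι t) (sym q) ℚP.≤-refl ∷ p) }) h g)
  feasible? (suc d) S with feasible? d (project (split S))
  ... | inj₁ h = inj₁ (ev-zip (λ { n (y , p) s → let (x , q) = lift (split S) n s y p in (x ∷ y) , q }) h (Split.signs (split S)))
  ... | inj₂ h = inj₂ (ev-zip (λ { n f s (x ∷ y) p → f y (drop-head (split S) n s x y p) }) h (Split.signs (split S)))

-- From boundedness for each n to a polynomial bound.

module PolynomialBound where

  open import Data.Nat as ℕ using (ℕ; zero; suc)
  import Data.Nat.Properties as ℕP
  open import Data.Integer as ℤ using (ℤ; +_)
  import Data.Integer.Properties as ℤP
  open import Data.Integer.Tactic.RingSolver using (solve-∀)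
  open import Data.Vec as Vec using (Vec; []; _∷_)
  import Data.Vec.Relation.Unary.All as VAll
  open VAll using ([]; _∷_)
  open import Data.List using (List; []; _∷_)
  open import Data.List.Relation.Unary.All as All using (All; []; _∷_)
  open import Data.Product using (Σ; ∃; _×_; _,_; proj₁; proj₂)
  open import Data.Sum using (_⊎_; inj₁; inj₂)
  open import Data.Empty using (⊥; ⊥-elim)
  open import Relation.Nullary using (¬_)
  open import Relation.Binary.PropositionalEquality
  open ℚ using (ℚ; 0ℚ; 1ℚ)
  open Embedding
  open Indicator
  open EventualSign
  open FourierMotzkin

  -- A pure power without a constant factor: for large n a constant is at most n, at the price of a
  -- larger exponent. The power will be the shift of the coordinates.
  PolyBounded : (ℕ → ℕ) → Set
  PolyBounded b = ∃ λ k → Eventually (λ n → b n ℕ.≤ n ℕ.^ k)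

  pb-const : ∀ c → PolyBounded (λ _ → c)
  pb-const c = 1 , ev-map (λ n le → ℕP.≤-trans le (ℕP.≤-reflexive (sym (ℕP.^-identityʳ n)))) (ev-≥ c)

  pb-id : PolyBounded (λ n → n)
  pb-id = 1 , always (λ n → ℕP.≤-reflexive (sym (ℕP.^-identityʳ n)))

  pb-≤ : ∀ {b c} → (∀ n → b n ℕ.≤ c n) → PolyBounded c → PolyBounded b
  pb-≤ f (k , h) = k , ev-map (λ n → ℕP.≤-trans (f n)) h

  -- Both terms are at most the power with exponent j + k, and the resulting factor 2 is absorbed by
  -- one more factor n ≥ 2.
  pb-+ : ∀ {b c} → PolyBounded b → PolyBounded c → PolyBounded (λ n → b n ℕ.+ c n)
  pb-+ {b} {c} (j , p) (k , q) = suc (j ℕ.+ k) , ev-zip (λ { n (p , q) le → go n p q le }) (ev-zip (λ n p q → p , q) p q) (ev-≥ 2)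
    where
    open ℕP.≤-Reasoning
    go : ∀ n → b n ℕ.≤ n ℕ.^ j → c n ℕ.≤ n ℕ.^ k → 2 ℕ.≤ n → b n ℕ.+ c n ℕ.≤ n ℕ.^ suc (j ℕ.+ k)
    go n@(suc _) p q le = begin
      b n ℕ.+ c n                                      ≤⟨ ℕP.+-mono-≤ (ℕP.≤-trans p (ℕP.^-monoʳ-≤ n (ℕP.m≤m+n j k))) (ℕP.≤-trans q (ℕP.^-monoʳ-≤ n (ℕP.m≤n+m k j))) ⟩
      n ℕ.^ (j ℕ.+ k) ℕ.+ n ℕ.^ (j ℕ.+ k)              ≡⟨ cong (n ℕ.^ (j ℕ.+ k) ℕ.+_) (ℕP.+-identityʳ (n ℕ.^ (j ℕ.+ k))) ⟨
      2 ℕ.* n ℕ.^ (j ℕ.+ k)                            ≤⟨ ℕP.*-monoˡ-≤ (n ℕ.^ (j ℕ.+ k)) le ⟩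
      n ℕ.* n ℕ.^ (j ℕ.+ k)                            ∎

  pb-* : ∀ {b c} → PolyBounded b → PolyBounded c → PolyBounded (λ n → b n ℕ.* c n)
  pb-* (j , p) (k , q) = j ℕ.+ k , ev-zip (λ n p q → ℕP.≤-trans (ℕP.*-mono-≤ p q) (ℕP.≤-reflexive (sym (ℕP.^-distribˡ-+-* n j k)))) p q

  pb-poly : ∀ p → PolyBounded (λ n → ℤ.∣ evalℤ p (+ n) ∣)
  pb-poly []       = pb-const 0
  pb-poly (a ∷ as) = pb-≤ (λ n → ℕP.≤-trans (ℤP.∣i+j∣≤∣i∣+∣j∣ a (+ n ℤ.* evalℤ as (+ n))) (ℕP.+-monoʳ-≤ ℤ.∣ a ∣ (ℕP.≤-reflexive (ℤP.abs-* (+ n) (evalℤ as (+ n))))))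
    (pb-+ (pb-const ℤ.∣ a ∣) (pb-* pb-id (pb-poly as)))

  -- The inequality |t| ≤ b as two nonnegative quantities, so that estimates reduce to ring
  -- identities between nonnegative terms.
  record Within (b t : ℚ) : Set where
    constructor within
    field
      above : 0ℚ ℚ.≤ b ℚ.+ ℚ.- t
      below : 0ℚ ℚ.≤ b ℚ.+ t

  halve : ∀ {p} → 0ℚ ℚ.≤ p ℚ.+ p → 0ℚ ℚ.≤ p
  halve {p} h = 0≤-* (recip-nonneg 1) h (trans (r (recip 1) p) (trans (cong (ℚ._* p) (recip-inverse 1)) (ℚP.*-identityˡ p)))
    where
    r : ∀ i p → i ℚ.* (p ℚ.+ p) ≡ (1ℚ ℚ.+ 1ℚ) ℚ.* i ℚ.* p
    r = RS.solve-∀ ℚ-ring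

  within-nonneg : ∀ {b t} → Within b t → 0ℚ ℚ.≤ b
  within-nonneg {b} {t} (within u l) = halve (0≤-+ u l (r b t))
    where
    r : ∀ b t → b ℚ.+ ℚ.- t ℚ.+ (b ℚ.+ t) ≡ b ℚ.+ b
    r = RS.solve-∀ ℚ-ring

  within-+ : ∀ {b c s t} → Within b s → Within c t → Within (b ℚ.+ c) (s ℚ.+ t)
  within-+ {b} {c} {s} {t} (within u l) (within v m) = within (0≤-+ u v (r₁ b c s t)) (0≤-+ l m (r₂ b c s t))
    where
    r₁ : ∀ b c s t → b ℚ.+ ℚ.- s ℚ.+ (c ℚ.+ ℚ.- t) ≡ b ℚ.+ c ℚ.+ ℚ.- (s ℚ.+ t)
    r₁ = RS.solve-∀ ℚ-ring
    r₂ : ∀ b c s t → b ℚ.+ s ℚ.+ (c ℚ.+ t) ≡ b ℚ.+ c ℚ.+ (s ℚ.+ t)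
    r₂ = RS.solve-∀ ℚ-ring

  -- Twice bc - st is (b - s)(c + t) + (b + s)(c - t), and twice bc + st is (b - s)(c - t) + (b +
  -- s)(c + t).
  within-* : ∀ {b c s t} → Within b s → Within c t → Within (b ℚ.* c) (s ℚ.* t)
  within-* {b} {c} {s} {t} (within u l) (within v m) = within
      (halve (0≤-+ (0≤-* u m refl) (0≤-* l v refl) (r₁ b c s t)))
      (halve (0≤-+ (0≤-* u v refl) (0≤-* l m refl) (r₂ b c s t)))
    where
    r₁ : ∀ b c s t → (b ℚ.+ ℚ.- s) ℚ.* (c ℚ.+ t) ℚ.+ (b ℚ.+ s) ℚ.* (c ℚ.+ ℚ.- t) ≡ b ℚ.* c ℚ.+ ℚ.- (s ℚ.* t) ℚ.+ (b ℚ.* c ℚ.+ ℚ.- (s ℚ.* t))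
    r₁ = RS.solve-∀ ℚ-ring
    r₂ : ∀ b c s t → (b ℚ.+ ℚ.- s) ℚ.* (c ℚ.+ ℚ.- t) ℚ.+ (b ℚ.+ s) ℚ.* (c ℚ.+ t) ≡ b ℚ.* c ℚ.+ s ℚ.* t ℚ.+ (b ℚ.* c ℚ.+ s ℚ.* t)
    r₂ = RS.solve-∀ ℚ-ring

  within-mono : ∀ {b c t} → b ℚ.≤ c → Within b t → Within c t
  within-mono {b} {c} {t} le (within u l) = within (0≤-+ (≤⇒0≤ le) u (r₁ b c t)) (0≤-+ (≤⇒0≤ le) l (r₂ b c t))
    where
    r₁ : ∀ b c t → c ℚ.+ ℚ.- b ℚ.+ (b ℚ.+ ℚ.- t) ≡ c ℚ.+ ℚ.- t
    r₁ = RS.solve-∀ ℚ-ring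
    r₂ : ∀ b c t → c ℚ.+ ℚ.- b ℚ.+ (b ℚ.+ t) ≡ c ℚ.+ t
    r₂ = RS.solve-∀ ℚ-ring

  within-ι : ∀ z → Within (ℕtoℚ ℤ.∣ z ∣) (ι z)
  within-ι z = within (subst (0ℚ ℚ.≤_) (trans (ι-+ (+ ℤ.∣ z ∣) (-1ℤ ℤ.* z)) (cong (ℕtoℚ ℤ.∣ z ∣ ℚ.+_) (trans (cong ι (eq z)) (ι-neg z)))) (ι-mono (abs- z)))
                      (subst (0ℚ ℚ.≤_) (trans (ι-+ z (+ ℤ.∣ z ∣)) (ℚP.+-comm (ι z) (ℕtoℚ ℤ.∣ z ∣))) (ι-mono (abs+ z)))
    where
    eq : ∀ z → -1ℤ ℤ.* z ≡ ℤ.- z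
    eq = solve-∀

  row-bound : ∀ {d} → Row d → (ℕ → ℕ) → ℕ → ℕ
  row-bound {zero}  (c ∷ _) b n = ℤ.∣ evalℤ c (+ n) ∣
  row-bound {suc d} (a ∷ r) b n = ℤ.∣ evalℤ a (+ n) ∣ ℕ.* b n ℕ.+ row-bound r b n

  pb-row : ∀ {d} (r : Row d) {b} → PolyBounded b → PolyBounded (row-bound r b)
  pb-row {zero}  (c ∷ _) h = pb-poly c
  pb-row {suc d} (a ∷ r) h = pb-+ (pb-* (pb-poly a) h) (pb-row r h)

  ℕtoℚ-+ : ∀ a b → ℕtoℚ (a ℕ.+ b) ≡ ℕtoℚ a ℚ.+ ℕtoℚ b
  ℕtoℚ-+ a b = trans (cong ι (ℤP.pos-+ a b)) (ι-+ (+ a) (+ b))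

  ℕtoℚ-* : ∀ a b → ℕtoℚ (a ℕ.* b) ≡ ℕtoℚ a ℚ.* ℕtoℚ b
  ℕtoℚ-* a b = trans (cong ι (ℤP.pos-* a b)) (ι-* (+ a) (+ b))

  row-within : ∀ {d} (r : Row d) b n y → VAll.All (Within (ℕtoℚ (b n))) y → Within (ℕtoℚ (row-bound r b n)) (val r n y)
  row-within {zero}  (c ∷ _) b n []      h        = within-ι (evalℤ c (+ n))
  row-within {suc d} (a ∷ r) b n (x ∷ y) (h ∷ hs) = subst (λ t → Within t (val (a ∷ r) n (x ∷ y)))
    (sym (trans (ℕtoℚ-+ (ℤ.∣ evalℤ a (+ n) ∣ ℕ.* b n) (row-bound r b n)) (cong (ℚ._+ ℕtoℚ (row-bound r b n)) (ℕtoℚ-* ℤ.∣ evalℤ a (+ n) ∣ (b n)))))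
    (within-+ (within-* (within-ι (evalℤ a (+ n))) h) (row-within r b n y hs))

  -- A nonzero integer has absolute value at least 1. By this integrality of the coefficients,
  -- dividing by them never enlarges a bound.
  rinv-≤ : ∀ z b → 0ℚ ℚ.≤ b → Pos z ⊎ Neg z → 0ℚ ℚ.≤ b ℚ.+ ℚ.- (b ℚ.* rinv z)
  rinv-≤ z b h (inj₁ p) = 0≤-* (0≤-* h (rinv-nonneg z) refl) (ι-mono (Pos.nonneg p))
      (trans (cong (b ℚ.* rinv z ℚ.*_) (ι-+ z -1ℤ)) (trans (r (rinv z) b (ι z)) (trans (cong (λ t → b ℚ.* t ℚ.+ ℚ.- (b ℚ.* rinv z)) (rinv-pos p)) (cong (ℚ._+ ℚ.- (b ℚ.* rinv z)) (ℚP.*-identityʳ b)))))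
    where
    r : ∀ i b z → b ℚ.* i ℚ.* (z ℚ.+ ℚ.- 1ℚ) ≡ b ℚ.* (z ℚ.* i) ℚ.+ ℚ.- (b ℚ.* i)
    r = RS.solve-∀ ℚ-ring
  rinv-≤ z b h (inj₂ p) = 0≤-* (0≤-* h (rinv-nonneg z) refl) (ι-mono (Neg.nonneg p))
      (trans (cong (b ℚ.* rinv z ℚ.*_) (trans (ι-+ -1ℤ (-1ℤ ℤ.* z)) (cong (ι -1ℤ ℚ.+_) (trans (cong ι (eq z)) (ι-neg z))))) (trans (r (rinv z) b (ι z)) (trans (cong (λ t → b ℚ.* t ℚ.+ ℚ.- (b ℚ.* rinv z)) (rinv-neg p)) (cong (ℚ._+ ℚ.- (b ℚ.* rinv z)) (ℚP.*-identityʳ b)))))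
    where
    eq : ∀ z → -1ℤ ℤ.* z ≡ ℤ.- z
    eq = solve-∀
    r : ∀ i b z → b ℚ.* i ℚ.* (ℚ.- 1ℚ ℚ.+ ℚ.- z) ≡ b ℚ.* (ℚ.- z ℚ.* i) ℚ.+ ℚ.- (b ℚ.* i)
    r = RS.solve-∀ ℚ-ring

  -- The number b + x is the sum of x + ℓ/a, (b - ℓ)/a and b - b/a, all nonnegative.
  head-lower : ∀ a ℓ b x → Pos a → Within b ℓ → 0ℚ ℚ.≤ ι a ℚ.* x ℚ.+ ℓ → 0ℚ ℚ.≤ b ℚ.+ x
  head-lower a ℓ b x p w h = 0≤-+ (0≤-+ (≤⇒0≤ (lower-sound a ℓ x p h)) (0≤-* (Within.above w) (rinv-nonneg a) refl) refl) (rinv-≤ a b (within-nonneg w) (inj₁ p)) (r x ℓ b (rinv a))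
    where
    r : ∀ x l b i → x ℚ.+ ℚ.- (ℚ.- (l ℚ.* i)) ℚ.+ (b ℚ.+ ℚ.- l) ℚ.* i ℚ.+ (b ℚ.+ ℚ.- (b ℚ.* i)) ≡ b ℚ.+ x
    r = RS.solve-∀ ℚ-ring

  head-upper : ∀ a κ b x → Neg a → Within b κ → 0ℚ ℚ.≤ ι a ℚ.* x ℚ.+ κ → 0ℚ ℚ.≤ b ℚ.+ ℚ.- x
  head-upper a κ b x p w h = 0≤-+ (0≤-+ (≤⇒0≤ (upper-sound a κ x p h)) (0≤-* (Within.above w) (rinv-nonneg a) refl) refl) (rinv-≤ a b (within-nonneg w) (inj₂ p)) (r x κ b (rinv a))
    where
    r : ∀ x l b i → l ℚ.* i ℚ.+ ℚ.- x ℚ.+ (b ℚ.+ ℚ.- l) ℚ.* i ℚ.+ (b ℚ.+ ℚ.- (b ℚ.* i)) ≡ b ℚ.+ ℚ.- x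
    r = RS.solve-∀ ℚ-ring

  Bounded : ∀ {d} → List (Row d) → ℕ → Set
  Bounded S n = ∃ λ B → ∀ x → Sat S n x → VAll.All (Within B) x

  shift-head : ∀ {d} n x (y : Vec ℚ d) t r → 0ℚ ℚ.≤ ι (leading n r) ℚ.* t → Holds n (x ∷ y) r → Holds n ((x ℚ.+ t) ∷ y) r
  shift-head n x y t r h p = 0≤-+ p h (trans (cong (ℚ._+ ι (leading n r) ℚ.* t) (val-∷ r n x y)) (trans (eq (ι (leading n r)) x t (val (Vec.tail r) n y)) (sym (val-∷ r n (x ℚ.+ t) y))))
    where
    eq : ∀ a x t v → a ℚ.* x ℚ.+ v ℚ.+ a ℚ.* t ≡ a ℚ.* (x ℚ.+ t) ℚ.+ v
    eq = RS.solve-∀ ℚ-ring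

  module _ {d : ℕ} {S : List (Row (suc d))} (R : Split S) (n : ℕ) (sg : Signs R n) (bd : Bounded S n) where

    open Split R

    private
      B : ℚ
      B = proj₁ bd

      f : ∀ x → Sat S n x → VAll.All (Within B) x
      f = proj₂ bd

    zero-ok : ∀ t {r : Row (suc d)} → leading n r ≡ + 0 → 0ℚ ℚ.≤ ι (leading n r) ℚ.* t
    zero-ok t e = ℚP.≤-reflexive (sym (trans (cong (λ u → ι u ℚ.* t) e) (ℚP.*-zeroˡ t)))

    -- Without a lower (upper) bound on the head coordinate, a solution could be shifted by 2 B + 1 out of the bound B.
    pos-nonempty : pos ≡ [] → ∀ x → ¬ Sat S n x
    pos-nonempty e (x ∷ y) h with f (x ∷ y) h
    ... | w ∷ _ = contra (f ((x ℚ.+ ℚ.- t) ∷ y) (join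
          (subst (λ P → Sat P n ((x ℚ.+ ℚ.- t) ∷ y)) (sym e) [])
          (All.zipWith (λ {r} (s , p) → shift-head n x y (ℚ.- t) r (0≤-* (ι-neg-nonneg s) 0≤t (r₀ (ι (leading n r)) t)) p) (proj₁ (proj₂ sg) , to-ng h))
          (All.zipWith (λ {r} (s , p) → shift-head n x y (ℚ.- t) r (zero-ok (ℚ.- t) {r} s) p) (proj₂ (proj₂ sg) , to-zer h))))
      where
      t : ℚ
      t = B ℚ.+ B ℚ.+ 1ℚ
      r₀ : ∀ a t → ℚ.- a ℚ.* t ≡ a ℚ.* ℚ.- t
      r₀ = RS.solve-∀ ℚ-ring
      0≤t : 0ℚ ℚ.≤ t
      0≤t = 0≤-+ (0≤-+ (within-nonneg w) (within-nonneg w) refl) (ι-mono (+-NonNeg 1)) refl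
      r₁ : ∀ b x → b ℚ.+ ℚ.- x ℚ.+ (b ℚ.+ (x ℚ.+ ℚ.- (b ℚ.+ b ℚ.+ 1ℚ))) ≡ ℚ.- 1ℚ
      r₁ = RS.solve-∀ ℚ-ring
      contra : VAll.All (Within B) ((x ℚ.+ ℚ.- t) ∷ y) → ⊥
      contra (w′ ∷ _) = ¬0≤-1 (0≤-+ (Within.above w) (Within.below w′) (r₁ B x))

    neg-nonempty : ng ≡ [] → ∀ x → ¬ Sat S n x
    neg-nonempty e (x ∷ y) h with f (x ∷ y) h
    ... | w ∷ _ = contra (f ((x ℚ.+ t) ∷ y) (join
          (All.zipWith (λ {r} (s , p) → shift-head n x y t r (0≤-* (ι-pos s) 0≤t refl) p) (proj₁ sg , to-pos h))
          (subst (λ P → Sat P n ((x ℚ.+ t) ∷ y)) (sym e) [])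
          (All.zipWith (λ {r} (s , p) → shift-head n x y t r (zero-ok t {r} s) p) (proj₂ (proj₂ sg) , to-zer h))))
      where
      t : ℚ
      t = B ℚ.+ B ℚ.+ 1ℚ
      0≤t : 0ℚ ℚ.≤ t
      0≤t = 0≤-+ (0≤-+ (within-nonneg w) (within-nonneg w) refl) (ι-mono (+-NonNeg 1)) refl
      r₁ : ∀ b x → b ℚ.+ x ℚ.+ (b ℚ.+ ℚ.- (x ℚ.+ (b ℚ.+ b ℚ.+ 1ℚ))) ≡ ℚ.- 1ℚ
      r₁ = RS.solve-∀ ℚ-ring
      contra : VAll.All (Within B) ((x ℚ.+ t) ∷ y) → ⊥
      contra (w′ ∷ _) = ¬0≤-1 (0≤-+ (Within.below w) (Within.above w′) (r₁ B x))

    -- Every point of the projection lifts to a rational point of `S`, so the same bound serves.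
    project-bounded : Bounded (project R) n
    project-bounded = B , λ y h → VAll.tail (f (proj₁ (lift R n sg y h) ∷ y) (proj₂ (lift R n sg y h)))

  PolynomiallyBounded : ∀ {d} → List (Row d) → Set
  PolynomiallyBounded S = Σ (ℕ → ℕ) λ b → PolyBounded b × Eventually (λ n → ∀ x → Sat S n x → VAll.All (Within (ℕtoℚ (b n))) x)

  module _ {d : ℕ} {S : List (Row (suc d))} (R : Split S) (bd : Eventually (Bounded S))
           (h : Eventually (λ n → ∃ λ x → Sat S n x)) (IH : PolynomiallyBounded (project R)) where

    open Split R

    infeasible-absurd : Eventually (λ n → ∀ x → ¬ Sat S n x) → ⊥
    infeasible-absurd g with ev-zip (λ n (x , p) f → f x p) h g
    ... | N , f = f N ℕP.≤-refl

    -- One row of each sign suffices: given bounds on the other coordinates, a single lower and a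
    -- single upper constraint bound the head. The lists come with equations so that fields of `R`
    -- can be matched.
    cases : ∀ P → pos ≡ P → ∀ Q → ng ≡ Q → PolynomiallyBounded S
    cases [] e _ _       = ⊥-elim (infeasible-absurd (ev-zip (λ n s b → pos-nonempty R n s b e) signs bd))
    cases (_ ∷ _) _ [] e = ⊥-elim (infeasible-absurd (ev-zip (λ n s b → neg-nonempty R n s b e) signs bd))
    cases (p ∷ _) e (q ∷ _) e′ = c , pb-+ (pb-+ (pb-row (Vec.tail p) pb) (pb-row (Vec.tail q) pb)) pb , ev-zip go signs (proj₂ (proj₂ IH))
      where
      b c : ℕ → ℕ
      b = proj₁ IH
      pb : PolyBounded b
      pb = proj₁ (proj₂ IH)
      c n = row-bound (Vec.tail p) b n ℕ.+ row-bound (Vec.tail q) b n ℕ.+ b n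
      go : ∀ n → Signs R n → (∀ y → Sat (project R) n y → VAll.All (Within (ℕtoℚ (b n))) y) → ∀ x → Sat S n x → VAll.All (Within (ℕtoℚ (c n))) x
      go n sg f (x ∷ y) h = head-within ∷ VAll.map (within-mono (ι-mono (ℤ.+≤+ (ℕP.m≤n+m (b n) (row-bound (Vec.tail p) b n ℕ.+ row-bound (Vec.tail q) b n))))) hs
        where
        hs : VAll.All (Within (ℕtoℚ (b n))) y
        hs = f y (drop-head R n sg x y h)
        β γ δ : ℕ
        β = row-bound (Vec.tail p) b n
        γ = row-bound (Vec.tail q) b n
        δ = b n
        low : 0ℚ ℚ.≤ ℕtoℚ β ℚ.+ x
        low with subst (λ P → All (λ r → Pos (leading n r)) P) e (proj₁ sg) | subst (λ P → Sat P n (x ∷ y)) e (to-pos h)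
        ... | s ∷ _ | v ∷ _ = head-lower (leading n p) (val (Vec.tail p) n y) (ℕtoℚ β) x s (row-within (Vec.tail p) b n y hs) (subst (0ℚ ℚ.≤_) (val-∷ p n x y) v)
        high : 0ℚ ℚ.≤ ℕtoℚ γ ℚ.+ ℚ.- x
        high with subst (λ P → All (λ r → Neg (leading n r)) P) e′ (proj₁ (proj₂ sg)) | subst (λ P → Sat P n (x ∷ y)) e′ (to-ng h)
        ... | s ∷ _ | v ∷ _ = head-upper (leading n q) (val (Vec.tail q) n y) (ℕtoℚ γ) x s (row-within (Vec.tail q) b n y hs) (subst (0ℚ ℚ.≤_) (val-∷ q n x y) v)
        c≡ : ℕtoℚ (c n) ≡ ℕtoℚ β ℚ.+ ℕtoℚ γ ℚ.+ ℕtoℚ δ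
        c≡ = trans (ℕtoℚ-+ (β ℕ.+ γ) δ) (cong (ℚ._+ ℕtoℚ δ) (ℕtoℚ-+ β γ))
        0≤ : ∀ m → 0ℚ ℚ.≤ ℕtoℚ m
        0≤ m = ι-mono (+-NonNeg m)
        r₁ : ∀ b g d x → g ℚ.+ ℚ.- x ℚ.+ (b ℚ.+ d) ≡ b ℚ.+ g ℚ.+ d ℚ.+ ℚ.- x
        r₁ = RS.solve-∀ ℚ-ring
        r₂ : ∀ b g d x → b ℚ.+ x ℚ.+ (g ℚ.+ d) ≡ b ℚ.+ g ℚ.+ d ℚ.+ x
        r₂ = RS.solve-∀ ℚ-ring
        head-within : Within (ℕtoℚ (c n)) x
        head-within = subst (λ t → Within t x) (sym c≡) (within
          (0≤-+ high (0≤-+ (0≤ β) (0≤ δ) refl) (r₁ (ℕtoℚ β) (ℕtoℚ γ) (ℕtoℚ δ) x))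
          (0≤-+ low (0≤-+ (0≤ γ) (0≤ δ) refl) (r₂ (ℕtoℚ β) (ℕtoℚ γ) (ℕtoℚ δ) x)))

  poly-bound : ∀ d (S : List (Row d)) → Eventually (Bounded S) → PolynomiallyBounded S
  poly-bound zero    S bd = (λ _ → 0) , pb-const 0 , always λ { n [] _ → [] }
  poly-bound (suc d) S bd with feasible? (suc d) S
  -- For an empty system every bound holds vacuously.
  ... | inj₂ h = (λ _ → 0) , pb-const 0 , ev-map (λ n f x p → ⊥-elim (f x p)) h
  ... | inj₁ h = cases (split S) bd h
      (poly-bound d (project (split S)) (ev-zip (project-bounded (split S)) (Split.signs (split S)) bd))
      (Split.pos (split S)) refl (Split.ng (split S)) refl

-- Carries in base m + 1.

module Digits where

  open import Data.Nat as ℕ using (ℕ; zero; suc)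
  import Data.Nat.Properties as ℕP
  open import Data.Integer as ℤ using (ℤ; +_)
  import Data.Integer.Properties as ℤP
  import Data.Integer.DivMod as ℤD
  open import Data.Integer.Tactic.RingSolver using (solve-∀)
  open import Data.Fin using (zero; suc)
  open import Data.Vec using (Vec; []; _∷_)

  open import Data.Vec.Relation.Unary.All as VAll using ([]; _∷_)
  open import Data.Vec.Relation.Unary.All.Properties using (lookup⁺)
  open import Data.List using (List; []; _∷_)
  open import Data.Product using (∃; _×_; _,_; proj₁; proj₂)
  open import Data.Sum using (inj₁; inj₂)
  open import Data.Empty using (⊥-elim)

  open import Relation.Binary.PropositionalEquality
  open ≡-Reasoning
  open ℚ using (ℚ; 0ℚ; 1ℚ)
  open Sums
  open Indicator
  open StepPolynomials
  open Elimination using (NonNeg⇒+)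
  open EventualSign

  -- The sum of the absolute values of the coefficients, without cancellation. Since the digits, the
  -- parameter and 1 are at most m + 1, it bounds the form divided by the base, uniformly in m.
  size : ∀ {D} → Lin D → ℕ
  size (con z) = ℤ.∣ z ∣
  size prm     = 1
  size (var i) = 1
  size (a ⊞ b) = size a ℕ.+ size b
  size (z ⊡ a) = ℤ.∣ z ∣ ℕ.* size a

  size-bound : ∀ {D} (a : Lin D) m y → VAll.All (ℕ._< suc m) y → ℤ.∣ ⟦ a ⟧ℓ m y ∣ ℕ.≤ size a ℕ.* suc m
  size-bound (con z) m y h = ℕP.m≤m*n ℤ.∣ z ∣ (suc m)
  size-bound prm     m y h = ℕP.≤-trans (ℕP.n≤1+n m) (ℕP.≤-reflexive (sym (ℕP.*-identityˡ (suc m))))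
  size-bound (var i) m y h = ℕP.≤-trans (ℕP.<⇒≤ (lookup⁺ h i)) (ℕP.≤-reflexive (sym (ℕP.*-identityˡ (suc m))))
  size-bound (a ⊞ b) m y h = ℕP.≤-trans (ℤP.∣i+j∣≤∣i∣+∣j∣ (⟦ a ⟧ℓ m y) (⟦ b ⟧ℓ m y))
    (ℕP.≤-trans (ℕP.+-mono-≤ (size-bound a m y h) (size-bound b m y h)) (ℕP.≤-reflexive (sym (ℕP.*-distribʳ-+ (suc m) (size a) (size b)))))
  size-bound (z ⊡ a) m y h = ℕP.≤-trans (ℕP.≤-reflexive (ℤP.abs-* z (⟦ a ⟧ℓ m y)))
    (ℕP.≤-trans (ℕP.*-monoʳ-≤ ℤ.∣ z ∣ (size-bound a m y h)) (ℕP.≤-reflexive (sym (ℕP.*-assoc ℤ.∣ z ∣ (size a) (suc m)))))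

  ∑Fn : ∀ {D} → ℕ → (ℕ → Fn D) → Fn D
  ∑Fn zero    f = con 0ℚ
  ∑Fn (suc b) f = f 0 ⊕ ∑Fn b (λ i → f (suc i))

  ∑Fn-eval : ∀ {D} b (f : ℕ → Fn D) n y → ⟦ ∑Fn b f ⟧ n y ≡ ∑ b (λ i → ⟦ f i ⟧ n y)
  ∑Fn-eval zero    f n y = refl
  ∑Fn-eval (suc b) f n y = cong (⟦ f 0 ⟧ n y ℚ.+_) (∑Fn-eval b (λ i → f (suc i)) n y)

  -- Polynomials in the base suc m whose coefficients are affine forms in the digits.
  LPoly : ℕ → Set
  LPoly D = List (Lin D)

  evalL : ∀ {D} → LPoly D → ℕ → Vec ℕ D → ℤ
  evalL []       m y = + 0
  evalL (L ∷ Ls) m y = ⟦ L ⟧ℓ m y ℤ.+ + suc m ℤ.* evalL Ls m y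

  -- The digits run over 0, ..., m with m the value of `prm`, so the base m + 1 is the n of the
  -- theorem.
  base : ∀ {D} → Lin D
  base = prm ⊞ con (+ 1)

  base-eval : ∀ {D} m (y : Vec ℕ D) → ⟦ base ⟧ℓ m y ≡ + suc m
  base-eval m y = cong +_ (ℕP.+-comm m 1)

  -- Quotients may be negative: the indices 0, ..., 2C stand for -C, ..., C.
  candidate : ℕ → ℕ → ℤ
  candidate C i = + i ℤ.+ -1ℤ ℤ.* + C

  -- carry Ls q is the indicator of Ls + q ≥ 0: if j is the quotient of the lowest coefficient plus q by
  -- the base, then Ls + q ≥ 0 iff the higher part plus j is nonnegative, and j is bounded independently of m.
  carry : ∀ {D} → LPoly D → ℤ → Fn D
  carry []       q = ind (con q)
  carry (L ∷ Ls) q = ∑Fn (suc (C ℕ.+ C)) λ i →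
      ind (L ⊞ con q ⊞ (-1ℤ ℤ.* candidate C i) ⊡ base)
      ⊗ ind ((candidate C i ℤ.+ + 1) ⊡ base ⊞ con -1ℤ ⊞ -1ℤ ⊡ (L ⊞ con q))
      ⊗ carry Ls (candidate C i)
    where
    C : ℕ
    C = size (L ⊞ con q)

  χ-quotient-≥ : ∀ m a j → χ (a ℤ.+ (-1ℤ ℤ.* j) ℤ.* + suc m) ≡ χ (a ℤD./ℕ suc m ℤ.+ -1ℤ ℤ.* j)
  χ-quotient-≥ m a j = trans (cong χ (eq a j (+ suc m))) (trans (χ-floor m (-1ℤ ℤ.* j) a) (cong χ (ℤP.+-comm (-1ℤ ℤ.* j) (a ℤD./ℕ suc m))))
    where
    eq : ∀ a j s → a ℤ.+ (-1ℤ ℤ.* j) ℤ.* s ≡ s ℤ.* (-1ℤ ℤ.* j) ℤ.+ a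
    eq = solve-∀

  -- Negate both sides: a ≥ (j + 1)(m + 1) holds iff the floored quotient is at least j + 1, by the
  -- floor equivalence with t = -(j + 1).
  χ-quotient-≤ : ∀ m a j → χ ((j ℤ.+ + 1) ℤ.* + suc m ℤ.+ -1ℤ ℤ.+ -1ℤ ℤ.* a) ≡ χ (j ℤ.+ -1ℤ ℤ.* (a ℤD./ℕ suc m))
  χ-quotient-≤ m a j = χ-iff {a = u} {b = v} fwd bwd
    where
    q u v w : ℤ
    q = a ℤD./ℕ suc m
    u = (j ℤ.+ + 1) ℤ.* + suc m ℤ.+ -1ℤ ℤ.+ -1ℤ ℤ.* a
    v = j ℤ.+ -1ℤ ℤ.* q
    w = -1ℤ ℤ.* (j ℤ.+ + 1)
    e₁ : ∀ j q → -1ℤ ℤ.+ -1ℤ ℤ.* (j ℤ.+ -1ℤ ℤ.* q) ≡ -1ℤ ℤ.* (j ℤ.+ + 1) ℤ.+ q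
    e₁ = solve-∀
    e₂ : ∀ j a s → s ℤ.* (-1ℤ ℤ.* (j ℤ.+ + 1)) ℤ.+ a ≡ -1ℤ ℤ.+ -1ℤ ℤ.* ((j ℤ.+ + 1) ℤ.* s ℤ.+ -1ℤ ℤ.+ -1ℤ ℤ.* a)
    e₂ = solve-∀
    fwd : NonNeg u → NonNeg v
    fwd p with sign v
    ... | inj₁ h       = h
    ... | inj₂ (neg h) = ⊥-elim (NonNeg-Neg p (neg (subst NonNeg (e₂ j a (+ suc m)) (floor-bwd m w a (subst NonNeg (e₁ j q) h)))))
    bwd : NonNeg v → NonNeg u
    bwd p with sign u
    ... | inj₁ h       = h
    ... | inj₂ (neg h) = ⊥-elim (NonNeg-Neg p (neg (subst NonNeg (sym (e₁ j q)) (floor-fwd m w a (subst NonNeg (sym (e₂ j a (+ suc m))) h)))))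

  χ-distinct : ∀ a b → a ≢ b → χ (a ℤ.+ -1ℤ ℤ.* b) ℚ.* χ (b ℤ.+ -1ℤ ℤ.* a) ≡ 0ℚ
  χ-distinct a b a≢b with sign (a ℤ.+ -1ℤ ℤ.* b) | sign (b ℤ.+ -1ℤ ℤ.* a)
  ... | inj₂ p | _      = trans (cong (ℚ._* χ (b ℤ.+ -1ℤ ℤ.* a)) (χ-no p)) (ℚP.*-zeroˡ (χ (b ℤ.+ -1ℤ ℤ.* a)))
  ... | inj₁ _ | inj₂ p = trans (cong (χ (a ℤ.+ -1ℤ ℤ.* b) ℚ.*_) (χ-no p)) (ℚP.*-zeroʳ (χ (a ℤ.+ -1ℤ ℤ.* b)))
  ... | inj₁ p | inj₁ q = ⊥-elim (a≢b (ℤP.≤-antisym (ℤP.0≤i-j⇒j≤i (subst NonNeg (eq b a) q)) (ℤP.0≤i-j⇒j≤i (subst NonNeg (eq a b) p))))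
    where
    eq : ∀ a b → a ℤ.+ -1ℤ ℤ.* b ≡ a ℤ.- b
    eq = solve-∀

  -- The hypothesis puts a between -C and C times the base, hence the floored quotient between -C
  -- and C; the index is C plus the quotient.
  quotient-candidate : ∀ m a C → ℤ.∣ a ∣ ℕ.≤ C ℕ.* suc m → ∃ λ i → i ℕ.< suc (C ℕ.+ C) × a ℤD./ℕ suc m ≡ candidate C i
  quotient-candidate m a C h = i , ℕ.s≤s i≤2C , trans (e₀ q (+ C)) (cong (λ t → t ℤ.+ -1ℤ ℤ.* + C) i≡)
    where
    q : ℤ
    q = a ℤD./ℕ suc m
    e₀ : ∀ q c → q ≡ (c ℤ.+ q) ℤ.+ -1ℤ ℤ.* c
    e₀ = solve-∀
    ∣a∣≤ : NonNeg (+ suc m ℤ.* + C ℤ.+ -1ℤ ℤ.* + ℤ.∣ a ∣)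
    ∣a∣≤ = subst NonNeg (trans (cong (λ t → t ℤ.+ ℤ.- + ℤ.∣ a ∣) (ℤP.pos-* C (suc m))) (e (+ C) (+ suc m) (+ ℤ.∣ a ∣))) (ℤP.i≤j⇒0≤j-i (ℤ.+≤+ h))
      where
      e : ∀ c s x → c ℤ.* s ℤ.+ ℤ.- x ≡ s ℤ.* c ℤ.+ -1ℤ ℤ.* x
      e = solve-∀
    low : NonNeg (+ C ℤ.+ q)
    low = floor-fwd m (+ C) a (NonNeg-+ ∣a∣≤ (abs+ a) (e (+ suc m ℤ.* + C) (+ ℤ.∣ a ∣) a))
      where
      e : ∀ u x a → u ℤ.+ -1ℤ ℤ.* x ℤ.+ (a ℤ.+ x) ≡ u ℤ.+ a
      e = solve-∀
    i : ℕ
    i = proj₁ (NonNeg⇒+ low)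
    i≡ : + C ℤ.+ q ≡ + i
    i≡ = proj₂ (NonNeg⇒+ low)
    high : NonNeg (+ C ℤ.+ -1ℤ ℤ.* q)
    high with sign (+ C ℤ.+ -1ℤ ℤ.* q)
    ... | inj₁ p       = p
    ... | inj₂ (neg p) = ⊥-elim (NonNeg-Neg (NonNeg-+ (NonNeg-+ ∣a∣≤ (abs- a) refl) (floor-bwd m (-1ℤ ℤ.* (+ C ℤ.+ + 1)) a (subst NonNeg (e₁ (+ C) q) p)) (e₂ (+ suc m) (+ C) (+ ℤ.∣ a ∣) a)) (neg (subst NonNeg (e₃ (+ suc m)) (ℤ.+≤+ (ℕ.z≤n {m})))))
      where
      e₁ : ∀ c q → -1ℤ ℤ.+ -1ℤ ℤ.* (c ℤ.+ -1ℤ ℤ.* q) ≡ -1ℤ ℤ.* (c ℤ.+ + 1) ℤ.+ q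
      e₁ = solve-∀
      e₂ : ∀ s c x a → s ℤ.* c ℤ.+ -1ℤ ℤ.* x ℤ.+ (x ℤ.+ -1ℤ ℤ.* a) ℤ.+ (s ℤ.* (-1ℤ ℤ.* (c ℤ.+ + 1)) ℤ.+ a) ≡ -1ℤ ℤ.* s
      e₂ = solve-∀
      e₃ : ∀ s → -1ℤ ℤ.+ s ≡ -1ℤ ℤ.+ -1ℤ ℤ.* (-1ℤ ℤ.* s)
      e₃ = solve-∀
    i≤2C : i ℕ.≤ C ℕ.+ C
    i≤2C = ℤP.drop‿+≤+ (ℤP.0≤i-j⇒j≤i (subst NonNeg (trans (e (+ C) q) (cong₂ (λ s t → s ℤ.- t) (sym (ℤP.pos-+ C C)) i≡)) high))
      where
      e : ∀ c q → c ℤ.+ -1ℤ ℤ.* q ≡ (c ℤ.+ c) ℤ.- (c ℤ.+ q)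
      e = solve-∀

  candidate-injective : ∀ C {i j} → candidate C i ≡ candidate C j → i ≡ j
  candidate-injective C {i} {j} e = ℤP.+-injective (trans (r (+ i) (+ C)) (trans (cong (ℤ._+ + C) e) (sym (r (+ j) (+ C)))))
    where
    r : ∀ i c → i ≡ (i ℤ.+ -1ℤ ℤ.* c) ℤ.+ c
    r = solve-∀

  -- Together the two indicators say that the candidate equals the quotient, so exactly one summand
  -- survives; `size-bound` ensures that the quotient is among the candidates.
  carry-correct : ∀ {D} (Ls : LPoly D) q m y → VAll.All (ℕ._< suc m) y → ⟦ carry Ls q ⟧ m y ≡ χ (evalL Ls m y ℤ.+ q)
  carry-correct []       q m y h = cong χ (sym (ℤP.+-identityˡ q))
  carry-correct (L ∷ Ls) q m y h with quotient-candidate m (⟦ L ⊞ con q ⟧ℓ m y) (size (L ⊞ con q)) (size-bound (L ⊞ con q) m y h)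
  ... | j , j< , j≡ = begin
      ⟦ ∑Fn K f ⟧ m y                          ≡⟨ ∑Fn-eval K f m y ⟩
      ∑ K (λ i → ⟦ f i ⟧ m y)                  ≡⟨ ∑-cong K value ⟩
      ∑ K g                                    ≡⟨ ∑-single K j g j< (λ i i≢j → trans (cong (ℚ._* χ (E ℤ.+ candidate C i)) (χ-distinct Q (candidate C i) (λ e → i≢j (candidate-injective C (trans (sym e) j≡))))) (ℚP.*-zeroˡ (χ (E ℤ.+ candidate C i)))) ⟩
      g j                                      ≡⟨ cong (λ t → χ (Q ℤ.+ -1ℤ ℤ.* t) ℚ.* χ (t ℤ.+ -1ℤ ℤ.* Q) ℚ.* χ (E ℤ.+ t)) (sym j≡) ⟩
      χ (Q ℤ.+ -1ℤ ℤ.* Q) ℚ.* χ (Q ℤ.+ -1ℤ ℤ.* Q) ℚ.* χ (E ℤ.+ Q)   ≡⟨ cong (λ t → χ t ℚ.* χ t ℚ.* χ (E ℤ.+ Q)) (e₀ Q) ⟩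
      1ℚ ℚ.* 1ℚ ℚ.* χ (E ℤ.+ Q)                ≡⟨ r₀ (χ (E ℤ.+ Q)) ⟩
      χ (E ℤ.+ Q)                              ≡⟨ χ-floor m E A ⟨
      χ (+ suc m ℤ.* E ℤ.+ A)                  ≡⟨ cong χ (e₁ (+ suc m) E (⟦ L ⟧ℓ m y) q) ⟩
      χ (⟦ L ⟧ℓ m y ℤ.+ + suc m ℤ.* E ℤ.+ q) ∎
    where
    C K : ℕ
    C = size (L ⊞ con q)
    K = suc (C ℕ.+ C)
    A Q E : ℤ
    A = ⟦ L ⊞ con q ⟧ℓ m y
    Q = A ℤD./ℕ suc m
    E = evalL Ls m y
    f : ℕ → Fn _
    f i = ind (L ⊞ con q ⊞ (-1ℤ ℤ.* candidate C i) ⊡ base)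
      ⊗ ind ((candidate C i ℤ.+ + 1) ⊡ base ⊞ con -1ℤ ⊞ -1ℤ ⊡ (L ⊞ con q))
      ⊗ carry Ls (candidate C i)
    g : ℕ → ℚ
    g i = χ (Q ℤ.+ -1ℤ ℤ.* candidate C i) ℚ.* χ (candidate C i ℤ.+ -1ℤ ℤ.* Q) ℚ.* χ (E ℤ.+ candidate C i)
    e₀ : ∀ q → q ℤ.+ -1ℤ ℤ.* q ≡ + 0
    e₀ = solve-∀
    e₁ : ∀ s e l q → s ℤ.* e ℤ.+ (l ℤ.+ q) ≡ l ℤ.+ s ℤ.* e ℤ.+ q
    e₁ = solve-∀
    r₀ : ∀ t → 1ℚ ℚ.* 1ℚ ℚ.* t ≡ t
    r₀ = RS.solve-∀ ℚ-ring
    value : ∀ i → ⟦ f i ⟧ m y ≡ g i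
    value i = cong₂ ℚ._*_ (cong₂ ℚ._*_
        (trans (cong (λ t → χ (A ℤ.+ (-1ℤ ℤ.* candidate C i) ℤ.* t)) (base-eval m y)) (χ-quotient-≥ m A (candidate C i)))
        (trans (cong (λ t → χ ((candidate C i ℤ.+ + 1) ℤ.* t ℤ.+ -1ℤ ℤ.+ -1ℤ ℤ.* A)) (base-eval m y)) (χ-quotient-≤ m A (candidate C i))))
      (carry-correct Ls (candidate C i) m y h)

-- Coordinates and boxes in terms of digits.

module DigitForms where

  open import Data.Nat as ℕ using (ℕ; zero; suc)
  import Data.Nat.Properties as ℕP
  open import Data.Integer as ℤ using (ℤ; +_)
  import Data.Integer.Properties as ℤP
  open import Data.Integer.Tactic.RingSolver using (solve-∀)
  open import Data.Fin using (Fin; zero; suc; _↑ˡ_; _↑ʳ_)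
  open import Data.Vec using (Vec; []; _∷_; lookup; take; drop; _++_)
  open import Data.Vec.Properties using (take++drop≡id; lookup-++ˡ; lookup-++ʳ)
  open import Data.List as List using (List; []; _∷_; map)
  open import Function using (_∘_)
  open import Relation.Binary.PropositionalEquality
  open ≡-Reasoning

  open Sums
  open StepPolynomials
  open Digits

  _+ᴸ_ : ∀ {D} → LPoly D → LPoly D → LPoly D
  []       +ᴸ Ms       = Ms
  (L ∷ Ls) +ᴸ []       = L ∷ Ls
  (L ∷ Ls) +ᴸ (M ∷ Ms) = (L ⊞ M) ∷ (Ls +ᴸ Ms)

  _*ᴸ_ : ∀ {D} → ZPoly → LPoly D → LPoly D
  []       *ᴸ Ls = []
  (a ∷ as) *ᴸ Ls = map (a ⊡_) Ls +ᴸ (con (+ 0) ∷ (as *ᴸ Ls))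

  eval-+ᴸ : ∀ {D} (Ls Ms : LPoly D) m y → evalL (Ls +ᴸ Ms) m y ≡ evalL Ls m y ℤ.+ evalL Ms m y
  eval-+ᴸ []       Ms       m y = sym (ℤP.+-identityˡ (evalL Ms m y))
  eval-+ᴸ (L ∷ Ls) []       m y = sym (ℤP.+-identityʳ (evalL (L ∷ Ls) m y))
  eval-+ᴸ (L ∷ Ls) (M ∷ Ms) m y = trans (cong (λ t → ⟦ L ⟧ℓ m y ℤ.+ ⟦ M ⟧ℓ m y ℤ.+ + suc m ℤ.* t) (eval-+ᴸ Ls Ms m y)) (r (⟦ L ⟧ℓ m y) (⟦ M ⟧ℓ m y) (+ suc m) (evalL Ls m y) (evalL Ms m y))
    where
    r : ∀ a b t u v → a ℤ.+ b ℤ.+ t ℤ.* (u ℤ.+ v) ≡ (a ℤ.+ t ℤ.* u) ℤ.+ (b ℤ.+ t ℤ.* v)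
    r = solve-∀

  eval-map⊡ : ∀ {D} a (Ls : LPoly D) m y → evalL (map (a ⊡_) Ls) m y ≡ a ℤ.* evalL Ls m y
  eval-map⊡ a []       m y = sym (ℤP.*-zeroʳ a)
  eval-map⊡ a (L ∷ Ls) m y = trans (cong (λ t → a ℤ.* ⟦ L ⟧ℓ m y ℤ.+ + suc m ℤ.* t) (eval-map⊡ a Ls m y)) (r a (⟦ L ⟧ℓ m y) (+ suc m) (evalL Ls m y))
    where
    r : ∀ a b t v → a ℤ.* b ℤ.+ t ℤ.* (a ℤ.* v) ≡ a ℤ.* (b ℤ.+ t ℤ.* v)
    r = solve-∀

  eval-*ᴸ : ∀ {D} p (Ls : LPoly D) m y → evalL (p *ᴸ Ls) m y ≡ evalℤ p (+ suc m) ℤ.* evalL Ls m y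
  eval-*ᴸ []       Ls m y = sym (ℤP.*-zeroˡ (evalL Ls m y))
  eval-*ᴸ (a ∷ as) Ls m y = trans (eval-+ᴸ (map (a ⊡_) Ls) (con (+ 0) ∷ (as *ᴸ Ls)) m y)
    (trans (cong₂ (λ u v → u ℤ.+ (+ 0 ℤ.+ + suc m ℤ.* v)) (eval-map⊡ a Ls m y) (eval-*ᴸ as Ls m y)) (r a (+ suc m) (evalℤ as (+ suc m)) (evalL Ls m y)))
    where
    r : ∀ a t u v → a ℤ.* v ℤ.+ (+ 0 ℤ.+ t ℤ.* (u ℤ.* v)) ≡ (a ℤ.+ t ℤ.* u) ℤ.* v
    r = solve-∀

  constᴸ : ∀ {D} → ZPoly → LPoly D
  constᴸ = map con

  eval-constᴸ : ∀ {D} p m (y : Vec ℕ D) → evalL (constᴸ p) m y ≡ evalℤ p (+ suc m)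
  eval-constᴸ []      m y = refl
  eval-constᴸ (a ∷ p) m y = cong (λ t → a ℤ.+ + suc m ℤ.* t) (eval-constᴸ p m y)

  sumᴸ : ∀ {D} d → (Fin d → LPoly D) → LPoly D
  sumᴸ zero    f = []
  sumᴸ (suc d) f = f zero +ᴸ sumᴸ d (f ∘ suc)

  eval-sumᴸ : ∀ {D} d (f : Fin d → LPoly D) (g : Fin d → ℤ) m y → (∀ j → evalL (f j) m y ≡ g j) → evalL (sumᴸ d f) m y ≡ sumℤ d g
  eval-sumᴸ zero    f g m y e = refl
  eval-sumᴸ (suc d) f g m y e = trans (eval-+ᴸ (f zero) (sumᴸ d (f ∘ suc)) m y) (cong₂ ℤ._+_ (e zero) (eval-sumᴸ d (f ∘ suc) (g ∘ suc) m y (e ∘ suc)))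

  monomial : ℕ → ZPoly
  monomial zero    = + 1 ∷ []
  monomial (suc k) = + 0 ∷ monomial k

  eval-monomial : ∀ k n → evalℤ (monomial k) (+ n) ≡ + (n ℕ.^ k)
  eval-monomial zero    n = trans (cong (λ t → + 1 ℤ.+ t) (ℤP.*-zeroʳ (+ n))) refl
  eval-monomial (suc k) n = trans (ℤP.+-identityˡ _) (trans (cong (+ n ℤ.*_) (eval-monomial k n)) (sym (ℤP.pos-* n (n ℕ.^ k))))

  renameℓ : ∀ {D E} → (Fin D → Fin E) → Lin D → Lin E
  renameℓ ρ (con z) = con z
  renameℓ ρ prm     = prm
  renameℓ ρ (var i) = var (ρ i)
  renameℓ ρ (a ⊞ b) = renameℓ ρ a ⊞ renameℓ ρ b
  renameℓ ρ (z ⊡ a) = z ⊡ renameℓ ρ a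

  renameℓ-eval : ∀ {D E} (ρ : Fin D → Fin E) (a : Lin D) m y z → (∀ i → lookup z (ρ i) ≡ lookup y i) → ⟦ renameℓ ρ a ⟧ℓ m z ≡ ⟦ a ⟧ℓ m y
  renameℓ-eval ρ (con c) m y z e = refl
  renameℓ-eval ρ prm     m y z e = refl
  renameℓ-eval ρ (var i) m y z e = cong +_ (e i)
  renameℓ-eval ρ (a ⊞ b) m y z e = cong₂ ℤ._+_ (renameℓ-eval ρ a m y z e) (renameℓ-eval ρ b m y z e)
  renameℓ-eval ρ (c ⊡ a) m y z e = cong (c ℤ.*_) (renameℓ-eval ρ a m y z e)

  rename-eval : ∀ {D E} (ρ : Fin D → Fin E) (Ls : LPoly D) m y z → (∀ i → lookup z (ρ i) ≡ lookup y i) → evalL (map (renameℓ ρ) Ls) m z ≡ evalL Ls m y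
  rename-eval ρ []       m y z e = refl
  rename-eval ρ (L ∷ Ls) m y z e = cong₂ (λ s t → s ℤ.+ + suc m ℤ.* t) (renameℓ-eval ρ L m y z e) (rename-eval ρ Ls m y z e)

  -- Lowest digit first, in agreement with `evalL` and with the innermost variable of `box`.
  horner : ∀ {K} → ℕ → Vec ℕ K → ℕ
  horner b []      = 0
  horner b (r ∷ u) = r ℕ.+ horner b u ℕ.* b

  eval-tabulate-var : ∀ {D} K (ρ : Fin K → Fin D) m y (u : Vec ℕ K) → (∀ i → lookup y (ρ i) ≡ lookup u i) →
    evalL (List.tabulate (var ∘ ρ)) m y ≡ + horner (suc m) u
  eval-tabulate-var zero    ρ m y []      e = refl
  eval-tabulate-var (suc K) ρ m y (r ∷ u) e = trans (cong₂ (λ s t → + s ℤ.+ + suc m ℤ.* t) (e zero) (eval-tabulate-var K (ρ ∘ suc) m y u (e ∘ suc)))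
    (trans (cong (λ t → + r ℤ.+ t) (trans (ℤP.*-comm (+ suc m) (+ horner (suc m) u)) (sym (ℤP.pos-* (horner (suc m) u) (suc m))))) (sym (ℤP.pos-+ r (horner (suc m) u ℕ.* suc m))))

  module _ (K : ℕ) where

    undigits : ∀ d → ℕ → Vec ℕ (d ℕ.* K) → Vec ℕ d
    undigits zero    b ds = []
    undigits (suc d) b ds = horner b (take K ds) ∷ undigits d b (drop K ds)

    -- The digits of the coordinates stand in consecutive blocks of length `K`; the renaming skips
    -- the first block.
    coordinate : ∀ d → Fin d → LPoly (d ℕ.* K)
    coordinate (suc d) zero    = List.tabulate (λ i → var (i ↑ˡ (d ℕ.* K)))
    coordinate (suc d) (suc j) = map (renameℓ (K ↑ʳ_)) (coordinate d j)

    eval-coordinate : ∀ d j m ds → evalL (coordinate d j) m ds ≡ + lookup (undigits d (suc m) ds) j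
    eval-coordinate (suc d) zero    m ds = eval-tabulate-var K (_↑ˡ (d ℕ.* K)) m ds (take K ds)
      (λ i → trans (cong (λ v → lookup v (i ↑ˡ (d ℕ.* K))) (sym (take++drop≡id K ds))) (lookup-++ˡ (take K ds) (drop K ds) i))
    eval-coordinate (suc d) (suc j) m ds = trans (rename-eval (K ↑ʳ_) (coordinate d j) m (drop K ds) ds
      (λ i → trans (cong (λ v → lookup v (K ↑ʳ i)) (sym (take++drop≡id K ds))) (lookup-++ʳ (take K ds) (drop K ds) i))) (eval-coordinate d j m (drop K ds))

  take-++ : ∀ {A : Set} {p q} (u : Vec A p) (w : Vec A q) → take p (u ++ w) ≡ u
  take-++ []      w = refl
  take-++ (x ∷ u) w = cong (x ∷_) (take-++ u w)

  drop-++ : ∀ {A : Set} {p q} (u : Vec A p) (w : Vec A q) → drop p (u ++ w) ≡ w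
  drop-++ []      w = refl
  drop-++ (x ∷ u) w = drop-++ u w

  -- Splitting off the lowest digit leaves the higher ones outermost, as the order of summation in
  -- `box` requires.
  ∑-digits : ∀ b K g → ∑ (b ℕ.^ K) g ≡ box b K (λ u → g (horner b u))
  ∑-digits b zero    g = ℚP.+-identityʳ (g 0)
  ∑-digits b (suc K) g = begin
    ∑ (b ℕ.* b ℕ.^ K) g                                          ≡⟨ cong (λ t → ∑ t g) (ℕP.*-comm b (b ℕ.^ K)) ⟩
    ∑ (b ℕ.^ K ℕ.* b) g                                          ≡⟨ ∑-blocks (b ℕ.^ K) b g ⟩
    ∑ (b ℕ.^ K) (λ q → ∑ b (λ r → g (r ℕ.+ q ℕ.* b)))            ≡⟨ ∑-digits b K (λ q → ∑ b (λ r → g (r ℕ.+ q ℕ.* b))) ⟩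
    box b K (λ u → ∑ b (λ r → g (r ℕ.+ horner b u ℕ.* b))) ∎

  box-digits : ∀ b K d G → box (b ℕ.^ K) d G ≡ box b (d ℕ.* K) (λ ds → G (undigits K d b ds))
  box-digits b K zero    G = refl
  box-digits b K (suc d) G = begin
    box (b ℕ.^ K) d (λ v → ∑ (b ℕ.^ K) (λ x → G (x ∷ v)))                                ≡⟨ box-cong (b ℕ.^ K) d (λ v → ∑-digits b K (λ x → G (x ∷ v))) ⟩
    box (b ℕ.^ K) d (λ v → box b K (λ u → G (horner b u ∷ v)))                           ≡⟨ box-digits b K d (λ v → box b K (λ u → G (horner b u ∷ v))) ⟩
    box b (d ℕ.* K) (λ w → box b K (λ u → G (horner b u ∷ undigits K d b w)))
      ≡⟨ box-cong b (d ℕ.* K) (λ w → box-cong b K (λ u → cong₂ (λ s t → G (horner b s ∷ undigits K d b t)) (sym (take-++ u w)) (sym (drop-++ u w)))) ⟩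
    box b (d ℕ.* K) (λ w → box b K (λ u → G (undigits K (suc d) b (u ++ w))))            ≡⟨ box-++ b K (d ℕ.* K) (λ ds → G (undigits K (suc d) b ds)) ⟨
    box b (K ℕ.+ d ℕ.* K) (λ ds → G (undigits K (suc d) b ds)) ∎

-- Counting lists of points by sums of indicators.

module PointLists where

  open import Data.Nat as ℕ using (ℕ; zero; suc)
  open import Data.Vec using (Vec; []; _∷_)
  open import Data.Vec.Properties using (∷-injective)
  open import Data.Vec.Relation.Unary.All as VAll using ([]; _∷_)
  open import Data.List using (List; []; _∷_; map; _++_; length; filter; cartesianProductWith; upTo; applyUpTo)
  open import Data.List.Membership.Propositional using (_∈_)
  open import Data.List.Membership.Propositional.Properties using (∈-cartesianProductWith⁺; ∈-upTo⁺)
  open import Data.List.Relation.Unary.Any using (here)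
  open import Data.List.Relation.Unary.Unique.Propositional using (Unique; []; _∷_)
  open import Data.List.Relation.Unary.Unique.Propositional.Properties using (cartesianProductWith⁺; upTo⁺)
  import Data.List.Relation.Unary.All as All
  open import Data.Product using (swap)
  open import Data.Integer using (+_)
  open import Relation.Nullary using (¬_; yes; no)
  open import Relation.Unary using (Decidable)
  open import Relation.Binary.PropositionalEquality
  open ℚ using (ℚ; 0ℚ; 1ℚ)
  open Embedding
  open Sums

  ∑ᴸ : ∀ {A : Set} → (A → ℚ) → List A → ℚ
  ∑ᴸ g []       = 0ℚ
  ∑ᴸ g (x ∷ xs) = g x ℚ.+ ∑ᴸ g xs

  ∑ᴸ-cong : ∀ {A : Set} {g h : A → ℚ} → (∀ x → g x ≡ h x) → ∀ xs → ∑ᴸ g xs ≡ ∑ᴸ h xs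
  ∑ᴸ-cong e []       = refl
  ∑ᴸ-cong e (x ∷ xs) = cong₂ ℚ._+_ (e x) (∑ᴸ-cong e xs)

  ∑ᴸ-map : ∀ {A B : Set} (g : B → ℚ) (h : A → B) xs → ∑ᴸ g (map h xs) ≡ ∑ᴸ (λ x → g (h x)) xs
  ∑ᴸ-map g h []       = refl
  ∑ᴸ-map g h (x ∷ xs) = cong (g (h x) ℚ.+_) (∑ᴸ-map g h xs)

  ∑ᴸ-++ : ∀ {A : Set} (g : A → ℚ) xs ys → ∑ᴸ g (xs ++ ys) ≡ ∑ᴸ g xs ℚ.+ ∑ᴸ g ys
  ∑ᴸ-++ g []       ys = sym (ℚP.+-identityˡ (∑ᴸ g ys))
  ∑ᴸ-++ g (x ∷ xs) ys = trans (cong (g x ℚ.+_) (∑ᴸ-++ g xs ys)) (sym (ℚP.+-assoc (g x) (∑ᴸ g xs) (∑ᴸ g ys)))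

  ∑ᴸ-product : ∀ {A B C : Set} (g : C → ℚ) (f : A → B → C) xs ys →
    ∑ᴸ g (cartesianProductWith f xs ys) ≡ ∑ᴸ (λ x → ∑ᴸ (λ y → g (f x y)) ys) xs
  ∑ᴸ-product g f []       ys = refl
  ∑ᴸ-product g f (x ∷ xs) ys = trans (∑ᴸ-++ g (map (f x) ys) (cartesianProductWith f xs ys)) (cong₂ ℚ._+_ (∑ᴸ-map g (f x) ys) (∑ᴸ-product g f xs ys))

  ∑ᴸ-applyUpTo : ∀ {A : Set} (g : A → ℚ) h b → ∑ᴸ g (applyUpTo h b) ≡ ∑ b (λ i → g (h i))
  ∑ᴸ-applyUpTo g h zero    = refl
  ∑ᴸ-applyUpTo g h (suc b) = cong (g (h 0) ℚ.+_) (∑ᴸ-applyUpTo g (λ i → h (suc i)) b)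

  length-filter-∑ : ∀ {A : Set} {P : A → Set} (P? : Decidable P) (g : A → ℚ) →
    (∀ x → P x → g x ≡ 1ℚ) → (∀ x → ¬ P x → g x ≡ 0ℚ) → ∀ xs → ℕtoℚ (length (filter P? xs)) ≡ ∑ᴸ g xs
  length-filter-∑ P? g yes₁ no₀ []       = refl
  length-filter-∑ P? g yes₁ no₀ (x ∷ xs) with P? x
  ... | yes p = trans (ι-+ (+ 1) (+ length (filter P? xs))) (cong₂ ℚ._+_ (sym (yes₁ x p)) (length-filter-∑ P? g yes₁ no₀ xs))
  ... | no ¬p = trans (length-filter-∑ P? g yes₁ no₀ xs) (sym (trans (cong (ℚ._+ ∑ᴸ g xs) (no₀ x ¬p)) (ℚP.+-identityˡ (∑ᴸ g xs))))

  boxList : ℕ → ∀ d → List (Vec ℕ d)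
  boxList b zero    = [] ∷ []
  boxList b (suc d) = cartesianProductWith (λ v x → x ∷ v) (boxList b d) (upTo b)

  boxList-∑ : ∀ b d F → ∑ᴸ F (boxList b d) ≡ box b d F
  boxList-∑ b zero    F = ℚP.+-identityʳ (F [])
  boxList-∑ b (suc d) F = trans (∑ᴸ-product F (λ v x → x ∷ v) (boxList b d) (upTo b))
    (trans (∑ᴸ-cong (λ v → ∑ᴸ-applyUpTo (λ x → F (x ∷ v)) (λ i → i) b) (boxList b d)) (boxList-∑ b d (λ v → ∑ b (λ x → F (x ∷ v)))))

  boxList-complete : ∀ b d v → VAll.All (ℕ._< b) v → v ∈ boxList b d
  boxList-complete b zero    []      []       = here refl
  boxList-complete b (suc d) (x ∷ v) (p ∷ ps) = ∈-cartesianProductWith⁺ (λ v x → x ∷ v) (boxList-complete b d v ps) (∈-upTo⁺ p)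

  boxList-unique : ∀ b d → Unique (boxList b d)
  boxList-unique b zero    = All.[] ∷ []
  boxList-unique b (suc d) = cartesianProductWith⁺ (λ v x → x ∷ v) (λ e → swap (∷-injective e)) (boxList-unique b d) (upTo⁺ b)

-- The lattice points of P(n).

module LatticePoints {r d : ℕ} (V : PolyMatrix r d) (c : PolyVector r) where

  open import Data.Nat as ℕ using (ℕ; zero; suc)
  import Data.Nat.Properties as ℕP
  open import Data.Nat.DivMod using (_mod_)
  open import Data.Integer as ℤ using (ℤ; +_)
  import Data.Integer.Properties as ℤP
  open import Data.Integer.Tactic.RingSolver using (solve-∀)
  open import Data.Fin using (Fin; zero; suc)
  open import Data.Fin.Properties using (all?)
  open import Data.Vec as Vec using (Vec; []; _∷_; lookup)
  open import Data.Vec.Properties using (lookup-map)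
  import Data.Vec.Relation.Unary.All as VAll
  open import Data.Vec.Relation.Unary.All.Properties using (lookup⁺; lookup⁻)
  open import Data.List as List using (List; []; _∷_; map; length; filter)
  open import Data.List.Membership.Propositional using (_∈_)
  open import Data.List.Membership.Propositional.Properties using (∈-map⁺; ∈-filter⁺; ∈-filter⁻)
  open import Data.List.Relation.Unary.Unique.Propositional using (Unique)
  import Data.List.Relation.Unary.Unique.Propositional.Properties as UniqueP
  open import Data.List.Relation.Unary.All.Properties using (tabulate⁺; tabulate⁻)
  open import Data.Product using (Σ; ∃; _×_; _,_; proj₁; proj₂)
  open import Data.Sum using (inj₁; inj₂)
  open import Data.Empty using (⊥-elim)
  open import Function using (_∘_)
  open import Function.Bundles using (_⇔_; mk⇔)
  open import Relation.Nullary using (¬_)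
  open import Relation.Unary using (Decidable)
  open import Relation.Binary.PropositionalEquality
  open ≡-Reasoning
  open ℚ using (ℚ; 0ℚ; 1ℚ)
  open Embedding
  open Sums
  open Indicator
  open StepPolynomials
  open EventualSign
  open QuasiPolynomials
  open BoxSums using (EQP-box-sum)
  open FourierMotzkin
  open PolynomialBound
  open Digits
  open DigitForms
  open PointLists

  ∏ : ∀ s → (Fin s → ℚ) → ℚ
  ∏ zero    f = 1ℚ
  ∏ (suc s) f = f zero ℚ.* ∏ s (f ∘ suc)

  ∏-cong : ∀ s {f g} → (∀ i → f i ≡ g i) → ∏ s f ≡ ∏ s g
  ∏-cong zero    e = refl
  ∏-cong (suc s) e = cong₂ ℚ._*_ (e zero) (∏-cong s (e ∘ suc))

  ∏-yes : ∀ s (a : Fin s → ℤ) → (∀ i → NonNeg (a i)) → ∏ s (χ ∘ a) ≡ 1ℚ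
  ∏-yes zero    a p = refl
  ∏-yes (suc s) a p = cong₂ ℚ._*_ (χ-yes (p zero)) (∏-yes s (a ∘ suc) (p ∘ suc))

  ∏-no : ∀ s (a : Fin s → ℤ) → ¬ (∀ i → NonNeg (a i)) → ∏ s (χ ∘ a) ≡ 0ℚ
  ∏-no zero    a ¬p = ⊥-elim (¬p λ ())
  ∏-no (suc s) a ¬p with sign (a zero)
  ... | inj₂ h = trans (cong (ℚ._* ∏ s (χ ∘ a ∘ suc)) (χ-no h)) (ℚP.*-zeroˡ (∏ s (χ ∘ a ∘ suc)))
  ... | inj₁ h = trans (cong (χ (a zero) ℚ.*_) (∏-no s (a ∘ suc) (λ p → ¬p λ { zero → h ; (suc i) → p i }))) (ℚP.*-zeroʳ (χ (a zero)))

  ∏Fn : ∀ {D} s → (Fin s → Fn D) → Fn D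
  ∏Fn zero    f = con 1ℚ
  ∏Fn (suc s) f = f zero ⊗ ∏Fn s (f ∘ suc)

  ∏Fn-eval : ∀ {D} s (f : Fin s → Fn D) n y → ⟦ ∏Fn s f ⟧ n y ≡ ∏ s (λ i → ⟦ f i ⟧ n y)
  ∏Fn-eval zero    f n y = refl
  ∏Fn-eval (suc s) f n y = cong (⟦ f zero ⟧ n y ℚ.*_) (∏Fn-eval s (f ∘ suc) n y)

  slack : ℕ → (Fin d → ℤ) → Fin r → ℤ
  slack n x i = sumℤ d (λ j → evalℤ (V i j) (+ n) ℤ.* x j) ℤ.+ -1ℤ ℤ.* evalℤ (c i) (+ n)

  slack-NonNeg : ∀ n x → InPℤ V c n x → ∀ i → NonNeg (slack n x i)
  slack-NonNeg n x p i = subst NonNeg (eq (sumℤ d (λ j → evalℤ (V i j) (+ n) ℤ.* x j)) (evalℤ (c i) (+ n))) (ℤP.i≤j⇒0≤j-i (p i))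
    where
    eq : ∀ s c → s ℤ.- c ≡ s ℤ.+ -1ℤ ℤ.* c
    eq = solve-∀

  NonNeg-slack : ∀ n x → (∀ i → NonNeg (slack n x i)) → InPℤ V c n x
  NonNeg-slack n x p i = ℤP.0≤i-j⇒j≤i (subst NonNeg (eq (sumℤ d (λ j → evalℤ (V i j) (+ n) ℤ.* x j)) (evalℤ (c i) (+ n))) (p i))
    where
    eq : ∀ s c → s ℤ.+ -1ℤ ℤ.* c ≡ s ℤ.- c
    eq = solve-∀

  inside : ℕ → (Fin d → ℤ) → ℚ
  inside n x = ∏ r (χ ∘ slack n x)

  InP? : ∀ n → Decidable (λ (x : Vec ℤ d) → InPℤ V c n (lookup x))
  InP? n x = all? (λ i → evalℤ (c i) (+ n) ℤ.≤? sumℤ d (λ j → evalℤ (V i j) (+ n) ℤ.* lookup x j))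

  -- Points of the cube [-n^k, n^(k+1) - n^k)^d, shifted to have coordinates in [0, n^(k+1)).
  module _ (k : ℕ) where

    unshift : ℕ → Vec ℕ d → Vec ℤ d
    unshift n = Vec.map (λ t → + t ℤ.+ -1ℤ ℤ.* + (n ℕ.^ k))

    -- Defined for every n as the count within the cube; it counts all of P(n) once the cube is
    -- known to contain its lattice points.
    count : ℕ → ℚ
    count n = box (n ℕ.^ suc k) d (λ z → inside n (lookup (unshift n z)))

    -- The slack of a constraint as a polynomial in the base. The matrix entries, the shift and the
    -- right-hand side are polynomials in that base too, so after collecting powers only constants
    -- multiply the digits.
    row-form : Fin r → LPoly (d ℕ.* suc k)
    row-form i = sumᴸ d (λ j → V i j *ᴸ (coordinate (suc k) d j +ᴸ constᴸ (map (-1ℤ ℤ.*_) (monomial k)))) +ᴸ constᴸ (map (-1ℤ ℤ.*_) (c i))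

    row-form-eval : ∀ i m ds → evalL (row-form i) m ds ≡ slack (suc m) (lookup (unshift (suc m) (undigits (suc k) d (suc m) ds))) i
    row-form-eval i m ds = trans (eval-+ᴸ (sumᴸ d _) (constᴸ (map (-1ℤ ℤ.*_) (c i))) m ds) (cong₂ ℤ._+_
        (eval-sumᴸ d _ _ m ds (λ j → trans (eval-*ᴸ (V i j) (coordinate (suc k) d j +ᴸ constᴸ (map (-1ℤ ℤ.*_) (monomial k))) m ds) (cong (evalℤ (V i j) (+ suc m) ℤ.*_) (coord j))))
        (trans (eval-constᴸ (map (-1ℤ ℤ.*_) (c i)) m ds) (eval-map*ᶻ -1ℤ (c i) (+ suc m))))
      where
      z : Vec ℕ d
      z = undigits (suc k) d (suc m) ds
      coord : ∀ j → evalL (coordinate (suc k) d j +ᴸ constᴸ (map (-1ℤ ℤ.*_) (monomial k))) m ds ≡ lookup (unshift (suc m) z) j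
      coord j = trans (eval-+ᴸ (coordinate (suc k) d j) (constᴸ (map (-1ℤ ℤ.*_) (monomial k))) m ds)
        (trans (cong₂ ℤ._+_ (eval-coordinate (suc k) d j m ds)
                 (trans (eval-constᴸ (map (-1ℤ ℤ.*_) (monomial k)) m ds) (trans (eval-map*ᶻ -1ℤ (monomial k) (+ suc m)) (cong (-1ℤ ℤ.*_) (eval-monomial k (suc m))))))
               (sym (lookup-map j (λ t → + t ℤ.+ -1ℤ ℤ.* + (suc m ℕ.^ k)) z)))

    membership : Fn (d ℕ.* suc k)
    membership = ∏Fn r (λ i → carry (row-form i) (+ 0))

    membership-eval : ∀ m ds → VAll.All (ℕ._< suc m) ds →
      inside (suc m) (lookup (unshift (suc m) (undigits (suc k) d (suc m) ds))) ≡ ⟦ membership ⟧ m ds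
    membership-eval m ds ds< = sym (trans (∏Fn-eval r (λ i → carry (row-form i) (+ 0)) m ds)
      (∏-cong r (λ i → trans (carry-correct (row-form i) (+ 0) m ds ds<) (cong χ (trans (ℤP.+-identityʳ (evalL (row-form i) m ds)) (row-form-eval i m ds))))))

    count-box : ∀ m → count (suc m) ≡ box (suc m) (d ℕ.* suc k) (⟦ membership ⟧ m)
    count-box m = trans (box-digits (suc m) (suc k) d (λ z → inside (suc m) (lookup (unshift (suc m) z))))
      (box-cong-< (suc m) (d ℕ.* suc k) (membership-eval m))

    count-EQP : EQP count
    -- The count at m + 1 is a sum with parameter m, hence the shift.
    count-EQP = EQP-unshift {count} (EQP-ext {λ m → count (suc m)} {λ m → box (suc m) (d ℕ.* suc k) (⟦ membership ⟧ m)} count-box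
      (EQP-box-sum (d ℕ.* suc k) membership))

    points : ℕ → List (Vec ℤ d)
    points n = filter (InP? n) (map (unshift n) (boxList (n ℕ.^ suc k) d))

    unshift-injective : ∀ n {z w} → unshift n z ≡ unshift n w → z ≡ w
    unshift-injective n {z} {w} e = vec-injective z w e
      where
      r₀ : ∀ t s → t ≡ (t ℤ.+ -1ℤ ℤ.* s) ℤ.+ s
      r₀ = solve-∀
      vec-injective : ∀ {e} (z w : Vec ℕ e) → Vec.map (λ t → + t ℤ.+ -1ℤ ℤ.* + (n ℕ.^ k)) z ≡ Vec.map (λ t → + t ℤ.+ -1ℤ ℤ.* + (n ℕ.^ k)) w → z ≡ w
      vec-injective []      []      _ = refl
      vec-injective (t ∷ z) (u ∷ w) e = cong₂ _∷_
        (ℤP.+-injective (trans (r₀ (+ t) (+ (n ℕ.^ k))) (trans (cong (ℤ._+ + (n ℕ.^ k)) (cong Vec.head e)) (sym (r₀ (+ u) (+ (n ℕ.^ k)))))))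
        (vec-injective z w (cong Vec.tail e))

    points-unique : ∀ n → Unique (points n)
    points-unique n = UniqueP.filter⁺ (InP? n) (UniqueP.map⁺ (unshift-injective n) (boxList-unique (n ℕ.^ suc k) d))

    points-length : ∀ n → ℕtoℚ (length (points n)) ≡ count n
    points-length n = trans (length-filter-∑ (InP? n) (inside n ∘ lookup)
        (λ x p → ∏-yes r (slack n (lookup x)) (slack-NonNeg n (lookup x) p))
        (λ x ¬p → ∏-no r (slack n (lookup x)) (λ p → ¬p (NonNeg-slack n (lookup x) p)))
        (map (unshift n) (boxList (n ℕ.^ suc k) d)))
      (trans (∑ᴸ-map (inside n ∘ lookup) (unshift n) (boxList (n ℕ.^ suc k) d)) (boxList-∑ (n ℕ.^ suc k) d (λ z → inside n (lookup (unshift n z)))))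

    Confined : ℕ → Set
    Confined n = ∀ (x : Vec ℤ d) → InPℤ V c n (lookup x) → ∀ j → NonNeg (+ (n ℕ.^ k) ℤ.+ lookup x j) × NonNeg (+ (n ℕ.^ k) ℤ.+ ℤ.- lookup x j)

    -- With B = n^k the shifted coordinates lie between 0 and 2B, and 2B < 3B ≤ n^(k+1); this is the
    -- origin of n ≥ 3.
    points-complete : ∀ n → 3 ℕ.≤ n → Confined n → ∀ x → InPℤ V c n (lookup x) → x ∈ points n
    points-complete n@(suc _) n≥3 conf x p = ∈-filter⁺ (InP? n) (subst (_∈ map (unshift n) (boxList (n ℕ.^ suc k) d)) x≡ (∈-map⁺ (unshift n) (boxList-complete (n ℕ.^ suc k) d z z<))) p
      where
      B : ℕ
      B = n ℕ.^ k
      up : ℤ → ℕ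
      up t = ℤ.∣ + B ℤ.+ t ∣
      z : Vec ℕ d
      z = Vec.map up x
      e₁ : ∀ b t → (b ℤ.+ t) ℤ.+ -1ℤ ℤ.* b ≡ t
      e₁ = solve-∀
      x≡ : unshift n z ≡ x
      x≡ = pointwise x (λ j → proj₁ (conf x p j))
        where
        pointwise : ∀ {e} (x : Vec ℤ e) → (∀ j → NonNeg (+ B ℤ.+ lookup x j)) → Vec.map (λ t → + t ℤ.+ -1ℤ ℤ.* + B) (Vec.map up x) ≡ x
        pointwise []      h = refl
        pointwise (t ∷ x) h = cong₂ _∷_ (trans (cong (ℤ._+ -1ℤ ℤ.* + B) (ℤP.0≤i⇒+∣i∣≡i (h zero))) (e₁ (+ B) t)) (pointwise x (h ∘ suc))
      e₂ : ∀ b t → b ℤ.+ ℤ.- t ≡ (b ℤ.+ b) ℤ.- (b ℤ.+ t)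
      e₂ = solve-∀
      up< : ∀ t → NonNeg (+ B ℤ.+ t) → NonNeg (+ B ℤ.+ ℤ.- t) → up t ℕ.< n ℕ.^ suc k
      up< t lo hi = ℕP.<-≤-trans (ℕ.s≤s up≤) (ℕP.≤-trans (ℕP.≤-trans (ℕP.+-monoˡ-≤ (B ℕ.+ B) (ℕP.m^n>0 n k)) (ℕP.≤-reflexive (cong (λ u → B ℕ.+ (B ℕ.+ u)) (sym (ℕP.+-identityʳ B))))) (ℕP.*-monoˡ-≤ B n≥3))
        where
        up≤ : up t ℕ.≤ B ℕ.+ B
        up≤ = ℤP.drop‿+≤+ (ℤP.0≤i-j⇒j≤i (subst NonNeg (trans (e₂ (+ B) t) (cong₂ (λ u v → u ℤ.- v) (sym (ℤP.pos-+ B B)) (sym (ℤP.0≤i⇒+∣i∣≡i lo)))) hi))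
      z< : VAll.All (ℕ._< n ℕ.^ suc k) z
      z< = lookup⁻ (λ j → subst (ℕ._< n ℕ.^ suc k) (sym (lookup-map j up x)) (up< (lookup x j) (proj₁ (conf x p j)) (proj₂ (conf x p j))))

    point-count : ∀ n → 3 ℕ.≤ n → Confined n → HasIntPointCount V c n (length (points n))
    point-count n n≥3 conf = points n , points-unique n , (λ x → mk⇔ (λ x∈ → proj₂ (∈-filter⁻ (InP? n) {xs = map (unshift n) (boxList (n ℕ.^ suc k) d)} x∈)) (points-complete n n≥3 conf x)) , refl

  row : ∀ {d} → (Fin d → ZPoly) → ZPoly → Row d
  row {zero}  a b = map (-1ℤ ℤ.*_) b ∷ []
  row {suc d} a b = a zero ∷ row (a ∘ suc) b

  val-row : ∀ {d} (a : Fin d → ZPoly) b n x → val (row a b) n x ≡ sumℚ d (λ j → ι (evalℤ (a j) (+ n)) ℚ.* lookup x j) ℚ.+ ℚ.- ι (evalℤ b (+ n))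
  val-row {zero}  a b n []      = trans (cong ι (trans (eval-map*ᶻ -1ℤ b (+ n)) (eq (evalℤ b (+ n))))) (trans (ι-neg (evalℤ b (+ n))) (sym (ℚP.+-identityˡ (ℚ.- ι (evalℤ b (+ n))))))
    where
    eq : ∀ b → -1ℤ ℤ.* b ≡ ℤ.- b
    eq = solve-∀
  val-row {suc d} a b n (x ∷ y) = trans (cong (ι (evalℤ (a zero) (+ n)) ℚ.* x ℚ.+_) (val-row (a ∘ suc) b n y)) (sym (ℚP.+-assoc (ι (evalℤ (a zero) (+ n)) ℚ.* x) (sumℚ d (λ j → ι (evalℤ (a (suc j)) (+ n)) ℚ.* lookup y j)) (ℚ.- ι (evalℤ b (+ n)))))

  rows : List (Row d)
  rows = List.tabulate (λ i → row (V i) (c i))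

  Sat⇒InPℚ : ∀ n x → Sat rows n x → InPℚ V c n (lookup x)
  Sat⇒InPℚ n x h i = 0≤⇒≤ (subst (0ℚ ℚ.≤_) (val-row (V i) (c i) n x) (tabulate⁻ h i))

  InPℚ⇒Sat : ∀ n x → InPℚ V c n (lookup x) → Sat rows n x
  InPℚ⇒Sat n x h = tabulate⁺ (λ i → subst (0ℚ ℚ.≤_) (sym (val-row (V i) (c i) n x)) (≤⇒0≤ (h i)))

  p≤∣p∣ : ∀ p → p ℚ.≤ ℚ.∣ p ∣
  p≤∣p∣ p with ℚP.≤-total 0ℚ p
  ... | inj₁ h = ℚP.≤-reflexive (sym (ℚP.0≤p⇒∣p∣≡p h))
  ... | inj₂ h = ℚP.≤-trans h (ℚP.0≤∣p∣ p)

  ∣∣≤⇒Within : ∀ {B} p → ℚ.∣ p ∣ ℚ.≤ B → Within B p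
  ∣∣≤⇒Within {B} p h = within (≤⇒0≤ (ℚP.≤-trans (p≤∣p∣ p) h))
    (subst (λ t → 0ℚ ℚ.≤ B ℚ.+ t) (eq p) (≤⇒0≤ (ℚP.≤-trans (ℚP.≤-trans (p≤∣p∣ (ℚ.- p)) (ℚP.≤-reflexive (ℚP.∣-p∣≡∣p∣ p))) h)))
    where
    eq : ∀ p → ℚ.- (ℚ.- p) ≡ p
    eq = RS.solve-∀ ℚ-ring

  rows-bounded : ∀ n → BoundedP V c n → Bounded rows n
  rows-bounded n (B , h) = B , λ x s → lookup⁻ (λ j → ∣∣≤⇒Within (lookup x j) (h (lookup x) (Sat⇒InPℚ n x s) j))

  ι-sum : ∀ d (f : Fin d → ℤ) (g : Fin d → ℚ) → (∀ j → ι (f j) ≡ g j) → ι (sumℤ d f) ≡ sumℚ d g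
  ι-sum zero    f g e = refl
  ι-sum (suc d) f g e = trans (ι-+ (f zero) (sumℤ d (f ∘ suc))) (cong₂ ℚ._+_ (e zero) (ι-sum d (f ∘ suc) (g ∘ suc) (e ∘ suc)))

  InPℤ⇒Sat : ∀ n x → InPℤ V c n (lookup x) → Sat rows n (Vec.map ι x)
  InPℤ⇒Sat n x h = InPℚ⇒Sat n (Vec.map ι x) (λ i → ℚP.≤-trans (ι-mono (h i)) (ℚP.≤-reflexive
    (ι-sum d (λ j → evalℤ (V i j) (+ n) ℤ.* lookup x j) (λ j → ι (evalℤ (V i j) (+ n)) ℚ.* lookup (Vec.map ι x) j)
      (λ j → trans (ι-* (evalℤ (V i j) (+ n)) (lookup x j)) (cong (ι (evalℤ (V i j) (+ n)) ℚ.*_) (sym (lookup-map j ι x)))))))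

  confine : PolynomiallyBounded rows → ∃ λ k → Eventually (Confined k)
  confine (b , (k , b≤) , w) = k , ev-zip go b≤ w
    where
    go : ∀ n → b n ℕ.≤ n ℕ.^ k → (∀ x → Sat rows n x → VAll.All (Within (ℕtoℚ (b n))) x) → Confined k n
    go n le f x p j = ι-cancel (subst (0ℚ ℚ.≤_) (sym (ι-+ (+ (n ℕ.^ k)) (lookup x j))) (Within.below wj))
                    , ι-cancel (subst (0ℚ ℚ.≤_) (trans (cong (ℕtoℚ (n ℕ.^ k) ℚ.+_) (sym (ι-neg (lookup x j)))) (sym (ι-+ (+ (n ℕ.^ k)) (ℤ.- lookup x j)))) (Within.above wj))
      where
      wj : Within (ℕtoℚ (n ℕ.^ k)) (ι (lookup x j))
      wj = within-mono (ι-mono (ℤ.+≤+ le)) (subst (Within (ℕtoℚ (b n))) (lookup-map j ι x) (lookup⁺ (f (Vec.map ι x) (InPℤ⇒Sat n x p)) j))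

  eventually-confined : Eventually (BoundedP V c) → ∃ λ k → Eventually (Confined k)
  eventually-confined h = confine (poly-bound d rows (ev-map rows-bounded h))

  CountedBy : (k : ℕ) → (Fin (suc k) → QPoly) → ℕ → Set
  CountedBy k f n = ∃ λ p → HasIntPointCount V c n p × ℕtoℚ p ≡ evalℚ (f (n mod suc k)) (ℕtoℚ n)

  counted : (∃ λ k → Eventually (Confined k)) → ∃ λ k → Σ (Fin (suc k) → QPoly) λ f → Eventually (CountedBy k f)
  counted (k , conf) = proj₁ Q , proj₁ (proj₂ Q) , ev-zip
      (λ n (n≥3 , cf) e → length (points k n) , point-count k n n≥3 cf , trans (points-length k n) e)
      (ev-zip (λ n a b → a , b) (ev-≥ 3) conf) (proj₂ (proj₂ Q))
    where
    Q : ∃ λ k′ → Σ (Fin (suc k′) → QPoly) λ f → Eventually (λ n → count k n ≡ evalℚ (f (n mod suc k′)) (ℕtoℚ n))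
    Q = EQP⇒polynomials (count-EQP k)

  repackage : (∃ λ k → Σ (Fin (suc k) → QPoly) λ f → Eventually (CountedBy k f)) →
    ∃ λ s → Σ (ℕ.NonZero s) λ nz → ∃ λ (f : Fin s → QPoly) → ∃ λ N → ∀ n → n ℕ.≥ N →
      ∃ λ p → HasIntPointCount V c n p × ℕtoℚ p ≡ evalℚ (f ((n mod s) {{nz}})) (ℕtoℚ n)
  repackage (k , f , N , h) = suc k , _ , f , N , h

theorem2p1 : ∀ {r d : ℕ} (V : PolyMatrix r d) (c : PolyVector r) →
    (∃ λ N₀ → ∀ n → n ≥ N₀ → BoundedP V c n) →
    ∃ λ (s : ℕ) → Σ (NonZero s) λ nz → ∃ λ (f : Fin s → QPoly) → ∃ λ N → ∀ n → n ≥ N →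
    ∃ λ (k : ℕ) → HasIntPointCount V c n k ×
    ℕtoℚ k ≡ evalℚ (f ((n mod s) {{nz}})) (ℕtoℚ n)
theorem2p1 V c bounded = repackage (counted (eventually-confined bounded))
  where open LatticePoints V c
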